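{- Let $\mathcal H$ be a family of graphs and let $m:=\min\{\chi(H):H\in\mathcal H\}-1\ge2$. Consider the Turán problem $\mathrm{ex}(n,\mathcal H)$, i.e. the problem with $\kappa=2$, $\gamma(K_2)=1$, $\gamma(\overline{K_2})=0$ (so $\Lambda(G)=e(G)$) and admissible graphs $\mathcal G=\mathrm{Forb}(\mathcal H^\uparrow)$. Then: (1) The problem is perfectly $K_m$-stable if and only if there is an integer $q$ such that the graph obtained from $K_m^q$ by adding one edge is not $\mathcal H^\uparrow$-free. (2) If in addition $\mathcal H$ is finite, then the problem is robustly $K_m$-stable if and only if there is an integer $q$ such that the graph obtained from $K_m^q$ by adding some forest inside one of its parts is not $\mathcal H^\uparrow$-free.
   Context: All graphs are finite and simple; "subgraph" means induced subgraph; $\chi$ is the chromatic number. $\mathcal H^\uparrow$ is the family of all graphs obtained from members of $\mathcal H$ by adding some (possibly no) missing edges; a graph is $\mathcal H^\uparrow$-free if it has no induced subgraph isomorphic to a member of $\mathcal H^\uparrow$, and $\mathrm{Forb}(\mathcal H^\uparrow)$ is the class of such graphs. $\lambda(G)=e(G)/\binom{v(G)}2$ and $\lambda(n,\mathcal G)=\max\{\lambda(G):G\in\mathcal G,v(G)=n\}$ (so $\lambda(n,\mathcal G)\binom n2=\mathrm{ex}(n,\mathcal H)$). For a graph $B$ on $[m]$ and disjoint sets $V_1,\dots,V_m$, the blow-up $B(V_1,\dots,V_m)$ has vertex set $\bigcup V_i$, with $u\in V_i,w\in V_j$ adjacent iff $ij\in E(B)$; $B()$ is the family of all blow-ups. $K_m^q$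 is the blow-up of $K_m$ with $m$ parts each of size $q$; its "parts" are these $m$ sets. $\delta_{\mathrm{edit}}(G,B())$ is the minimal number of adjacency changes turning $G$ (order $n$) into a blow-up of $B$, divided by $\binom n2$. The problem is perfectly $B$-stable if there is $C>0$ with $\delta_{\mathrm{edit}}(G,B())\le C(\lambda(n,\mathcal G)-\lambda(G))$ for all $G\in\mathcal G$ of order $n\ge C$; robustly $B$-stable if there is $C>0$ with $\delta_{\mathrm{edit}}(G,B())\le C\max(1/n,\lambda(n,\mathcal G)-\lambda(G))$ for all $G\in\mathcal G$ of order $n\ge C$. -}

module Defs where

open import Data.Nat using (ℕ; zero; suc; _+_; _*_; _∸_; _≤_; _<?_)
open import Data.Nat.Combinatorics using (_C_)
open import Data.Fin using (Fin; zero; suc; inject₁; fromℕ; remQuot; toℕ; _≟_)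
open import Data.Bool using (Bool; true; false; not; _∧_; _xor_)
open import Data.Bool.Properties using (∧-zeroʳ)
open import Data.Product using (Σ; ∃; ∃-syntax; _×_; _,_; proj₁; proj₂)
open import Data.Sum using (_⊎_)
open import Data.Empty using (⊥-elim)
open import Relation.Nullary using (¬_; Dec; yes; no)
open import Relation.Nullary.Decidable using (⌊_⌋)
open import Relation.Binary.PropositionalEquality using (_≡_; refl; sym; cong; cong₂; subst)
open import Function.Definitions using (Injective)
open import Function.Bundles using (_↔_)

record Graph : Set where
  field
    order  : ℕ
    adj    : Fin order → Fin order → Bool
    adjSym : ∀ u w → adj u w ≡ adj w u
    irrefl : ∀ u → adj u u ≡ false
open Graph public

sumFin : (k : ℕ) → (Fin k → ℕ) → ℕ
sumFin zero    f = 0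
sumFin (suc k) f = f zero + sumFin k (λ i → f (suc i))

b2n : Bool → ℕ
b2n true  = 1
b2n false = 0

pairCount : (k : ℕ) → (Fin k → Fin k → Bool) → ℕ
pairCount k P = sumFin k (λ u → sumFin k (λ w → b2n (⌊ toℕ u <? toℕ w ⌋ ∧ P u w)))

edges : Graph → ℕ
edges G = pairCount (order G) (adj G)

InducedIn : Graph → Graph → Set
InducedIn H G = Σ (Fin (order H) → Fin (order G)) λ f →
  Injective _≡_ _≡_ f × (∀ u w → adj H u w ≡ adj G (f u) (f w))

Supergraph : Graph → Graph → Set
Supergraph H H' = Σ (order H ≡ order H') λ e →
  ∀ u w → adj H u w ≡ true → adj H' (subst Fin e u) (subst Fin e w) ≡ true

Free : {I : Set} → (I → Graph) → Graph → Set
Free {I} 𝓗 G = ¬ (Σ I λ i → Σ Graph λ H' → Supergraph (𝓗 i) H' × InducedIn H' G)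

Colorable : Graph → ℕ → Set
Colorable G k = Σ (Fin (order G) → Fin k) λ c →
  ∀ u w → adj G u w ≡ true → ¬ (c u ≡ c w)

MinChromatic : {I : Set} → (I → Graph) → ℕ → Set
MinChromatic {I} 𝓗 k = (∀ i → ¬ Colorable (𝓗 i) (k ∸ 1)) × (Σ I λ i → Colorable (𝓗 i) k)

IsEx : {I : Set} → (I → Graph) → ℕ → ℕ → Set
IsEx 𝓗 n e =
  (Σ Graph λ G → Free 𝓗 G × order G ≡ n × edges G ≡ e) ×
  (∀ G → Free 𝓗 G → order G ≡ n → edges G ≤ e)

-- the blow-up of K_m with parts V_i = p⁻¹(i): u ~ w iff p u ≠ p w
blowAdj : {k m : ℕ} → (Fin k → Fin m) → Fin k → Fin k → Bool
blowAdj p u w = not ⌊ p u ≟ p w ⌋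

-- number of adjacency changes turning G into the blow-up of K_m given by p
-- (δ_edit(G, K_m()) · binom(n,2) is the minimum of this over p)
editDist : (G : Graph) {m : ℕ} → (Fin (order G) → Fin m) → ℕ
editDist G p = pairCount (order G) (λ u w → adj G u w xor blowAdj p u w)

-- Perfect K_m-stability. With λ = e/binom(n,2) and δ_edit = d/binom(n,2),
-- δ_edit ≤ C(λ(n,𝒢) - λ(G)) is d_min ≤ C·(ex(n) - e(G)); C may be taken in ℕ.
PerfectlyStable : {I : Set} → (I → Graph) → ℕ → Set
PerfectlyStable 𝓗 m = Σ ℕ λ K →
  ∀ G → Free 𝓗 G → K ≤ order G → ∀ ex → IsEx 𝓗 (order G) ex →
  Σ (Fin (order G) → Fin m) λ p → editDist G p ≤ K * (ex ∸ edges G)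

-- Robust K_m-stability: δ_edit ≤ C·max(1/n, λ(n,𝒢) - λ(G)), i.e.
-- δ_edit ≤ C/n (⇔ d·n ≤ C·binom(n,2)) or δ_edit ≤ C(λ(n,𝒢) - λ(G)).
RobustlyStable : {I : Set} → (I → Graph) → ℕ → Set
RobustlyStable 𝓗 m = Σ ℕ λ K →
  ∀ G → Free 𝓗 G → K ≤ order G → ∀ ex → IsEx 𝓗 (order G) ex →
  Σ (Fin (order G) → Fin m) λ p →
    (editDist G p * order G ≤ K * ((order G) C 2)) ⊎ (editDist G p ≤ K * (ex ∸ edges G))

kadjD : {A : Set} {a b : A} → Dec (a ≡ b) → Bool → Bool
kadjD (yes _) x = x
kadjD (no _)  _ = true

kadjD-sym : {A : Set} {a b : A} (d1 : Dec (a ≡ b)) (d2 : Dec (b ≡ a)) (x y : Bool) →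
  (a ≡ b → x ≡ y) → kadjD d1 x ≡ kadjD d2 y
kadjD-sym (yes e) (yes _) x y h = h e
kadjD-sym (yes e) (no ne) x y h = ⊥-elim (ne (sym e))
kadjD-sym (no ne) (yes e) x y h = ⊥-elim (ne (sym e))
kadjD-sym (no _)  (no _)  x y h = refl

KmqPlus : (m : ℕ) → Fin m → (F : Graph) → Graph
KmqPlus m j F = record
  { order  = m * q
  ; adj    = A
  ; adjSym = λ u w → kadjD-sym (part u ≟ part w) (part w ≟ part u) _ _
               (λ e → cong₂ _∧_ (cong (λ x → ⌊ x ≟ j ⌋) e) (adjSym F (idx u) (idx w)))
  ; irrefl = irr
  }
  where
  q = order F
  part : Fin (m * q) → Fin m
  part u = proj₁ (remQuot {m} q u)
  idx : Fin (m * q) → Fin q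
  idx u = proj₂ (remQuot {m} q u)
  A : Fin (m * q) → Fin (m * q) → Bool
  A u w = kadjD (part u ≟ part w) (⌊ part u ≟ j ⌋ ∧ adj F (idx u) (idx w))
  irr : ∀ u → A u u ≡ false
  irr u with part u ≟ part u
  ... | yes _ = subst (λ b → ⌊ part u ≟ j ⌋ ∧ b ≡ false) (sym (irrefl F (idx u))) (∧-zeroʳ _)
  ... | no ne = ⊥-elim (ne refl)

HasCycle : Graph → Set
HasCycle F = Σ ℕ λ r → Σ (Fin (suc (suc (suc r))) → Fin (order F)) λ c →
  Injective _≡_ _≡_ c ×
  (∀ (i : Fin (suc (suc r))) → adj F (c (inject₁ i)) (c (suc i)) ≡ true) ×
  adj F (c (fromℕ (suc (suc r)))) (c zero) ≡ true

Forest : Graph → Set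
Forest F = ¬ HasCycle F

FiniteIndex : Set → Set
FiniteIndex I = Σ ℕ λ k → I ↔ Fin k

{-# OPTIONS --safe #-}
module Submission where

-- Necessity. If K_m^q plus F is free, then an extremal graph of the same order has at least e(F) more edges than any
-- complete m-partite graph, so it is at edit distance at least e(F) from all of these. For perfect stability F is one
-- edge. For robust stability F is a graph with many edges whose girth exceeds the order of every member of 𝓗, so a
-- member of 𝓗 inside K_m^q plus F meets F in a forest only.
--
-- Sufficiency. Let G avoid K_m^q plus F. As this graph embeds in K_{m+1}^q, G has few (m+1)-cliques (Erdős), and
-- Füredi's degree argument yields a partition into m parts with few inner edges, unless e(G) is far from extremal.
-- Improve the partition to a local maximum cut. A vertex with many inner neighbours then has many neighbours in all
-- parts; only boundedly many such vertices can exist (none if F is an edge). Vertices with fewer missing edges than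
-- four times their inner edges are joined to almost all of the other parts, so that no copy of F on them lies inside
-- a part, and the inner edges among them are linearly many (none if F is an edge). The remaining inner edges are at
-- most half of the missing ones. Since complete m-partite graphs are free, ex(n) - e(G) is at least the number of
-- missing edges minus the number of inner edges.

-- The sufficiency argument is closed by two inequalities between the number i of inner edges and
-- the number μ of missing ones. Extremality gives μ ≤ i + s, where s is the deficit; charging inner
-- edges to missing ones gives 2i ≤ μ + E. The factor 2 is what allows the two to be solved, to i +
-- μ ≤ 3s + 2E. The error E is 0 for a single edge and linear in n for a forest, which is the whole
-- difference between perfect and robust stability. Forests enter because they can be placed
-- greedily wherever the minimum degree is at least their order: in a K_{q,q}, or in a part with too
-- many inner edges. For an arbitrary family freeness need not be decidable, so an extremal graph is
-- available only under a double negation. This is harmless while the goal is itself a negation. In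
-- the robust case a forest has to be exhibited, and finiteness of the family serves twice: it
-- bounds the girth required, and it makes the search for an embedded member decidable. To stay
-- within natural numbers, edges are counted as ordered pairs and a bound x ≤ n²/c is written c·x ≤
-- n².

open import Defs
open import Data.Nat hiding (_≟_)
open import Data.Nat.Properties hiding (_≟_)
open import Data.Nat.Combinatorics using (_C_; nC1≡n; nCk+nC[k+1]≡[n+1]C[k+1])
open import Data.Nat.Tactic.RingSolver using (solve-∀)
open import Data.Bool using (Bool; true; false; not; _∧_; _∨_; _xor_; if_then_else_)
import Data.Bool as Bool
open import Data.Bool.Properties using (∧-comm; ∧-assoc; ∧-zeroʳ; ∧-identityʳ; ∨-comm; ∨-zeroʳ)
open import Data.Bool.ListAction using (all)
open import Data.Fin using (Fin; zero; suc; toℕ; _≟_; remQuot; combine; inject₁; fromℕ)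
import Data.Fin.Properties as Fin
open import Data.Fin.Permutation.Components using (transpose; transpose-inverse)
import Data.List.Properties
open import Data.List using (List; []; _∷_; length; allFin; map; filter; take; _++_)
open import Data.List.Membership.Propositional using (_∈_)
import Data.List.Membership.Propositional as Mem using (find)
import Data.List.Membership.Propositional.Properties as Mem
open import Data.List.Relation.Unary.Any using (here; there)
import Data.List.Relation.Unary.Any as Any
import Data.List.Relation.Unary.All as All
open import Data.List.Relation.Unary.AllPairs using ([]; _∷_)
open import Data.List.Relation.Unary.Unique.Propositional using (Unique)
import Data.List.Relation.Unary.Unique.Propositional.Properties as Unique
open import Data.Vec using (Vec; []; _∷_)
open import Data.Product using (Σ; ∃; _×_; _,_; proj₁; proj₂)
open import Data.Sum using (_⊎_; inj₁; inj₂)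
open import Data.Empty using (⊥; ⊥-elim)
open import Function using (_∘_; id)
open import Function.Bundles using (_⇔_; _↔_; mk⇔; Inverse)
open import Function.Definitions using (Injective)
open import Relation.Nullary using (¬_; Dec; yes; no)
open import Relation.Nullary.Decidable using (⌊_⌋; _×-dec_; _→-dec_; map′)
open import Relation.Binary.PropositionalEquality

-- Finite sums

private
  variable
    α β : Set

-- Linear arithmetic by certificate: X ≤ Y is a combination of the hypotheses, k is the slack, and the identity is left to
-- the ring solver.
lin : ∀ {X Y a b} k → X ≤ Y → a + Y + k ≡ b + X → a ≤ b
lin {X} {Y} {a} {b} k h e = +-cancelʳ-≤ X a b
  (≤-trans (+-monoʳ-≤ a h) (≤-trans (m≤m+n (a + Y) k) (≤-reflexive e)))

∑ : List α → (α → ℕ) → ℕ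
∑ []       f = 0
∑ (x ∷ xs) f = f x + ∑ xs f

count : List α → (α → Bool) → ℕ
count xs P = ∑ xs (λ x → b2n (P x))

∑-cong : ∀ (xs : List α) {f g : α → ℕ} → (∀ x → f x ≡ g x) → ∑ xs f ≡ ∑ xs g
∑-cong []       h = refl
∑-cong (x ∷ xs) h = cong₂ _+_ (h x) (∑-cong xs h)

∑-mono : ∀ (xs : List α) {f g : α → ℕ} → (∀ x → f x ≤ g x) → ∑ xs f ≤ ∑ xs g
∑-mono []       h = z≤n
∑-mono (x ∷ xs) h = +-mono-≤ (h x) (∑-mono xs h)

∑-mono-∈ : ∀ (xs : List α) {f g : α → ℕ} → (∀ x → x ∈ xs → f x ≤ g x) → ∑ xs f ≤ ∑ xs g
∑-mono-∈ []       h = z≤n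
∑-mono-∈ (x ∷ xs) h = +-mono-≤ (h x (here refl)) (∑-mono-∈ xs (λ y m → h y (there m)))

∑-+ : ∀ (xs : List α) (f g : α → ℕ) → ∑ xs (λ x → f x + g x) ≡ ∑ xs f + ∑ xs g
∑-+ []       f g = refl
∑-+ (x ∷ xs) f g = trans (cong (f x + g x +_) (∑-+ xs f g)) (eq (f x) (g x) (∑ xs f) (∑ xs g))
  where
  eq : ∀ a b c d → a + b + (c + d) ≡ a + c + (b + d)
  eq = solve-∀

∑-* : ∀ (xs : List α) (c : ℕ) (f : α → ℕ) → ∑ xs (λ x → c * f x) ≡ c * ∑ xs f
∑-* []       c f = sym (*-zeroʳ c)
∑-* (x ∷ xs) c f = trans (cong (c * f x +_) (∑-* xs c f)) (sym (*-distribˡ-+ c (f x) (∑ xs f)))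

∑-*ʳ : ∀ (xs : List α) (c : ℕ) (f : α → ℕ) → ∑ xs (λ x → f x * c) ≡ ∑ xs f * c
∑-*ʳ xs c f = trans (∑-cong xs (λ x → *-comm (f x) c)) (trans (∑-* xs c f) (*-comm c _))

∑-const : ∀ (xs : List α) (c : ℕ) → ∑ xs (λ _ → c) ≡ length xs * c
∑-const []       c = refl
∑-const (x ∷ xs) c = cong (c +_) (∑-const xs c)

∑-zero : ∀ (xs : List α) {f : α → ℕ} → (∀ x → f x ≡ 0) → ∑ xs f ≡ 0
∑-zero xs h = trans (∑-cong xs h) (trans (∑-const xs 0) (*-zeroʳ (length xs)))

∑-swap : ∀ (xs : List α) (ys : List β) (f : α → β → ℕ) →
  ∑ xs (λ x → ∑ ys (f x)) ≡ ∑ ys (λ y → ∑ xs (λ x → f x y))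
∑-swap []       ys f = sym (∑-zero ys (λ _ → refl))
∑-swap (x ∷ xs) ys f = trans (cong (∑ ys (f x) +_) (∑-swap xs ys f)) (sym (∑-+ ys (f x) _))

∑-++ : ∀ (xs ys : List α) (f : α → ℕ) → ∑ (xs ++ ys) f ≡ ∑ xs f + ∑ ys f
∑-++ []       ys f = refl
∑-++ (x ∷ xs) ys f = trans (cong (f x +_) (∑-++ xs ys f)) (sym (+-assoc (f x) _ _))

∑-map : ∀ (h : α → β) (xs : List α) (f : β → ℕ) → ∑ (map h xs) f ≡ ∑ xs (λ x → f (h x))
∑-map h []       f = refl
∑-map h (x ∷ xs) f = cong (f (h x) +_) (∑-map h xs f)

∑-∈ : ∀ {xs : List α} (f : α → ℕ) {x} → x ∈ xs → f x ≤ ∑ xs f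
∑-∈ f (here refl) = m≤m+n _ _
∑-∈ f {x} (there m) = ≤-trans (∑-∈ f m) (m≤n+m _ _)

∑-exists : ∀ (xs : List α) {f g : α → ℕ} → ∑ xs g < ∑ xs f → ∃ λ x → x ∈ xs × g x < f x
∑-exists (x ∷ xs) {f} {g} h with g x <? f x
... | yes p = x , here refl , p
... | no np with ∑-exists xs {f} {g} (+-cancelˡ-< (f x) _ _ (≤-<-trans (+-monoˡ-≤ _ (≮⇒≥ np)) h))
...   | y , m , p = y , there m , p

b2n≤1 : ∀ b → b2n b ≤ 1
b2n≤1 true  = ≤-refl
b2n≤1 false = z≤n

b2n-∧ : ∀ b c → b2n (b ∧ c) ≡ b2n b * b2n c
b2n-∧ true  c = sym (+-identityʳ _)
b2n-∧ false c = refl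

count-exists : ∀ (xs : List α) (P : α → Bool) → 1 ≤ count xs P → ∃ λ x → x ∈ xs × P x ≡ true
count-exists xs P h with ∑-exists xs {λ x → b2n (P x)} {λ _ → 0} (≤-trans (s≤s (≤-reflexive (∑-zero xs (λ _ → refl)))) h)
... | x , m , p with P x in eq
...   | true = x , m , eq

count-∈ : ∀ {xs : List α} (P : α → Bool) {x} → x ∈ xs → P x ≡ true → 1 ≤ count xs P
count-∈ P {x} m e = ≤-trans (≤-reflexive (sym (cong b2n e))) (∑-∈ (λ y → b2n (P y)) m)

count≤length : ∀ (xs : List α) (P : α → Bool) → count xs P ≤ length xs
count≤length xs P = ≤-trans (∑-mono xs (λ x → b2n≤1 (P x))) (≤-reflexive (trans (∑-const xs 1) (*-identityʳ _)))

⌊⌋-true : ∀ {P : Set} (d : Dec P) → P → ⌊ d ⌋ ≡ true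
⌊⌋-true (yes _) p = refl
⌊⌋-true (no ¬p) p = ⊥-elim (¬p p)

⌊⌋-false : ∀ {P : Set} (d : Dec P) → ¬ P → ⌊ d ⌋ ≡ false
⌊⌋-false (yes p) ¬p = ⊥-elim (¬p p)
⌊⌋-false (no _)  ¬p = refl

true-⌊⌋ : ∀ {P : Set} (d : Dec P) → ⌊ d ⌋ ≡ true → P
true-⌊⌋ (yes p) _ = p

false-⌊⌋ : ∀ {P : Set} (d : Dec P) → ⌊ d ⌋ ≡ false → ¬ P
false-⌊⌋ (no ¬p) _ = ¬p

⌊⌋-cong : ∀ {P Q : Set} (d : Dec P) (e : Dec Q) → (P → Q) → (Q → P) → ⌊ d ⌋ ≡ ⌊ e ⌋
⌊⌋-cong (yes p) e f g = sym (⌊⌋-true e (f p))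
⌊⌋-cong (no ¬p) e f g = sym (⌊⌋-false e (λ q → ¬p (g q)))

not-true : ∀ {b} → not b ≡ true → b ≡ false
not-true {false} _ = refl

∧-true : ∀ {b c} → b ∧ c ≡ true → b ≡ true × c ≡ true
∧-true {true} e = refl , e

true-∧ : ∀ {b c} → b ≡ true → c ≡ true → b ∧ c ≡ true
true-∧ refl e = e

absurd-bool : ∀ {b : Bool} {C : Set} → b ≡ true → b ≡ false → C
absurd-bool refl ()

V : (n : ℕ) → List (Fin n)
V n = allFin n

tabulate-∈ : ∀ {n} (f : Fin n → α) i → f i ∈ Data.List.tabulate f
tabulate-∈ f zero    = here refl
tabulate-∈ f (suc i) = there (tabulate-∈ (λ j → f (suc j)) i)

∈V : ∀ {n} (x : Fin n) → x ∈ V n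
∈V = tabulate-∈ id

∑-tabulate : ∀ {n} (h : Fin n → α) (f : α → ℕ) → ∑ (Data.List.tabulate h) f ≡ sumFin n (λ i → f (h i))
∑-tabulate {n = zero}  h f = refl
∑-tabulate {n = suc n} h f = cong (f (h zero) +_) (∑-tabulate (λ i → h (suc i)) f)

∑V-sumFin : ∀ n (f : Fin n → ℕ) → ∑ (V n) f ≡ sumFin n f
∑V-sumFin n f = ∑-tabulate id f

∑V-suc : ∀ n (f : Fin (suc n) → ℕ) → ∑ (V (suc n)) f ≡ f zero + ∑ (V n) (λ i → f (suc i))
∑V-suc n f = trans (∑V-sumFin (suc n) f) (cong (f zero +_) (sym (∑V-sumFin n (λ i → f (suc i)))))

length-V : ∀ n → length (V n) ≡ n
length-V n = Data.List.Properties.length-tabulate id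

∑V-const : ∀ n c → ∑ (V n) (λ _ → c) ≡ n * c
∑V-const n c = trans (∑-const (V n) c) (cong (_* c) (length-V n))

count≤n : ∀ {n} (P : Fin n → Bool) → count (V n) P ≤ n
count≤n {n} P = ≤-trans (count≤length (V n) P) (≤-reflexive (length-V n))

∑-δ : ∀ {n} (v : Fin n) (f : Fin n → ℕ) → ∑ (V n) (λ x → b2n ⌊ x ≟ v ⌋ * f x) ≡ f v
∑-δ {suc n} zero f = trans (∑V-suc n (λ x → b2n ⌊ x ≟ zero ⌋ * f x))
  (trans (cong (f zero + 0 +_) (∑-zero (V n) (λ x → refl))) (eq (f zero)))
  where
  eq : ∀ a → a + 0 + 0 ≡ a
  eq = solve-∀
∑-δ {suc n} (suc v) f = trans (∑V-suc n (λ x → b2n ⌊ x ≟ suc v ⌋ * f x)) (trans (∑-cong (V n) (λ x →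
    cong (λ b → b2n b * f (suc x)) (⌊⌋-cong (suc x ≟ suc v) (x ≟ v) Fin.suc-injective (cong suc))))
  (∑-δ v (λ x → f (suc x))))

∑-δ-count : ∀ {n} (v : Fin n) → count (V n) (λ x → ⌊ x ≟ v ⌋) ≡ 1
∑-δ-count {n} v = trans (∑-cong (V n) (λ x → sym (*-identityʳ _))) (∑-δ v (λ _ → 1))

∑-δʳ : ∀ {n} (v : Fin n) (f : Fin n → ℕ) → ∑ (V n) (λ x → b2n ⌊ v ≟ x ⌋ * f x) ≡ f v
∑-δʳ v f = trans (∑-cong (V _) (λ x → cong (λ b → b2n b * f x) (⌊⌋-cong (v ≟ x) (x ≟ v) sym sym))) (∑-δ v f)

-- Counting edges

∑₂ : ∀ {n} → (Fin n → Fin n → ℕ) → ℕ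
∑₂ {n} f = ∑ (V n) (λ u → ∑ (V n) (f u))

-- Ordered pairs: every edge is counted twice.
pairs : ∀ {n} → (Fin n → Fin n → Bool) → ℕ
pairs P = ∑₂ (λ u w → b2n (P u w))

∑₂-cong : ∀ {n} {f g : Fin n → Fin n → ℕ} → (∀ u w → f u w ≡ g u w) → ∑₂ f ≡ ∑₂ g
∑₂-cong h = ∑-cong (V _) (λ u → ∑-cong (V _) (h u))

∑₂-mono : ∀ {n} {f g : Fin n → Fin n → ℕ} → (∀ u w → f u w ≤ g u w) → ∑₂ f ≤ ∑₂ g
∑₂-mono h = ∑-mono (V _) (λ u → ∑-mono (V _) (h u))

∑₂-+ : ∀ {n} (f g : Fin n → Fin n → ℕ) → ∑₂ (λ u w → f u w + g u w) ≡ ∑₂ f + ∑₂ g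
∑₂-+ {n} f g = trans (∑-cong (V n) (λ u → ∑-+ (V n) (f u) (g u))) (∑-+ (V n) _ _)

∑₂-const : ∀ n c → ∑₂ {n} (λ _ _ → c) ≡ n * n * c
∑₂-const n c = trans (∑-cong (V n) (λ _ → ∑V-const n c)) (trans (∑V-const n (n * c)) (sym (*-assoc n n c)))

pairs≤ : ∀ {n} (P : Fin n → Fin n → Bool) → pairs P ≤ n * n
pairs≤ {n} P = ≤-trans (∑₂-mono (λ u w → b2n≤1 (P u w))) (≤-reflexive (trans (∑₂-const n 1) (*-identityʳ _)))

pairCount≡ : ∀ n (P : Fin n → Fin n → Bool) →
  pairCount n P ≡ ∑₂ (λ u w → b2n (⌊ toℕ u <? toℕ w ⌋ ∧ P u w))
pairCount≡ n P = trans (sym (∑V-sumFin n _)) (∑-cong (V n) (λ u → sym (∑V-sumFin n _)))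

handshake : ∀ n (P : Fin n → Fin n → Bool) → (∀ u w → P u w ≡ P w u) → (∀ u → P u u ≡ false) →
  pairs P ≡ 2 * pairCount n P
handshake n P s irr = begin
  pairs P ≡⟨ ∑₂-cong split ⟩
  ∑₂ (λ u w → below u w + below w u) ≡⟨ ∑₂-+ below (λ u w → below w u) ⟩
  ∑₂ below + ∑₂ (λ u w → below w u) ≡⟨ cong (∑₂ below +_) (∑-swap (V n) (V n) (λ u w → below w u)) ⟩
  ∑₂ below + ∑₂ below ≡⟨ cong (∑₂ below +_) (sym (+-identityʳ _)) ⟩
  2 * ∑₂ below ≡⟨ cong (2 *_) (sym (pairCount≡ n P)) ⟩
  2 * pairCount n P ∎
  where
  open ≡-Reasoning
  below : Fin n → Fin n → ℕ
  below u w = b2n (⌊ toℕ u <? toℕ w ⌋ ∧ P u w)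
  split : ∀ u w → b2n (P u w) ≡ below u w + below w u
  split u w with toℕ u <? toℕ w | toℕ w <? toℕ u
  ... | yes p | yes q = ⊥-elim (<-asym p q)
  ... | yes p | no q  = sym (+-identityʳ _)
  ... | no p  | yes q = cong b2n (s u w)
  ... | no p  | no q  with Fin.toℕ-injective (≤-antisym (≮⇒≥ q) (≮⇒≥ p))
  ... | refl = cong b2n (irr u)

-- Adding to each function the row and column `v` of the other makes the two equal pointwise, as
-- both vanish at (v, v). This serves for moving a vertex to another part and for deleting a vertex.
row-swap : ∀ {n} (f g : Fin n → Fin n → ℕ) (v : Fin n) →
  (∀ u w → f u w ≡ f w u) → (∀ u w → g u w ≡ g w u) → f v v ≡ 0 → g v v ≡ 0 →
  (∀ u w → u ≢ v → w ≢ v → f u w ≡ g u w) →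
  ∑₂ f + 2 * ∑ (V n) (g v) ≡ ∑₂ g + 2 * ∑ (V n) (f v)
row-swap {n} f g v fs gs f0 g0 off =
  trans (sym (total f g)) (trans (∑₂-cong pointwise) (total g f))
  where
  at : (Fin n → Fin n → ℕ) → Fin n → Fin n → ℕ
  at h u w = b2n ⌊ u ≟ v ⌋ * h v w + b2n ⌊ w ≟ v ⌋ * h v u
  pointwise : ∀ u w → f u w + at g u w ≡ g u w + at f u w
  pointwise u w with u ≟ v | w ≟ v
  ... | yes refl | yes refl rewrite f0 | g0 = refl
  ... | yes refl | no q = eq (f v w) (g v w)
    where
    eq : ∀ a b → a + (b + 0 + 0) ≡ b + (a + 0 + 0)
    eq = solve-∀
  ... | no p | yes refl rewrite fs u v | gs u v = eq (f v u) (g v u)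
    where
    eq : ∀ a b → a + (b + 0) ≡ b + (a + 0)
    eq = solve-∀
  ... | no p | no q rewrite off u w p q = refl
  total : ∀ h k → ∑₂ (λ u w → h u w + at k u w) ≡ ∑₂ h + 2 * ∑ (V n) (k v)
  total h k = trans (∑₂-+ h (at k)) (cong (∑₂ h +_)
    (trans (∑₂-+ (λ u w → b2n ⌊ u ≟ v ⌋ * k v w) (λ u w → b2n ⌊ w ≟ v ⌋ * k v u))
    (cong₂ _+_
      (trans (∑-cong (V n) (λ u → ∑-* (V n) (b2n ⌊ u ≟ v ⌋) (k v))) (∑-δ v (λ _ → ∑ (V n) (k v))))
      (trans (∑-cong (V n) (λ u → ∑-δ v (λ _ → k v u))) (sym (+-identityʳ _))))))

inner : ∀ {n m} → (Fin n → Fin n → Bool) → (Fin n → Fin m) → ℕ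
inner a p = pairs (λ u w → a u w ∧ ⌊ p u ≟ p w ⌋)

missing : ∀ {n m} → (Fin n → Fin n → Bool) → (Fin n → Fin m) → ℕ
missing a p = pairs (λ u w → not (a u w) ∧ not ⌊ p u ≟ p w ⌋)

cross : ∀ {n m} → (Fin n → Fin m) → ℕ
cross p = pairs (blowAdj p)

part-size : ∀ {n m} → (Fin n → Fin m) → Fin m → ℕ
part-size {n} p l = count (V n) (λ x → ⌊ p x ≟ l ⌋)

-- Multiplied out so as to avoid a fraction: this is Σ aₗ² ≥ n²/m together with the defect of one term.
cauchy : ∀ m (a : Fin m → ℕ) (l : Fin m) n D → ∑ (V m) a ≡ n →
  m * a l * (m * a l) + n * n ≡ 2 * (m * a l * n) + D →
  m * (n * n) + D ≤ m * m * ∑ (V m) (λ k → a k * a k)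
cauchy m a l n D sum defect = lin 0 total (eq m n D (m * m * ∑ (V m) (λ k → a k * a k)))
  where
  sq : ∀ x y → 2 * (x * y) ≤ x * x + y * y
  sq zero    y = z≤n
  sq (suc x) zero = ≤-trans (≤-reflexive (cong (2 *_) (*-zeroʳ (suc x)))) z≤n
  sq (suc x) (suc y) = lin 0 (sq x y) (eq x y)
    where
    eq : ∀ x y → 2 * ((1 + x) * (1 + y)) + (x * x + y * y) + 0 ≡ (1 + x) * (1 + x) + (1 + y) * (1 + y) + 2 * (x * y)
    eq = solve-∀
  -- The inequality 2xn ≤ x² + n² with x = m·aₖ, kept as an equality with defect at `l`. After
  -- summation the left side is 2mn² + D, of which mn² cancels.
  pointwise : ∀ k → 2 * (m * a k * n) + b2n ⌊ k ≟ l ⌋ * D ≤ m * a k * (m * a k) + n * n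
  pointwise k with k ≟ l
  ... | yes refl = ≤-reflexive (trans (cong (2 * (m * a k * n) +_) (+-identityʳ D)) (sym defect))
  ... | no _ = ≤-trans (≤-reflexive (+-identityʳ _)) (sq (m * a k) n)
  lhs : ∑ (V m) (λ k → 2 * (m * a k * n) + b2n ⌊ k ≟ l ⌋ * D) ≡ 2 * (m * n * n) + D
  lhs = trans (∑-+ (V m) _ _) (cong₂ _+_
    (trans (∑-* (V m) 2 _) (cong (2 *_) (trans (∑-*ʳ (V m) n _)
      (cong (_* n) (trans (∑-* (V m) m a) (cong (m *_) sum))))))
    (∑-δ l (λ _ → D)))
  rhs : ∑ (V m) (λ k → m * a k * (m * a k) + n * n) ≡ m * m * ∑ (V m) (λ k → a k * a k) + m * (n * n)
  rhs = trans (∑-+ (V m) _ _) (cong₂ _+_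
    (trans (∑-cong (V m) (λ k → eq m (a k))) (∑-* (V m) (m * m) _))
    (∑V-const m (n * n)))
    where
    eq : ∀ m a → m * a * (m * a) ≡ m * m * (a * a)
    eq = solve-∀
  total : 2 * (m * n * n) + D ≤ m * m * ∑ (V m) (λ k → a k * a k) + m * (n * n)
  total = subst₂ _≤_ lhs rhs (∑-mono (V m) pointwise)
  eq : ∀ m n D y → m * (n * n) + D + (y + m * (n * n)) + 0 ≡ y + (2 * (m * n * n) + D)
  eq = solve-∀

module _ {n m : ℕ} (p : Fin n → Fin m) where

  b2n-same : ∀ u w → b2n ⌊ p u ≟ p w ⌋ ≡ ∑ (V m) (λ l → b2n ⌊ p u ≟ l ⌋ * b2n ⌊ p w ≟ l ⌋)
  b2n-same u w = trans (cong b2n (⌊⌋-cong (p u ≟ p w) (p w ≟ p u) sym sym))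
    (sym (∑-δʳ (p u) (λ l → b2n ⌊ p w ≟ l ⌋)))

  ∑-by-part : ∀ (f : Fin n → ℕ) → ∑ (V n) f ≡ ∑ (V m) (λ l → ∑ (V n) (λ x → b2n ⌊ p x ≟ l ⌋ * f x))
  ∑-by-part f = trans (∑-cong (V n) (λ x → sym (∑-δʳ (p x) (λ _ → f x))))
    (∑-swap (V n) (V m) (λ x l → b2n ⌊ p x ≟ l ⌋ * f x))

  ∑-part-size : ∑ (V m) (part-size p) ≡ n
  ∑-part-size = trans (sym (trans (∑-by-part (λ _ → 1)) (∑-cong (V m) (λ l → ∑-cong (V n) (λ x → *-identityʳ _)))))
    (trans (∑V-const n 1) (*-identityʳ n))

  same-pairs : pairs (λ u w → ⌊ p u ≟ p w ⌋) ≡ ∑ (V m) (λ l → part-size p l * part-size p l)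
  same-pairs = trans (∑₂-cong b2n-same)
    (trans (∑-cong (V n) (λ u → ∑-swap (V n) (V m) (λ w l → b2n ⌊ p u ≟ l ⌋ * b2n ⌊ p w ≟ l ⌋)))
    (trans (∑-swap (V n) (V m) _)
    (∑-cong (V m) (λ l → trans (∑-cong (V n) (λ u → ∑-* (V n) (b2n ⌊ p u ≟ l ⌋) _)) (∑-*ʳ (V n) _ _)))))

  cross+squares : cross p + ∑ (V m) (λ l → part-size p l * part-size p l) ≡ n * n
  cross+squares = trans (cong (cross p +_) (sym same-pairs))
    (trans (sym (∑₂-+ {n} _ _)) (trans (∑₂-cong (λ u w → eq ⌊ p u ≟ p w ⌋)) (trans (∑₂-const n 1) (*-identityʳ _))))
    where
    eq : ∀ b → b2n (not b) + b2n b ≡ 1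
    eq true  = refl
    eq false = refl

  module _ (a : Fin n → Fin n → Bool) where

    -- Both directions of the theorem rest on this identity. With cross p ≤ x it yields missing ≤
    -- inner + (x - pairs a), and for an extremal graph it bounds the inner edges from below.
    edges+missing : pairs a + missing a p ≡ cross p + inner a p
    edges+missing = trans (sym (∑₂-+ {n} _ _)) (trans (∑₂-cong (λ u w → eq (a u w) ⌊ p u ≟ p w ⌋)) (∑₂-+ {n} _ _))
      where
      eq : ∀ a s → b2n a + b2n (not a ∧ not s) ≡ b2n (not s) + b2n (a ∧ s)
      eq true  true  = refl
      eq true  false = refl
      eq false true  = refl
      eq false false = refl

    edit-split : pairs (λ u w → a u w xor blowAdj p u w) ≡ inner a p + missing a p
    edit-split = trans (∑₂-cong (λ u w → eq (a u w) ⌊ p u ≟ p w ⌋)) (∑₂-+ {n} _ _)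
      where
      eq : ∀ a s → b2n (a xor not s) ≡ b2n (a ∧ s) + b2n (not a ∧ not s)
      eq true  true  = refl
      eq true  false = refl
      eq false true  = refl
      eq false false = refl

-- Dense families of sets

-- Either keeping or dropping x preserves half of the weight, whence the factor 2 for each element of the list.
pick-common : ∀ (k : ℕ) (os : List α) (ys : List β) (P : α → β → Bool) (Y₀ : β → Bool) → Unique os →
  let heavy = count ys (λ y → Y₀ y ∧ ⌊ k ≤? count os (λ x → P x y) ⌋) in 1 ≤ heavy →
  Σ (List α) λ s → Unique s × length s ≡ k × (∀ x → x ∈ s → x ∈ os) ×
    heavy ≤ 2 ^ length os * count ys (λ y → Y₀ y ∧ all (λ x → P x y) s)
pick-common zero os ys P Y₀ uos _ = [] , [] , refl , (λ _ ()) ,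
  ≤-trans (≤-reflexive (sym (*-identityˡ _))) (*-monoˡ-≤ _ (m^n>0 2 (length os)))
pick-common (suc k) [] ys P Y₀ uos pos = ⊥-elim (1+n≰n (≤-trans pos (≤-reflexive
  (∑-zero ys (λ y → cong b2n (∧-zeroʳ (Y₀ y)))))))
pick-common {α} (suc k) (x ∷ os) ys P Y₀ (x∉ ∷ uos) pos = choose (≤-total h₁ h₂)
  where
  c : _ → ℕ
  c y = count os (λ z → P z y)
  h h₁ h₂ : ℕ
  h = count ys (λ y → Y₀ y ∧ ⌊ suc k ≤? b2n (P x y) + c y ⌋)
  h₁ = count ys (λ y → Y₀ y ∧ ⌊ suc k ≤? c y ⌋)
  h₂ = count ys (λ y → (Y₀ y ∧ P x y) ∧ ⌊ k ≤? c y ⌋)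
  pointwise : ∀ b e c → b2n (b ∧ ⌊ suc k ≤? b2n e + c ⌋) ≤
    b2n (b ∧ ⌊ suc k ≤? c ⌋) + b2n ((b ∧ e) ∧ ⌊ k ≤? c ⌋)
  pointwise false e c = z≤n
  pointwise true true c with k ≤? c
  ... | yes p = ≤-trans (b2n≤1 _) (m≤n+m 1 _)
  ... | no ¬p = ≤-trans (≤-reflexive (cong b2n (⌊⌋-false (suc k ≤? suc c) (λ q → ¬p (s≤s⁻¹ q))))) z≤n
  pointwise true false c = m≤m+n _ _
  split : h ≤ h₁ + h₂
  split = ≤-trans (∑-mono ys (λ y → pointwise (Y₀ y) (P x y) (c y))) (≤-reflexive (∑-+ ys _ _))
  doubled : ∀ {h′} z → h ≤ h′ + h′ → h′ ≤ 2 ^ length os * z → h ≤ 2 * 2 ^ length os * z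
  doubled z p q = ≤-trans p (≤-trans (+-mono-≤ q q) (≤-reflexive (eq (2 ^ length os) z)))
    where
    eq : ∀ t z → t * z + t * z ≡ 2 * t * z
    eq = solve-∀
  half : ∀ {h′} → h ≤ h′ + h′ → 1 ≤ h′
  half {zero}  p = ≤-trans pos p
  half {suc _} p = s≤s z≤n
  choose : h₁ ≤ h₂ ⊎ h₂ ≤ h₁ → Σ (List α) λ s → Unique s × length s ≡ suc k × (∀ z → z ∈ s → z ∈ x ∷ os) ×
    h ≤ 2 ^ length (x ∷ os) * count ys (λ y → Y₀ y ∧ all (λ z → P z y) s)
  choose (inj₂ le) with ≤-trans split (+-monoʳ-≤ h₁ le)
  ... | dbl with pick-common (suc k) os ys P Y₀ uos (half dbl)
  ...   | s , us , ls , sub , bound = s , us , ls , (λ z m → there (sub z m)) ,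
    doubled (count ys (λ y → Y₀ y ∧ all (λ z → P z y) s)) dbl bound
  choose (inj₁ le) with ≤-trans split (+-monoˡ-≤ h₂ le)
  ... | dbl with pick-common k os ys P (λ y → Y₀ y ∧ P x y) uos (half dbl)
  ...   | s , us , ls , sub , bound = x ∷ s , (All.tabulate (λ {z} m → All.lookup x∉ (sub z m)) ∷ us) , cong suc ls ,
    (λ { _ (here refl) → here refl ; z (there m) → there (sub z m) }) ,
    ≤-trans (doubled (count ys (λ y → (Y₀ y ∧ P x y) ∧ all (λ z → P z y) s)) dbl bound)
      (≤-reflexive (cong (2 ^ length (x ∷ os) *_)
      (∑-cong ys (λ y → cong b2n (∧-assoc (Y₀ y) (P x y) _)))))

take-⊆ : ∀ t (os : List α) {x} → x ∈ take t os → x ∈ os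
take-⊆ (suc t) (o ∷ os) (here e)  = here e
take-⊆ (suc t) (o ∷ os) (there m) = there (take-⊆ t os m)

-- Let T be this number and N the number of elements `y`, at least N/h of which are related to each
-- of T given `x`. If `heavy` counts the `y` related to at least k of the `x`, then T·N ≤ h·(N·k +
-- T·heavy). As T > 4hk, the first term is less than a quarter of T·N, whence N ≤ 4h·heavy.
dense-size : ℕ → ℕ → ℕ
dense-size h k = suc (4 * (h * k))

dense-factor : ℕ → ℕ → ℕ
dense-factor h k = 4 * (h * 2 ^ dense-size h k)

-- The double counting of Kővári, Sós and Turán: many `y` are related to at least k of the `x`, and
-- a positive proportion of these share the same k elements.
common-dense : ∀ (h k : ℕ) (os : List α) (ys : List β) (P : α → β → Bool) → Unique os →
  dense-size h k ≤ length os → 1 ≤ length ys → (∀ x → x ∈ os → length ys ≤ h * count ys (P x)) →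
  Σ (List α) λ s → Unique s × length s ≡ k × (∀ x → x ∈ s → x ∈ os) ×
    length ys ≤ dense-factor h k * count ys (λ y → all (λ x → P x y) s)
common-dense {α} h k os₀ ys P uos₀ T≤ N≥1 dense = conclude (pick-common k os ys P (λ _ → true) uos heavy≥1)
  where
  T N : ℕ
  T = dense-size h k
  N = length ys
  -- Cutting the list to T elements makes the loss 2^T of `pick-common` a constant.
  os : List α
  os = take T os₀
  uos : Unique os
  uos = Unique.take⁺ T uos₀
  len : length os ≡ T
  len = trans (Data.List.Properties.length-take T os₀) (m≤n⇒m⊓n≡m T≤)
  c : _ → ℕ
  c y = count os (λ x → P x y)
  heavy : ℕ
  heavy = count ys (λ y → ⌊ k ≤? c y ⌋)
  c≤ : ∀ y → c y ≤ k + T * b2n ⌊ k ≤? c y ⌋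
  c≤ y with k ≤? c y
  ... | yes _ = ≤-trans (count≤length os _) (≤-trans (≤-reflexive (trans len (sym (*-identityʳ T)))) (m≤n+m _ k))
  ... | no ¬p = ≤-trans (<⇒≤ (≰⇒> ¬p)) (m≤m+n k _)
  lower : T * N ≤ h * ∑ ys c
  lower = begin
    T * N ≡⟨ cong (_* N) (sym len) ⟩
    length os * N ≡⟨ sym (∑-const os N) ⟩
    ∑ os (λ _ → N) ≤⟨ ∑-mono-∈ os (λ x m → dense x (take-⊆ T os₀ m)) ⟩
    ∑ os (λ x → h * count ys (P x)) ≡⟨ ∑-* os h _ ⟩
    h * ∑ os (λ x → count ys (P x)) ≡⟨ cong (h *_) (∑-swap os ys (λ x y → b2n (P x y))) ⟩
    h * ∑ ys c ∎
    where open ≤-Reasoning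
  upper : ∑ ys c ≤ N * k + T * heavy
  upper = ≤-trans (∑-mono ys c≤) (≤-reflexive (trans (∑-+ ys _ _) (cong₂ _+_ (∑-const ys k) (∑-* ys T _))))
  N≤heavy : N ≤ 4 * h * heavy
  N≤heavy = *-cancelˡ-≤ T (lin ((4 * (h * k)) * N * 2 + 3 * N) (*-monoʳ-≤ 4 (≤-trans lower (*-monoʳ-≤ h upper)))
    (eq h k N heavy))
    where
    eq : ∀ h k N H → (1 + 4 * (h * k)) * N + 4 * (h * (N * k + (1 + 4 * (h * k)) * H)) + ((4 * (h * k)) * N * 2 + 3 * N) ≡
      (1 + 4 * (h * k)) * (4 * h * H) + 4 * ((1 + 4 * (h * k)) * N)
    eq = solve-∀
  heavy≥1 : 1 ≤ heavy
  heavy≥1 = n≢0⇒n>0 (λ e → 1+n≰n (≤-trans N≥1 (≤-trans N≤heavy (≤-reflexive (trans (cong (4 * h *_) e) (*-zeroʳ (4 * h)))))))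
  conclude : (Σ (List α) λ s → Unique s × length s ≡ k × (∀ x → x ∈ s → x ∈ os) ×
      heavy ≤ 2 ^ length os * count ys (λ y → all (λ x → P x y) s)) →
    Σ (List α) λ s → Unique s × length s ≡ k × (∀ x → x ∈ s → x ∈ os₀) ×
      N ≤ dense-factor h k * count ys (λ y → all (λ x → P x y) s)
  conclude (s , us , ls , sub , bound) = s , us , ls , (λ x m → take-⊆ T os₀ (sub x m)) ,
    ≤-trans N≤heavy (≤-trans (*-monoʳ-≤ (4 * h) bound) (≤-reflexive (trans
      (cong (λ t → 4 * h * (2 ^ t * cnt)) len) (eq h (2 ^ T) cnt))))
    where
    cnt : ℕ
    cnt = count ys (λ y → all (λ x → P x y) s)
    eq : ∀ h t c → 4 * h * (t * c) ≡ 4 * (h * t) * c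
    eq = solve-∀

-- Complete multipartite subgraphs

select : (α → Bool) → List α → List α
select P = filter (λ x → P x Bool.≟ true)

length-select : ∀ (P : α → Bool) xs → length (select P xs) ≡ count xs P
length-select P [] = refl
length-select P (x ∷ xs) with P x
... | true  = cong suc (length-select P xs)
... | false = length-select P xs

select-true : ∀ (P : α → Bool) xs {x} → x ∈ select P xs → P x ≡ true
select-true P xs m = proj₂ (Mem.∈-filter⁻ (λ x → P x Bool.≟ true) {xs = xs} m)

all-∈ : ∀ (P : α → Bool) {s x} → all P s ≡ true → x ∈ s → P x ≡ true
all-∈ P {_ ∷ s} e (here refl) = proj₁ (∧-true e)
all-∈ P {y ∷ s} e (there m)   = all-∈ P (proj₂ (∧-true {P y} e)) m

∈-all : ∀ (P : α → Bool) s → (∀ x → x ∈ s → P x ≡ true) → all P s ≡ true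
∈-all P []      h = refl
∈-all P (y ∷ s) h = true-∧ (h y (here refl)) (∈-all P s (λ x m → h x (there m)))

lookup-∈ : ∀ (s : List α) i → Data.List.lookup s i ∈ s
lookup-∈ (x ∷ s) zero    = here refl
lookup-∈ (x ∷ s) (suc i) = there (lookup-∈ s i)

lookup-injective : ∀ {s : List α} → Unique s → ∀ i j → Data.List.lookup s i ≡ Data.List.lookup s j → i ≡ j
lookup-injective (_ ∷ _) zero zero e = refl
lookup-injective {s = _ ∷ s} (x∉ ∷ _) zero (suc j) e = ⊥-elim (All.lookup x∉ (lookup-∈ s j) e)
lookup-injective {s = _ ∷ s} (x∉ ∷ _) (suc i) zero e = ⊥-elim (All.lookup x∉ (lookup-∈ s i) (sym e))
lookup-injective (_ ∷ us) (suc i) (suc j) e = cong suc (lookup-injective us i j e)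

enumerate : ∀ {q} (s : List α) → Unique s → length s ≡ q →
  Σ (Fin q → α) λ f → Injective _≡_ _≡_ f × (∀ t → f t ∈ s)
enumerate s us refl = Data.List.lookup s , (λ {i} {j} → lookup-injective us i j) , lookup-∈ s

tuples : ∀ n r → List (Vec (Fin n) r)
tuples n zero    = [] ∷ []
tuples n (suc r) = Data.List.cartesianProductWith _∷_ (V n) (tuples n r)

∑-cartesian : ∀ {A B : Set} (g : A → B → α) xs ys (f : α → ℕ) →
  ∑ (Data.List.cartesianProductWith g xs ys) f ≡ ∑ xs (λ x → ∑ ys (λ y → f (g x y)))
∑-cartesian g []       ys f = refl
∑-cartesian g (x ∷ xs) ys f = trans (∑-++ (map (g x) ys) _ f) (cong₂ _+_ (∑-map (g x) ys f) (∑-cartesian g xs ys f))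

length≡∑ : ∀ (xs : List α) → length xs ≡ ∑ xs (λ _ → 1)
length≡∑ xs = sym (trans (∑-const xs 1) (*-identityʳ _))

length-tuples : ∀ n r → length (tuples n r) ≡ n ^ r
length-tuples n zero    = refl
length-tuples n (suc r) = begin
  length (tuples n (suc r)) ≡⟨ length≡∑ (tuples n (suc r)) ⟩
  ∑ (tuples n (suc r)) (λ _ → 1) ≡⟨ ∑-cartesian _∷_ (V n) (tuples n r) (λ _ → 1) ⟩
  ∑ (V n) (λ _ → ∑ (tuples n r) (λ _ → 1)) ≡⟨ ∑V-const n _ ⟩
  n * ∑ (tuples n r) (λ _ → 1) ≡⟨ cong (n *_) (trans (sym (length≡∑ (tuples n r))) (length-tuples n r)) ⟩
  n * n ^ r ∎
  where open ≡-Reasoning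

module _ {n : ℕ} (a : Fin n → Fin n → Bool) where

  isClique : ∀ {r} → (Fin n → Bool) → Vec (Fin n) r → Bool
  isClique U []       = true
  isClique U (x ∷ xs) = U x ∧ isClique (λ w → U w ∧ a x w) xs

  cliques : ℕ → (Fin n → Bool) → ℕ
  cliques zero    U = 1
  cliques (suc r) U = ∑ (V n) (λ x → b2n (U x) * cliques r (λ w → U w ∧ a x w))

  cliques-count : ∀ r U → cliques r U ≡ count (tuples n r) (isClique U)
  cliques-count zero    U = refl
  cliques-count (suc r) U = sym (trans (∑-cartesian _∷_ (V n) (tuples n r) _) (∑-cong (V n) (λ x →
    trans (∑-cong (tuples n r) (λ xs → b2n-∧ (U x) (isClique (λ w → U w ∧ a x w) xs)))
    (trans (∑-* (tuples n r) (b2n (U x)) _) (cong (b2n (U x) *_) (sym (cliques-count r _)))))))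

  cliques≤ : ∀ r U → cliques r U ≤ n ^ r
  cliques≤ r U = ≤-trans (≤-reflexive (cliques-count r U))
    (≤-trans (count≤length (tuples n r) _) (≤-reflexive (length-tuples n r)))

  -- Applied to the links of the vertices in `s`: a tuple that is a clique in each link is a clique
  -- in the common neighbourhood. The element `i₀` supplies the adjacencies within the tuple, which
  -- an empty `s` would not give.
  isClique-⋂ : ∀ {r} {I : Set} (s : List I) (U : I → Fin n → Bool) (W : Fin n → Bool) (y : Vec (Fin n) r) {i₀} → i₀ ∈ s →
    (∀ w → (∀ i → i ∈ s → U i w ≡ true) → W w ≡ true) →
    (∀ i → i ∈ s → isClique (U i) y ≡ true) → isClique W y ≡ true
  isClique-⋂ s U W []      m imp h = refl
  isClique-⋂ s U W (z ∷ y) m imp h = true-∧ (imp z (λ i k → proj₁ (∧-true (h i k))))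
    (isClique-⋂ s (λ i w → U i w ∧ a z w) (λ w → W w ∧ a z w) y m
      (λ w g → true-∧ (imp w (λ i k → proj₁ (∧-true (g i k)))) (proj₂ (∧-true {U _ w} (g _ m))))
      (λ i k → proj₂ (∧-true {U i z} (h i k))))

-- Distinctness is asked within each part; vertices of different parts are adjacent, hence distinct
-- in an irreflexive relation.
record Multipartite {n} (a : Fin n → Fin n → Bool) (U : Fin n → Bool) (r q : ℕ) : Set where
  field
    vertex   : Fin r → Fin q → Fin n
    inside   : ∀ i t → U (vertex i t) ≡ true
    distinct : ∀ i → Injective _≡_ _≡_ (vertex i)
    adjacent : ∀ {i j} → i ≢ j → ∀ t t′ → a (vertex i t) (vertex j t′) ≡ true

empty-parts : ∀ {n} {a : Fin n → Fin n → Bool} {U} r → Multipartite a U r 0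
empty-parts r = record { vertex = λ i () ; inside = λ i () ; distinct = λ i {} ; adjacent = λ _ () }

no-parts : ∀ {n} {a : Fin n → Fin n → Bool} {U} q → Multipartite a U 0 q
no-parts q = record { vertex = λ () ; inside = λ () ; distinct = λ () ; adjacent = λ {i} → ⊥-elim (Fin.¬Fin0 i) }

kst-size : ℕ → ℕ → ℕ → ℕ
kst-size q zero    h = 0
kst-size q (suc r) h = kst-size q r (dense-factor (2 * h) q) + suc (2 * h * dense-size (2 * h) q)

-- Erdős's theorem by induction on r. Many vertices have a link rich in r-cliques; `common-dense`
-- selects `suc q` of them whose links share many r-cliques, and these form the first part. The
-- others are found in the common neighbourhood. Parts are non-empty for the sake of `isClique-⋂`.
many-cliques : ∀ q r h {n} (a : Fin n → Fin n → Bool) → (∀ u w → a u w ≡ a w u) → ∀ U →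
  kst-size (suc q) r h ≤ n → n ^ r ≤ h * cliques a r U → Multipartite a U r (suc q)
many-cliques q zero    h a a-sym U size dense = no-parts (suc q)
many-cliques q (suc r) h {n} a a-sym U size dense = build
  (common-dense (2 * h) (suc q) os ys (λ x y → isClique a (link x) y)
    (Unique.filter⁺ (λ x → heavy x Bool.≟ true) (Unique.allFin⁺ n))
    enough (≤-trans (m^n>0 n ⦃ n≠0 ⦄ r) (≤-reflexive (sym (length-tuples n r)))) os-dense)
  where
  n≠0 : NonZero n
  n≠0 = >-nonZero (≤-trans (≤-trans (s≤s z≤n) (m≤n+m _ (kst-size (suc q) r (dense-factor (2 * h) (suc q))))) size)
  link : Fin n → Fin n → Bool
  link x w = U w ∧ a x w
  ys : List (Vec (Fin n) r)
  ys = tuples n r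
  heavy : Fin n → Bool
  heavy x = U x ∧ ⌊ n ^ r ≤? 2 * h * cliques a r (link x) ⌋
  os : List (Fin n)
  os = select heavy (V n)
  pointwise : ∀ x → 2 * h * (b2n (U x) * cliques a r (link x)) ≤ b2n (heavy x) * (2 * h * n ^ r) + n ^ r
  pointwise x with U x | n ^ r ≤? 2 * h * cliques a r (link x)
  ... | false | _ = ≤-trans (≤-reflexive (*-zeroʳ (2 * h))) z≤n
  ... | true | yes _ = ≤-trans (*-monoʳ-≤ (2 * h) (≤-trans (≤-reflexive (*-identityˡ _)) (cliques≤ a r (link x))))
    (≤-trans (≤-reflexive (sym (*-identityˡ _))) (m≤m+n _ _))
  ... | true | no ¬p = ≤-trans (*-monoʳ-≤ (2 * h) (≤-reflexive (*-identityˡ _))) (<⇒≤ (≰⇒> ¬p))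
  -- A vertex is heavy if its link has at least half the average density 1/h. The light ones account
  -- for at most half of the cliques, so at least n/(2h) vertices are heavy.
  many : n ≤ 2 * h * count (V n) heavy
  many = *-cancelʳ-≤ n _ (n ^ r) ⦃ m^n≢0 n r ⦃ n≠0 ⦄ ⦄
    (lin 0 (+-mono-≤ (*-monoʳ-≤ 2 dense)
      (≤-trans (≤-reflexive (sym (∑-* (V n) (2 * h) _))) (≤-trans (∑-mono (V n) pointwise)
        (≤-reflexive (trans (∑-+ (V n) (λ x → b2n (heavy x) * (2 * h * n ^ r)) (λ _ → n ^ r))
          (cong₂ _+_ (∑-*ʳ (V n) (2 * h * n ^ r) (λ x → b2n (heavy x))) (∑V-const n (n ^ r))))))))
      (eq n (n ^ r) h (cliques a (suc r) U) (count (V n) heavy)))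
    where
    eq : ∀ n N h c H → n * N + (2 * (h * c) + (H * (2 * h * N) + n * N)) + 0 ≡ 2 * h * H * N + (2 * (n * N) + 2 * h * c)
    eq = solve-∀
  enough : dense-size (2 * h) (suc q) ≤ length os
  enough with dense-size (2 * h) (suc q) ≤? length os
  ... | yes p = p
  ... | no ¬p = ⊥-elim (1+n≰n (≤-trans (≤-trans (m≤n+m _ (kst-size (suc q) r (dense-factor (2 * h) (suc q)))) size)
    (≤-trans many (*-monoʳ-≤ (2 * h) (≤-trans (≤-reflexive (sym (length-select heavy (V n)))) (<⇒≤ (≰⇒> ¬p)))))))
  os-dense : ∀ x → x ∈ os → length ys ≤ 2 * h * count ys (isClique a (link x))
  os-dense x m = ≤-trans (≤-reflexive (length-tuples n r)) (≤-trans
    (true-⌊⌋ (n ^ r ≤? _) (proj₂ (∧-true {U x} (select-true heavy (V n) m))))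
    (≤-reflexive (cong (2 * h *_) (cliques-count a r (link x)))))
  build : (Σ (List (Fin n)) λ s → Unique s × length s ≡ suc q × (∀ x → x ∈ s → x ∈ os) ×
    length ys ≤ dense-factor (2 * h) (suc q) * count ys (λ y → all (λ x → isClique a (link x) y) s)) →
    Multipartite a U (suc r) (suc q)
  build (s , us , ls , sub , bound) with enumerate s us ls
  ... | f , f-inj , f∈ = record { vertex = vertex ; inside = inside ; distinct = distinct ; adjacent = adjacent }
    where
    U′ : Fin n → Bool
    U′ w = U w ∧ all (λ x → a x w) s
    pointwise′ : ∀ y → b2n (all (λ x → isClique a (link x) y) s) ≤ b2n (isClique a U′ y)
    pointwise′ y with all (λ x → isClique a (link x) y) s in eq
    ... | false = z≤n
    ... | true = ≤-reflexive (sym (cong b2n (isClique-⋂ a s link U′ y (f∈ zero)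
      (λ w g → true-∧ (proj₁ (∧-true (g _ (f∈ zero)))) (∈-all _ s (λ x m → proj₂ (∧-true {U w} (g x m)))))
      (λ x m → all-∈ _ eq m))))
    module R = Multipartite (many-cliques q r (dense-factor (2 * h) (suc q)) a a-sym U′ (≤-trans (m≤m+n _ _) size)
      (≤-trans (≤-reflexive (sym (length-tuples n r))) (≤-trans bound (*-monoʳ-≤ (dense-factor (2 * h) (suc q))
        (≤-trans (∑-mono ys pointwise′) (≤-reflexive (sym (cliques-count a r U′))))))))
    vertex : Fin (suc r) → Fin (suc q) → Fin n
    vertex zero    = f
    vertex (suc i) = R.vertex i
    inside : ∀ i t → U (vertex i t) ≡ true
    inside zero    t = proj₁ (∧-true (select-true heavy (V n) (sub _ (f∈ t))))
    inside (suc i) t = proj₁ (∧-true (R.inside i t))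
    distinct : ∀ i → Injective _≡_ _≡_ (vertex i)
    distinct zero    = f-inj
    distinct (suc i) = R.distinct i
    joined : ∀ i t t′ → a (f t) (R.vertex i t′) ≡ true
    joined i t t′ = all-∈ _ (proj₂ (∧-true {U (R.vertex i t′)} (R.inside i t′))) (f∈ t)
    adjacent : ∀ {i j} → i ≢ j → ∀ t t′ → a (vertex i t) (vertex j t′) ≡ true
    adjacent {zero}  {zero}  ne t t′ = ⊥-elim (ne refl)
    adjacent {zero}  {suc j} ne t t′ = joined j t t′
    adjacent {suc i} {zero}  ne t t′ = trans (a-sym _ _) (joined i t′ t)
    adjacent {suc i} {suc j} ne t t′ = R.adjacent (λ e → ne (cong suc e)) t t′

-- Stability for graphs with few cliques

argmax : ∀ {A : Set} (xs : List A) (P : A → Bool) (f : A → ℕ) →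
  (∀ x → x ∈ xs → P x ≡ false) ⊎ (Σ A λ x → P x ≡ true × (∀ y → y ∈ xs → P y ≡ true → f y ≤ f x))
argmax []       P f = inj₁ (λ _ ())
argmax (z ∷ xs) P f with P z in eq | argmax xs P f
... | false | inj₁ none = inj₁ (λ { _ (here refl) → eq ; x (there m) → none x m })
... | false | inj₂ (x , px , max) = inj₂ (x , px , λ { _ (here refl) py → absurd-bool py eq ; y (there m) py → max y m py })
... | true | inj₁ none = inj₂ (z , eq , λ { _ (here refl) _ → ≤-refl ; y (there m) py → absurd-bool py (none y m) })
... | true | inj₂ (x , px , max) with ≤-total (f x) (f z)
...   | inj₁ le = inj₂ (z , eq , λ { _ (here refl) _ → ≤-refl ; y (there m) py → ≤-trans (max y m py) le })
...   | inj₂ ge = inj₂ (x , px , λ { _ (here refl) _ → ge ; y (there m) py → max y m py })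

module _ {n : ℕ} (U : Fin n → Bool) where

  edgesIn : (Fin n → Fin n → Bool) → ℕ
  edgesIn a = pairs (λ u w → (U u ∧ U w) ∧ a u w)

  innerIn : ∀ {m} → (Fin n → Fin n → Bool) → (Fin n → Fin m) → ℕ
  innerIn a p = pairs (λ u w → ((U u ∧ U w) ∧ a u w) ∧ ⌊ p u ≟ p w ⌋)

  crossIn : ∀ {m} → (Fin n → Fin m) → ℕ
  crossIn p = pairs (λ u w → (U u ∧ U w) ∧ not ⌊ p u ≟ p w ⌋)

  innerIn≤ : ∀ {m} a (p : Fin n → Fin m) → innerIn a p ≤ edgesIn a
  innerIn≤ a p = ∑₂-mono (λ u w → le ((U u ∧ U w) ∧ a u w) ⌊ p u ≟ p w ⌋)
    where
    le : ∀ b c → b2n (b ∧ c) ≤ b2n b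
    le true  c = b2n≤1 c
    le false c = z≤n

-- The error n²/c is spent in two halves. The recursive call receives n²/(2c), hence the argument
-- 2c. The vertices in too many cliques receive the other half: each costs at most 2n ordered pairs,
-- so n/(4c) of them are affordable, hence the factor 4.
stab-factor : ℕ → ℕ → ℕ
stab-factor zero    c = 2 * c
stab-factor (suc m) c = 4 * (c * stab-factor m (2 * c))

-- Füredi's argument: x₁ has maximum degree in U, the non-neighbours of x₁ form the first part, and one continues inside the
-- neighbourhood of x₁. Choosing x₁ among the vertices that lie in few cliques keeps the neighbourhood poor in cliques.
few-cliques : ∀ m c {n} (a : Fin n → Fin n → Bool) → (∀ u w → a u w ≡ a w u) → ∀ U →
  stab-factor m c * cliques a (2 + m) U ≤ n ^ (2 + m) →
  Σ (Fin n → Fin (suc m)) λ p → c * (edgesIn U a + innerIn U a p) ≤ c * crossIn U p + n * n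
few-cliques zero c {n} a a-sym U few = (λ _ → zero) , (begin
  c * (edgesIn U a + innerIn U {1} a (λ _ → zero)) ≤⟨ *-monoʳ-≤ c (+-monoʳ-≤ (edgesIn U a) (innerIn≤ U {1} a (λ _ → zero))) ⟩
  c * (edgesIn U a + edgesIn U a) ≡⟨ cong (λ e → c * (e + e)) edges≡ ⟩
  c * (cliques a 2 U + cliques a 2 U) ≡⟨ eq c (cliques a 2 U) ⟩
  2 * c * cliques a 2 U ≤⟨ few ⟩
  n * (n * 1) ≡⟨ cong (n *_) (*-identityʳ n) ⟩
  n * n ≤⟨ m≤n+m (n * n) _ ⟩
  c * crossIn U {1} (λ _ → zero) + n * n ∎)
  where
  open ≤-Reasoning
  eq : ∀ c k → c * (k + k) ≡ 2 * c * k
  eq = solve-∀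
  edges≡ : edgesIn U a ≡ cliques a 2 U
  edges≡ = ∑-cong (V n) (λ u → trans (∑-cong (V n) (λ w → trans (cong b2n (∧-assoc (U u) (U w) (a u w)))
      (trans (b2n-∧ (U u) (U w ∧ a u w)) (cong (b2n (U u) *_) (sym (*-identityʳ _))))))
    (∑-* (V n) (b2n (U u)) _))
few-cliques (suc m) c {n} a a-sym U few = choose (argmax (V n) good deg)
  where
  s′ K : ℕ
  s′ = stab-factor m (2 * c)
  K = n ^ (2 + m)
  link : Fin n → Fin n → Bool
  link x w = U w ∧ a x w
  deg : Fin n → ℕ
  deg x = count (V n) (link x)
  rich : Fin n → Bool
  rich x = ⌊ suc K ≤? s′ * cliques a (2 + m) (link x) ⌋
  good bad : Fin n → Bool
  good x = U x ∧ not (rich x)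
  bad x = U x ∧ rich x
  B : ℕ
  B = count (V n) bad
  bad-pointwise : ∀ x → b2n (bad x) * K ≤ s′ * (b2n (U x) * cliques a (2 + m) (link x))
  bad-pointwise x with U x | suc K ≤? s′ * cliques a (2 + m) (link x)
  ... | false | _ = z≤n
  ... | true | no _ = z≤n
  ... | true | yes p = ≤-trans (≤-reflexive (*-identityˡ K))
    (≤-trans (<⇒≤ p) (*-monoʳ-≤ s′ (≤-reflexive (sym (*-identityˡ _)))))
  -- The case distinction on n provides the non-zero power of n to cancel; for n = 0 there are no
  -- vertices.
  few-bad : ∀ N → n ≡ N → 4 * (c * B) ≤ n
  few-bad zero refl = ≤-reflexive (trans (sym (*-assoc 4 c 0)) (*-zeroʳ (4 * c)))
  few-bad (suc _) refl = *-cancelʳ-≤ (4 * (c * B)) n K ⦃ m^n≢0 n (2 + m) ⦄ (begin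
    4 * (c * B) * K ≡⟨ eq c B K ⟩
    4 * (c * (B * K)) ≡⟨ cong (λ z → 4 * (c * z)) (sym (∑-*ʳ (V n) K (λ x → b2n (bad x)))) ⟩
    4 * (c * ∑ (V n) (λ x → b2n (bad x) * K)) ≤⟨ *-monoʳ-≤ 4 (*-monoʳ-≤ c (∑-mono (V n) bad-pointwise)) ⟩
    4 * (c * ∑ (V n) (λ x → s′ * (b2n (U x) * cliques a (2 + m) (link x)))) ≡⟨ cong (λ z → 4 * (c * z))
      (∑-* (V n) s′ (λ x → b2n (U x) * cliques a (2 + m) (link x))) ⟩
    4 * (c * (s′ * cliques a (3 + m) U)) ≡⟨ eq′ c s′ (cliques a (3 + m) U) ⟩
    4 * (c * s′) * cliques a (3 + m) U ≤⟨ few ⟩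
    n * K ∎)
    where
    open ≤-Reasoning
    eq : ∀ c B K → 4 * (c * B) * K ≡ 4 * (c * (B * K))
    eq = solve-∀
    eq′ : ∀ c s k → 4 * (c * (s * k)) ≡ 4 * (c * s) * k
    eq′ = solve-∀
  4cB≤n : 4 * (c * B) ≤ n
  4cB≤n = few-bad n refl
  choose : (∀ x → x ∈ V n → good x ≡ false) ⊎
    (Σ (Fin n) λ x → good x ≡ true × (∀ y → y ∈ V n → good y ≡ true → deg y ≤ deg x)) →
    Σ (Fin n → Fin (2 + m)) λ p → c * (edgesIn U a + innerIn U a p) ≤ c * crossIn U p + n * n
  -- All vertices of `U` lie in too many cliques. As these are few, `U` spans few edges and any
  -- partition will do.
  choose (inj₁ none) = (λ _ → zero) , ≤-trans
    (*-monoʳ-≤ c (+-mono-≤ few-edges (≤-trans (innerIn≤ U {2 + m} a (λ _ → zero)) few-edges)))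
    (≤-trans (lin (2 * (c * (B * n))) (*-monoˡ-≤ n 4cB≤n) (eq c B n)) (m≤n+m (n * n) _))
    where
    pointwise : ∀ u w → b2n ((U u ∧ U w) ∧ a u w) ≤ b2n (bad u)
    pointwise u w with U u | none u (∈V u)
    ... | false | _ = z≤n
    ... | true | g with rich u
    ...   | true = b2n≤1 _
    few-edges : edgesIn U a ≤ B * n
    few-edges = ≤-trans (∑₂-mono pointwise) (≤-reflexive (trans
      (∑-cong (V n) (λ u → trans (∑V-const n _) (*-comm n _))) (∑-*ʳ (V n) n (λ x → b2n (bad x)))))
    eq : ∀ c B n → c * (B * n + B * n) + n * n + 2 * (c * (B * n)) ≡ n * n + 4 * (c * B) * n
    eq = solve-∀
  choose (inj₂ (x , gx , max)) = p , *-cancelˡ-≤ 2 (lin 0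
      (+-mono-≤ (*-monoʳ-≤ (2 * c) upper) (+-mono-≤ (*-monoʳ-≤ (2 * c) lower) (+-mono-≤ (proj₂ IH) (*-monoˡ-≤ n 4cB≤n))))
      (eq c (edgesIn U a + innerIn U a p) (crossIn U p) (edgesIn U′ a + innerIn U′ a p′) (crossIn U′ p′) W (deg x) B n))
    where
    eq : ∀ c E X E′ X′ W D B n →
      2 * (c * E) + (2 * c * (E′ + 2 * (W * D + B * n)) + (2 * c * X + (2 * c * X′ + n * n + n * n))) + 0 ≡
      2 * (c * X + n * n) + (2 * c * E + (2 * c * (X′ + 2 * (W * D)) + (2 * c * E′ + 4 * (c * B) * n)))
    eq = solve-∀
    U′ V₁ : Fin n → Bool
    U′ = link x
    V₁ w = U w ∧ not (a x w)
    W : ℕ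
    W = count (V n) V₁
    poor : s′ * cliques a (2 + m) U′ ≤ K
    poor = ≮⇒≥ (false-⌊⌋ (suc K ≤? s′ * cliques a (2 + m) U′) (not-true (proj₂ (∧-true {U x} gx))))
    IH : Σ (Fin n → Fin (suc m)) λ p → 2 * c * (edgesIn U′ a + innerIn U′ a p) ≤ 2 * c * crossIn U′ p + n * n
    IH = few-cliques m (2 * c) a a-sym U′ poor
    p′ : Fin n → Fin (suc m)
    p′ = proj₁ IH
    p : Fin n → Fin (2 + m)
    p w = if a x w then suc (p′ w) else zero
    same-p : ∀ u w → ⌊ p u ≟ p w ⌋ ≡ (if a x u then (if a x w then ⌊ p′ u ≟ p′ w ⌋ else false) else not (a x w))
    same-p u w with a x u | a x w
    ... | true | true = ⌊⌋-cong (suc (p′ u) ≟ suc (p′ w)) (p′ u ≟ p′ w) Fin.suc-injective (cong suc)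
    ... | true | false = refl
    ... | false | true = refl
    ... | false | false = refl
    side : Fin n → Fin n → ℕ
    side u w = b2n (V₁ u) * b2n (U w ∧ a u w)
    D : ℕ
    D = ∑ (V n) (λ u → b2n (V₁ u) * deg u)
    -- Maximality of `x` compares it with the vertices in few cliques only; the degree of any other
    -- vertex is estimated by n.
    D≤ : D ≤ W * deg x + B * n
    D≤ = ≤-trans (∑-mono (V n) pointwise) (≤-reflexive (trans (∑-+ (V n) (λ u → b2n (V₁ u) * deg x) (λ u → b2n (bad u) * n))
      (cong₂ _+_ (∑-*ʳ (V n) (deg x) (λ u → b2n (V₁ u))) (∑-*ʳ (V n) n (λ u → b2n (bad u))))))
      where
      pointwise : ∀ u → b2n (V₁ u) * deg u ≤ b2n (V₁ u) * deg x + b2n (bad u) * n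
      pointwise u with U u | max u (∈V u)
      ... | false | _ = z≤n
      ... | true | mx with rich u
      ...   | false = ≤-trans (*-monoʳ-≤ (b2n (not (a x u))) (mx refl)) (m≤m+n _ _)
      ...   | true = ≤-trans (*-mono-≤ (b2n≤1 (not (a x u))) (count≤n (link u))) (m≤n+m (1 * n) (b2n (not (a x u)) * deg x))
    ∑side : ∑₂ side ≡ D
    ∑side = ∑-cong (V n) (λ u → ∑-* (V n) (b2n (V₁ u)) _)
    -- An edge inside `V₁` weighs twice on the left, as an edge and as an inner edge, and is met
    -- twice by the degree sum over `V₁`, once from each end. This is why edges and inner edges are
    -- estimated together.
    upper : edgesIn U a + innerIn U a p ≤ edgesIn U′ a + innerIn U′ a p′ + 2 * (W * deg x + B * n)
    upper = begin
      edgesIn U a + innerIn U a p ≡⟨ sym (∑₂-+ {n} _ _) ⟩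
      ∑₂ (λ u w → b2n ((U u ∧ U w) ∧ a u w) + b2n (((U u ∧ U w) ∧ a u w) ∧ ⌊ p u ≟ p w ⌋)) ≤⟨ ∑₂-mono pointwise ⟩
      ∑₂ (λ u w → b2n ((U′ u ∧ U′ w) ∧ a u w) + b2n (((U′ u ∧ U′ w) ∧ a u w) ∧ ⌊ p′ u ≟ p′ w ⌋) + (side u w + side w u))
        ≡⟨ ∑₂-+ {n} _ _ ⟩
      ∑₂ (λ u w → b2n ((U′ u ∧ U′ w) ∧ a u w) + b2n (((U′ u ∧ U′ w) ∧ a u w) ∧ ⌊ p′ u ≟ p′ w ⌋)) + ∑₂
        (λ u w → side u w + side w u)
        ≡⟨ cong₂ _+_ (∑₂-+ {n} _ _) (trans (∑₂-+ side (λ u w → side w u))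
             (cong₂ _+_ ∑side (trans (∑-swap (V n) (V n) (λ u w → side w u)) ∑side))) ⟩
      edgesIn U′ a + innerIn U′ a p′ + (D + D) ≤⟨ +-monoʳ-≤ (edgesIn U′ a + innerIn U′ a p′)
        (+-mono-≤ D≤ (≤-trans D≤ (≤-reflexive (sym (+-identityʳ _))))) ⟩
      edgesIn U′ a + innerIn U′ a p′ + 2 * (W * deg x + B * n) ∎
      where
      open ≤-Reasoning
      bool : ∀ A B s t e i → b2n ((A ∧ B) ∧ e) + b2n (((A ∧ B) ∧ e) ∧ (if s then (if t then i else false) else not t)) ≤
        b2n (((A ∧ s) ∧ (B ∧ t)) ∧ e) + b2n ((((A ∧ s) ∧ (B ∧ t)) ∧ e) ∧ i) +
        (b2n (A ∧ not s) * b2n (B ∧ e) + b2n (B ∧ not t) * b2n (A ∧ e))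
      bool false _ _ _ _ _ = z≤n
      bool true false _ _ _ _ = z≤n
      bool true true _ _ false _ = z≤n
      bool true true true true true true = ≤-refl
      bool true true true true true false = ≤-refl
      bool true true true false true _ = ≤-refl
      bool true true false true true _ = ≤-refl
      bool true true false false true _ = ≤-refl
      pointwise : ∀ u w → b2n ((U u ∧ U w) ∧ a u w) + b2n (((U u ∧ U w) ∧ a u w) ∧ ⌊ p u ≟ p w ⌋) ≤
        b2n ((U′ u ∧ U′ w) ∧ a u w) + b2n (((U′ u ∧ U′ w) ∧ a u w) ∧ ⌊ p′ u ≟ p′ w ⌋) + (side u w + side w u)
      pointwise u w rewrite same-p u w | a-sym w u = bool (U u) (U w) (a x u) (a x w) (a u w) ⌊ p′ u ≟ p′ w ⌋
    lower : crossIn U′ p′ + 2 * (W * deg x) ≤ crossIn U p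
    lower = begin
      crossIn U′ p′ + 2 * (W * deg x) ≡⟨ cong (crossIn U′ p′ +_)
        (cong₂ _+_ (sym ∑join) (trans (+-identityʳ _) (trans (sym ∑join) (∑-swap (V n) (V n) join)))) ⟩
      crossIn U′ p′ + (∑₂ join + ∑₂ (λ u w → join w u)) ≡⟨ cong (crossIn U′ p′ +_) (sym (∑₂-+ join (λ u w → join w u))) ⟩
      crossIn U′ p′ + ∑₂ (λ u w → join u w + join w u) ≡⟨ sym (∑₂-+ {n} _ _) ⟩
      ∑₂ (λ u w → b2n ((U′ u ∧ U′ w) ∧ not ⌊ p′ u ≟ p′ w ⌋) + (join u w + join w u)) ≤⟨ ∑₂-mono pointwise ⟩
      crossIn U p ∎
      where
      open ≤-Reasoning
      join : Fin n → Fin n → ℕ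
      join u w = b2n (V₁ u) * b2n (U′ w)
      ∑join : ∑₂ join ≡ W * deg x
      ∑join = trans (∑-cong (V n) (λ u → ∑-* (V n) (b2n (V₁ u)) _)) (∑-*ʳ (V n) (deg x) (λ u → b2n (V₁ u)))
      bool : ∀ A B s t i → b2n (((A ∧ s) ∧ (B ∧ t)) ∧ not i) +
        (b2n (A ∧ not s) * b2n (B ∧ t) + b2n (B ∧ not t) * b2n (A ∧ s)) ≤
        b2n ((A ∧ B) ∧ not (if s then (if t then i else false) else not t))
      bool false B s t i = ≤-reflexive (*-zeroʳ (b2n (B ∧ not t)))
      bool true false true t i = z≤n
      bool true false false t i = z≤n
      bool true true true true true = ≤-refl
      bool true true true true false = ≤-refl
      bool true true true false _ = ≤-refl
      bool true true false true _ = ≤-refl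
      bool true true false false _ = ≤-refl
      pointwise : ∀ u w → b2n ((U′ u ∧ U′ w) ∧ not ⌊ p′ u ≟ p′ w ⌋) + (join u w + join w u) ≤ b2n
        ((U u ∧ U w) ∧ not ⌊ p u ≟ p w ⌋)
      pointwise u w rewrite same-p u w = bool (U u) (U w) (a x u) (a x w) ⌊ p′ u ≟ p′ w ⌋

-- Local maximum cuts

neighboursIn : ∀ {n m} → (Fin n → Fin n → Bool) → (Fin n → Fin m) → Fin n → Fin m → ℕ
neighboursIn {n} a p v l = count (V n) (λ w → a v w ∧ ⌊ p w ≟ l ⌋)

innerDegree missingDegree : ∀ {n m} → (Fin n → Fin n → Bool) → (Fin n → Fin m) → Fin n → ℕ
innerDegree {n} a p v = count (V n) (λ w → a v w ∧ ⌊ p v ≟ p w ⌋)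
missingDegree {n} a p v = count (V n) (λ w → not (a v w) ∧ not ⌊ p v ≟ p w ⌋)

-- Stability under moves of a single vertex is enough here, and it is reached by descent on the
-- number of inner edges.
LocalMaxCut : ∀ {n m} → (Fin n → Fin n → Bool) → (Fin n → Fin m) → Set
LocalMaxCut a p = ∀ v l → innerDegree a p v ≤ neighboursIn a p v l

module _ {n m : ℕ} (a : Fin n → Fin n → Bool) (a-sym : ∀ u w → a u w ≡ a w u) (a-irr : ∀ u → a u u ≡ false) where

  inner-move : ∀ (p : Fin n → Fin m) v l → neighboursIn a p v l < innerDegree a p v →
    Σ (Fin n → Fin m) λ p′ → inner a p′ < inner a p
  inner-move p v l gain = p′ , lin 1 (+-mono-≤ (≤-reflexive swapped) (*-monoʳ-≤ 2 (≤-trans (s≤s (≤-reflexive g-row)) gain)))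
      (eq (inner a p) (inner a p′) (∑ (V n) (g v)) (innerDegree a p v))
    where
    eq : ∀ x y g d → suc y + (x + 2 * g + 2 * d) + 1 ≡ x + (y + 2 * d + 2 * suc g)
    eq = solve-∀
    p′ : Fin n → Fin m
    p′ w = if ⌊ w ≟ v ⌋ then l else p w
    f g : Fin n → Fin n → ℕ
    f u w = b2n (a u w ∧ ⌊ p u ≟ p w ⌋)
    g u w = b2n (a u w ∧ ⌊ p′ u ≟ p′ w ⌋)
    symm : ∀ (q : Fin n → Fin m) u w → b2n (a u w ∧ ⌊ q u ≟ q w ⌋) ≡ b2n (a w u ∧ ⌊ q w ≟ q u ⌋)
    symm q u w = cong b2n (cong₂ _∧_ (a-sym u w) (⌊⌋-cong (q u ≟ q w) (q w ≟ q u) sym sym))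
    diag : ∀ (q : Fin n → Fin m) u → b2n (a u u ∧ ⌊ q u ≟ q u ⌋) ≡ 0
    diag q u rewrite a-irr u = refl
    moved : p′ v ≡ l
    moved rewrite ⌊⌋-true (v ≟ v) refl = refl
    kept : ∀ w → w ≢ v → p′ w ≡ p w
    kept w ne rewrite ⌊⌋-false (w ≟ v) ne = refl
    off : ∀ u w → u ≢ v → w ≢ v → f u w ≡ g u w
    off u w nu nw rewrite kept u nu | kept w nw = refl
    g-row : ∑ (V n) (g v) ≡ neighboursIn a p v l
    g-row = ∑-cong (V n) at
      where
      at : ∀ w → g v w ≡ b2n (a v w ∧ ⌊ p w ≟ l ⌋)
      at w with w ≟ v in w≟v
      ... | yes refl rewrite a-irr v = refl
      ... | no ne rewrite moved = cong (λ b → b2n (a v w ∧ b)) (⌊⌋-cong (l ≟ p w) (p w ≟ l) sym sym)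
    swapped : ∑₂ g + 2 * ∑ (V n) (f v) ≡ ∑₂ f + 2 * ∑ (V n) (g v)
    swapped = row-swap g f v (symm p′) (symm p) (diag p′ v) (diag p v) (λ u w nu nw → sym (off u w nu nw))

  local-max-cut : ∀ (p₀ : Fin n → Fin m) → Σ (Fin n → Fin m) λ p → inner a p ≤ inner a p₀ × LocalMaxCut a p
  local-max-cut p₀ = improve (inner a p₀) p₀ ≤-refl
    where
    improve : ∀ k p → inner a p ≤ k → Σ (Fin n → Fin m) λ p → inner a p ≤ k × LocalMaxCut a p
    improve k p le with Fin.any? (λ v → Fin.any? (λ l → suc (neighboursIn a p v l) ≤? innerDegree a p v))
    ... | no stuck = p , le , λ v l → ≮⇒≥ (λ gain → stuck (v , l , gain))
    ... | yes (v , l , gain) with inner-move p v l gain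
    improve zero p le | yes _ | p′ , lt = ⊥-elim (n≮0 (≤-trans lt le))
    improve (suc k) p le | yes _ | p′ , lt with improve k p′ (s≤s⁻¹ (≤-trans lt le))
    ...   | q , le′ , opt = q , m≤n⇒m≤1+n le′ , opt

-- A Turán partition up to an error of n pairs. In a local maximum cut of the complete graph the
-- inner degree of a vertex is at most the average of its degrees into the `suc m` parts, thus at
-- most n/(m+1).
balanced : ∀ n m → Σ (Fin n → Fin (suc m)) λ p → suc m * (n * n) ≤ suc m * cross p + n * n + suc m * n
balanced n m = p , lin 0 (+-mono-≤ (*-monoʳ-≤ (suc m) (≤-trans (≤-reflexive total) (+-monoʳ-≤ (cross p) same≤))) inner≤)
    (eq m n (cross p) (inner ne p))
  where
  eq : ∀ m n c i → (1 + m) * (n * n) + ((1 + m) * (c + (i + n)) + n * n) + 0 ≡ (1 + m) * c + n * n + (1 + m) * n +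
    ((1 + m) * (n * n) + (1 + m) * i)
  eq = solve-∀
  ne : Fin n → Fin n → Bool
  ne u w = not ⌊ u ≟ w ⌋
  optimum : Σ (Fin n → Fin (suc m)) λ p → inner ne p ≤ inner {n} {suc m} ne (λ _ → zero) × LocalMaxCut ne p
  optimum = local-max-cut ne (λ u w → cong not (⌊⌋-cong (u ≟ w) (w ≟ u) sym sym))
    (λ u → cong not (⌊⌋-true (u ≟ u) refl)) (λ _ → zero)
  p : Fin n → Fin (suc m)
  p = proj₁ optimum
  total : n * n ≡ cross p + pairs (λ u w → ⌊ p u ≟ p w ⌋)
  total = sym (trans (cong (cross p +_) (same-pairs p)) (cross+squares p))
  same≤ : pairs (λ u w → ⌊ p u ≟ p w ⌋) ≤ inner ne p + n
  same≤ = ≤-trans (∑₂-mono (λ u w → bool ⌊ u ≟ w ⌋ ⌊ p u ≟ p w ⌋)) (≤-reflexive (trans (∑₂-+ {n} _ _) (cong (inner ne p +_)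
    (trans (∑-swap (V n) (V n) _) (trans (∑-cong (V n) ∑-δ-count) (trans (∑V-const n 1) (*-identityʳ n)))))))
    where
    bool : ∀ e s → b2n s ≤ b2n (not e ∧ s) + b2n e
    bool true  s = b2n≤1 s
    bool false s = m≤m+n _ 0
  inner≤ : suc m * inner ne p ≤ n * n
  inner≤ = begin
    suc m * inner ne p ≡⟨ sym (∑-* (V n) (suc m) _) ⟩
    ∑ (V n) (λ v → suc m * innerDegree ne p v) ≡⟨ ∑-cong (V n) (λ v → sym (∑V-const (suc m) _)) ⟩
    ∑ (V n) (λ v → ∑ (V (suc m)) (λ _ → innerDegree ne p v)) ≤⟨ ∑-mono (V n)
      (λ v → ∑-mono (V (suc m)) (λ l → proj₂ (proj₂ optimum) v l)) ⟩
    ∑ (V n) (λ v → ∑ (V (suc m)) (neighboursIn ne p v)) ≤⟨ ∑-mono (V n) degree ⟩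
    ∑ (V n) (λ v → n) ≡⟨ ∑V-const n n ⟩
    n * n ∎
    where
    open ≤-Reasoning
    degree : ∀ v → ∑ (V (suc m)) (neighboursIn ne p v) ≤ n
    degree v = ≤-trans (∑-mono (V (suc m)) (λ l → ∑-mono (V n) (λ w → bool (ne v w) ⌊ p w ≟ l ⌋)))
      (≤-reflexive (∑-part-size p))
      where
      bool : ∀ x y → b2n (x ∧ y) ≤ b2n y
      bool true  y = ≤-refl
      bool false y = z≤n

-- Partitions of nearly extremal graphs

part-large : ∀ {n m} (p : Fin n → Fin m) i s → 16 * (m * m) * (i + s) ≤ n * n → 16 * (m * m) < n →
  m * (n * n) ≤ m * (cross p + i + s) + n * n + m * n → ∀ l → n < 2 * (m * part-size p l)
part-large {n} {m} p i s small n-large ex-large l with n <? 2 * (m * part-size p l)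
... | yes lt = lt
... | no nlt = ⊥-elim (<-irrefl refl
  (<-≤-trans n-large (*-cancelʳ-≤ n (16 * (m * m)) n ⦃ >-nonZero (≤-trans (s≤s z≤n) n-large) ⦄ n²≤)))
  where
  x y Sq : ℕ
  x = m * part-size p l
  y = n ∸ x
  Sq = ∑ (V m) (λ k → part-size p k * part-size p k)
  2x≤n : 2 * x ≤ n
  2x≤n = ≮⇒≥ nlt
  n≡ : x + y ≡ n
  n≡ = m+[n∸m]≡n (≤-trans (m≤m+n x (x + 0)) 2x≤n)
  defect : x * x + n * n ≡ 2 * (x * n) + y * y
  defect = subst (λ z → x * x + z * z ≡ 2 * (x * z) + y * y) n≡ (eq x y)
    where
    eq : ∀ x y → x * x + (x + y) * (x + y) ≡ 2 * (x * (x + y)) + y * y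
    eq = solve-∀
  -- A part of at most n/(2m) vertices has defect y² ≥ n²/4 in `cauchy`. Then the partition has too
  -- few cross pairs for `ex-large`, since m²(i + s) is at most n²/16 and m²n is below n²/16.
  D≤ : y * y ≤ m * m * (i + s + n)
  D≤ = lin 0 (+-mono-≤ (cauchy m (part-size p) l n (y * y) (∑-part-size p) defect) (*-monoʳ-≤ m
      (+-mono-≤ ex-large (*-monoʳ-≤ m (≤-reflexive (cross+squares p))))))
    (eq m (n * n) (y * y) Sq (cross p) i s n)
    where
    eq : ∀ m N D S c i s n → D + (m * m * S + m * (m * (c + i + s) + N + m * n + m * N)) + 0 ≡
      m * m * (i + s + n) + (m * N + D + m * (m * N + m * (c + S)))
    eq = solve-∀
  n≤2y : n ≤ 2 * y
  n≤2y = lin 0 (+-mono-≤ 2x≤n (≤-reflexive (cong (2 *_) (sym n≡)))) (eq n x y)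
    where
    eq : ∀ n x y → n + (n + 2 * (x + y)) + 0 ≡ 2 * y + (2 * x + 2 * n)
    eq = solve-∀
  n²≤ : n * n ≤ 16 * (m * m) * n
  n²≤ = lin (2 * (n * n)) (+-mono-≤ (*-monoʳ-≤ 4 (*-mono-≤ n≤2y n≤2y)) (+-mono-≤ (*-monoʳ-≤ 16 D≤) small))
    (eq (n * n) y (m * m) (i + s) n)
    where
    eq : ∀ N y M i n → N + (4 * (2 * y * (2 * y)) + (16 * (M * (i + n)) + N)) + 2 * N ≡ 16 * M * n +
      (4 * N + (16 * (y * y) + 16 * M * i))
    eq = solve-∀

-- The summand c is for the bounds asked for by the user, 16m² for `part-large`. The factor 3 arises
-- as follows: with c₁ this number and s < n²/c₁, `few-cliques` gives inner ≤ n²/c₁ + s, so that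
-- inner + s ≤ 3n²/c₁.
setup-factor : ℕ → ℕ → ℕ
setup-factor m c = 3 * (c + 16 * (suc m * suc m))

record Approximation {n} (a : Fin n → Fin n → Bool) (m c d : ℕ) : Set where
  field
    p             : Fin n → Fin m
    local         : LocalMaxCut a p
    inner-small   : c * inner a p ≤ n * n
    missing-small : c * missing a p ≤ n * n
    missing≤      : missing a p ≤ inner a p + d
    large         : ∀ l → n < 2 * (m * part-size p l)

-- Here `x` bounds the cross pairs of all partitions; it will be twice the extremal number. In the
-- first alternative the deficit has order n², so that every partition is close enough.
approximate : ∀ m c {n} (a : Fin n → Fin n → Bool) → (∀ u w → a u w ≡ a w u) → (∀ u → a u u ≡ false) → ∀ x →
  stab-factor m (setup-factor m c) * cliques a (2 + m) (λ _ → true) ≤ n ^ (2 + m) →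
  (∀ (p : Fin n → Fin (suc m)) → cross p ≤ x) → 16 * (suc m * suc m) < n →
  n * n ≤ setup-factor m c * (x ∸ pairs a) ⊎ Approximation a (suc m) c (x ∸ pairs a)
approximate m c {n} a a-sym a-irr x few cross≤ n-large with n * n ≤? setup-factor m c * (x ∸ pairs a)
... | yes le = inj₁ le
... | no ¬le = inj₂ (record
  { p = p ; local = proj₂ (proj₂ cut) ; inner-small = ≤-trans (*-monoˡ-≤ (inner a p) (m≤m+n c _))
    (≤-trans (*-monoʳ-≤ c′ (m≤m+n _ s)) small)
  ; missing-small = ≤-trans (*-mono-≤ (m≤m+n c (16 * (suc m * suc m))) mis≤) small ; missing≤ = mis≤
  ; large = part-large p (inner a p) s (≤-trans (*-monoˡ-≤ (inner a p + s) (m≤n+m _ c)) small) n-large ex-large })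
  where
  s c′ c₁ : ℕ
  s = x ∸ pairs a
  c′ = c + 16 * (suc m * suc m)
  c₁ = setup-factor m c
  x≤ : x ≤ pairs a + s
  x≤ = m≤n+m∸n x (pairs a)
  start : Σ (Fin n → Fin (suc m)) λ p → c₁ * (pairs a + inner a p) ≤ c₁ * cross p + n * n
  start = few-cliques m c₁ a a-sym (λ _ → true) few
  cut : Σ (Fin n → Fin (suc m)) λ p → inner a p ≤ inner a (proj₁ start) × LocalMaxCut a p
  cut = local-max-cut a a-sym a-irr (proj₁ start)
  p : Fin n → Fin (suc m)
  p = proj₁ cut
  small : c′ * (inner a p + s) ≤ n * n
  small = *-cancelˡ-≤ 3 (lin 0 (+-mono-≤ (proj₂ start) (+-mono-≤ (*-monoʳ-≤ c₁ (cross≤ (proj₁ start)))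
      (+-mono-≤ (*-monoʳ-≤ c₁ x≤) (+-mono-≤ (*-monoʳ-≤ 2 (<⇒≤ (≰⇒> ¬le))) (*-monoʳ-≤ c₁ (proj₁ (proj₂ cut)))))))
    (eq c′ (pairs a) (inner a (proj₁ start)) (inner a p) (cross (proj₁ start)) x s (n * n)))
    where
    eq : ∀ c e i₀ i k x s N → 3 * (c * (i + s)) +
      (3 * c * k + N + (3 * c * x + (3 * c * (e + s) + (2 * N + 3 * c * i₀)))) + 0 ≡
      3 * N + (3 * c * (e + i₀) + (3 * c * k + (3 * c * x + (2 * (3 * c * s) + 3 * c * i))))
    eq = solve-∀
  mis≤ : missing a p ≤ inner a p + s
  mis≤ = lin 0 (+-mono-≤ (≤-reflexive (edges+missing p a)) (≤-trans (cross≤ p) x≤))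
    (eq (missing a p) (inner a p) s (pairs a) (cross p))
    where
    eq : ∀ μ i s e k → μ + (k + i + (e + s)) + 0 ≡ i + s + (e + μ + k)
    eq = solve-∀
  -- The bound `x` is at least the cross count of the balanced partition, and at most pairs a + s ≤
  -- cross p + inner + s.
  ex-large : suc m * (n * n) ≤ suc m * (cross p + inner a p + s) + n * n + suc m * n
  ex-large = lin (suc m * missing a p)
    (+-mono-≤ (proj₂ (balanced n m))
    (*-monoʳ-≤ (suc m) (+-mono-≤ (cross≤ (proj₁ (balanced n m))) (+-mono-≤ x≤ (≤-reflexive (edges+missing p a))))))
    (eq m (n * n) n (cross (proj₁ (balanced n m))) x (pairs a) s (missing a p) (cross p) (inner a p))
    where
    eq : ∀ m N n b x e s μ k i → (1 + m) * N + ((1 + m) * b + N + (1 + m) * n + (1 + m) * (x + (e + s + (k + i)))) +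
      (1 + m) * μ ≡
      (1 + m) * (k + i + s) + N + (1 + m) * n + ((1 + m) * N + (1 + m) * (b + (x + (e + μ))))
    eq = solve-∀

-- Eliminating μ gives i ≤ s + E, and then μ ≤ 2s + E. With i instead of 2i in the second hypothesis
-- nothing would follow.
edit-bound : ∀ {μ i s} E → μ ≤ i + s → 2 * i ≤ μ + E → i + μ ≤ 3 * s + 2 * E
edit-bound {μ} {i} {s} E h k = lin 0 (+-mono-≤ (*-monoʳ-≤ 3 h) (*-monoʳ-≤ 2 k)) (eq i μ s E)
  where
  eq : ∀ i μ s E → i + μ + (3 * (i + s) + 2 * (μ + E)) + 0 ≡ 3 * s + 2 * E + (3 * μ + 2 * (2 * i))
  eq = solve-∀

-- Embedding K_m^q along a partition

-- Embedding as a subgraph, induced or not. This is the notion that matches the upward closure of a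
-- family: a graph contains a supergraph of `H` as an induced subgraph exactly if `H` embeds in it.
Embeds : Graph → ∀ {n} → (Fin n → Fin n → Bool) → Set
Embeds H {n} a = Σ (Fin (order H) → Fin n) λ f →
  Injective _≡_ _≡_ f × (∀ u w → adj H u w ≡ true → a (f u) (f w) ≡ true)

all-or-fails : ∀ {A : Set} (P : A → Bool) xs → 1 ≤ b2n (all P xs) + ∑ xs (λ x → b2n (not (P x)))
all-or-fails P []       = ≤-refl
all-or-fails P (x ∷ xs) with P x
... | true  = all-or-fails P xs
... | false = s≤s z≤n

-- For k vertices chosen greedily from sets of size n/h. Call a vertex typical if its missing degree
-- is at most n/(4hk). Then at most n/(4h) vertices are atypical, earlier choices exclude at most
-- n/(4h) by missing edges and fewer than n/(4h) by coincidence, so that n/(4h) candidates remain.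
aligned-factor aligned-size : ℕ → ℕ → ℕ
aligned-factor h k = 16 * (h * h) * k
aligned-size h k = suc (4 * h * k)

module _ {n m : ℕ} (a : Fin n → Fin n → Bool) (p : Fin n → Fin m) where

  compatible : Fin n → Fin n → Bool
  compatible u w = not ⌊ w ≟ u ⌋ ∧ (a u w ∨ ⌊ p u ≟ p w ⌋)

  compatible-≢ : ∀ {u w} → compatible u w ≡ true → w ≢ u
  compatible-≢ {u} {w} e = false-⌊⌋ (w ≟ u) (not-true (proj₁ (∧-true e)))

  compatible-adj : ∀ {u w} → compatible u w ≡ true → p u ≢ p w → a u w ≡ true
  compatible-adj {u} {w} e ne with a u w | p u ≟ p w | proj₂ (∧-true {not ⌊ w ≟ u ⌋} e)
  ... | true | _ | _ = refl
  ... | false | yes e′ | _ = ⊥-elim (ne e′)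

  avoid : ∀ (P : Fin n → Bool) k (u : Fin k → Fin n) →
    count (V n) P ≤ count (V n) (λ w → P w ∧ all (λ t → compatible (u t) w) (V k)) +
      (k + ∑ (V k) (λ t → missingDegree a p (u t)))
  avoid P k u = begin
    count (V n) P ≤⟨ ∑-mono (V n) pointwise ⟩
    ∑ (V n) (λ w → b2n (P w ∧ ok w) + ∑ (V k) (λ t → clash t w)) ≡⟨ ∑-+ (V n) (λ w → b2n (P w ∧ ok w))
      (λ w → ∑ (V k) (λ t → clash t w)) ⟩
    kept + ∑ (V n) (λ w → ∑ (V k) (λ t → clash t w)) ≡⟨ cong (kept +_) (∑-swap (V n) (V k) (λ w t → clash t w)) ⟩
    kept + ∑ (V k) (λ t → ∑ (V n) (clash t)) ≡⟨ cong (kept +_)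
      (∑-cong (V k) (λ t → trans (∑-+ (V n) _ _) (cong (_+ missingDegree a p (u t)) (∑-δ-count (u t))))) ⟩
    kept + ∑ (V k) (λ t → 1 + missingDegree a p (u t)) ≡⟨ cong (kept +_)
      (trans (∑-+ (V k) (λ _ → 1) _)
      (cong (_+ ∑ (V k) (λ t → missingDegree a p (u t))) (trans (∑V-const k 1) (*-identityʳ k)))) ⟩
    kept + (k + ∑ (V k) (λ t → missingDegree a p (u t))) ∎
    where
    open ≤-Reasoning
    ok : Fin n → Bool
    ok w = all (λ t → compatible (u t) w) (V k)
    kept : ℕ
    kept = count (V n) (λ w → P w ∧ ok w)
    clash : Fin k → Fin n → ℕ
    clash t w = b2n ⌊ w ≟ u t ⌋ + b2n (not (a (u t) w) ∧ not ⌊ p (u t) ≟ p w ⌋)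
    bool : ∀ e b s → b2n (not (not e ∧ (b ∨ s))) ≤ b2n e + b2n (not b ∧ not s)
    bool true b s = s≤s z≤n
    bool false true s = z≤n
    bool false false true = z≤n
    bool false false false = ≤-refl
    pointwise : ∀ w → b2n (P w) ≤ b2n (P w ∧ ok w) + ∑ (V k) (λ t → clash t w)
    pointwise w with P w
    ... | false = z≤n
    ... | true = ≤-trans (all-or-fails (λ t → compatible (u t) w) (V k)) (+-monoʳ-≤ (b2n (ok w))
      (∑-mono (V k) (λ t → bool ⌊ w ≟ u t ⌋ (a (u t) w) ⌊ p (u t) ≟ p w ⌋)))

  record Aligned {t} (U : Fin m → Fin n → Bool) (ρ : Fin t → Fin m) : Set where
    field
      vertex   : Fin t → Fin n
      inside   : ∀ x → U (ρ x) (vertex x) ≡ true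
      distinct : Injective _≡_ _≡_ vertex
      adjacent : ∀ x y → ρ x ≢ ρ y → a (vertex x) (vertex y) ≡ true

  module _ (a-sym : ∀ u w → a u w ≡ a w u) (h k : ℕ) (U : Fin m → Fin n → Bool)
    (U-part : ∀ l w → U l w ≡ true → p w ≡ l) (U-large : ∀ l → n ≤ h * count (V n) (U l))
    (few-missing : aligned-factor h k * missing a p ≤ n * n) (n-large : aligned-size h k ≤ n) where

    private
      typical : Fin n → Bool
      typical w = ⌊ 4 * h * k * missingDegree a p w ≤? n ⌋

      few-atypical : 4 * h * count (V n) (λ w → not (typical w)) ≤ n
      few-atypical = *-cancelʳ-≤ _ n n ⦃ >-nonZero (≤-trans (s≤s z≤n) n-large) ⦄ (begin
        4 * h * count (V n) (λ w → not (typical w)) * n ≡⟨ *-assoc (4 * h) _ n ⟩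
        4 * h * (count (V n) (λ w → not (typical w)) * n) ≡⟨ cong (4 * h *_) (sym (∑-*ʳ (V n) n _)) ⟩
        4 * h * ∑ (V n) (λ w → b2n (not (typical w)) * n) ≤⟨ *-monoʳ-≤ (4 * h) (∑-mono (V n) pointwise) ⟩
        4 * h * ∑ (V n) (λ w → 4 * h * k * missingDegree a p w) ≡⟨ cong (4 * h *_) (∑-* (V n) (4 * h * k) _) ⟩
        4 * h * (4 * h * k * missing a p) ≡⟨ eq h k (missing a p) ⟩
        16 * (h * h) * k * missing a p ≤⟨ few-missing ⟩
        n * n ∎)
        where
        open ≤-Reasoning
        eq : ∀ h k μ → 4 * h * (4 * h * k * μ) ≡ 16 * (h * h) * k * μ
        eq = solve-∀
        pointwise : ∀ w → b2n (not (typical w)) * n ≤ 4 * h * k * missingDegree a p w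
        pointwise w with 4 * h * k * missingDegree a p w ≤? n
        ... | yes _ = z≤n
        ... | no ¬p = ≤-trans (≤-reflexive (*-identityˡ n)) (<⇒≤ (≰⇒> ¬p))

      next : ∀ t → suc t ≤ k → (u : Fin t → Fin n) → (∀ x → typical (u x) ≡ true) → ∀ l →
        Σ (Fin n) λ w → U l w ≡ true × typical w ≡ true × (∀ x → compatible (u x) w ≡ true)
      next t t<k u u-typical l = w , proj₁ (∧-true (proj₁ (∧-true w-ok))) , proj₂ (∧-true {U l w} (proj₁ (∧-true w-ok))) ,
          λ x → all-∈ (λ x → compatible (u x) w) (proj₂ (∧-true {U l w ∧ typical w} w-ok)) (∈V x)
        where
        P : Fin n → Bool
        P w = U l w ∧ typical w
        good atypical M : ℕ
        good = count (V n) (λ w → P w ∧ all (λ x → compatible (u x) w) (V t))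
        atypical = count (V n) (λ w → not (typical w))
        M = ∑ (V t) (λ x → missingDegree a p (u x))
        U≤ : count (V n) (U l) ≤ count (V n) P + atypical
        U≤ = ≤-trans (∑-mono (V n) (λ w → bool (U l w) (typical w))) (≤-reflexive (∑-+ (V n) _ _))
          where
          bool : ∀ x y → b2n x ≤ b2n (x ∧ y) + b2n (not y)
          bool false y = z≤n
          bool true true = ≤-refl
          bool true false = ≤-refl
        M≤ : 4 * h * M ≤ n
        M≤ = *-cancelˡ-≤ k ⦃ >-nonZero (≤-trans (s≤s z≤n) t<k) ⦄ (begin
          k * (4 * h * M) ≡⟨ eq h k M ⟩
          4 * h * k * M ≡⟨ sym (∑-* (V t) (4 * h * k) _) ⟩
          ∑ (V t) (λ x → 4 * h * k * missingDegree a p (u x)) ≤⟨ ∑-mono (V t)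
            (λ x → true-⌊⌋ (4 * h * k * missingDegree a p (u x) ≤? n) (u-typical x)) ⟩
          ∑ (V t) (λ x → n) ≡⟨ ∑V-const t n ⟩
          t * n ≤⟨ *-monoˡ-≤ n (<⇒≤ t<k) ⟩
          k * n ∎)
          where
          open ≤-Reasoning
          eq : ∀ h k M → k * (4 * h * M) ≡ 4 * h * k * M
          eq = solve-∀
        t≤ : 4 * h * t ≤ n
        t≤ = ≤-trans (*-monoʳ-≤ (4 * h) (<⇒≤ t<k)) (<⇒≤ n-large)
        n≤ : n ≤ 4 * h * good
        n≤ = lin 0 (+-mono-≤ (*-monoʳ-≤ 4 (U-large l))
          (+-mono-≤ (*-monoʳ-≤ (4 * h) (≤-trans U≤ (+-monoˡ-≤ atypical (avoid P t u))))
            (+-mono-≤ few-atypical (+-mono-≤ M≤ t≤))))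
          (eq n h (count (V n) (U l)) good t M atypical)
          where
          eq : ∀ n h U g t M A → n + (4 * (h * U) + (4 * h * (g + (t + M) + A) + (n + (n + n)))) + 0 ≡
            4 * h * g + (4 * n + (4 * h * U + (4 * h * A + (4 * h * M + 4 * h * t))))
          eq = solve-∀
        found : ∃ λ w → w ∈ V n × (P w ∧ all (λ x → compatible (u x) w) (V t)) ≡ true
        found = count-exists (V n) _ (n≢0⇒n>0 (λ e → n≮0 (<-≤-trans n-large (≤-trans n≤
          (≤-reflexive (trans (cong (4 * h *_) e) (*-zeroʳ (4 * h))))))))
        w : Fin n
        w = proj₁ found
        w-ok : (P w ∧ all (λ x → compatible (u x) w) (V t)) ≡ true
        w-ok = proj₂ (proj₂ found)

      extend : ∀ t → (ρ : Fin (suc t) → Fin m) (A : Aligned U (λ x → ρ (suc x))) →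
        (Σ (Fin n) λ w → U (ρ zero) w ≡ true × typical w ≡ true × (∀ x → compatible (Aligned.vertex A x) w ≡ true)) →
          Aligned U ρ
      extend t ρ A (w , w-in , _ , w-ok) =
        record { vertex = vertex ; inside = inside ; distinct = distinct ; adjacent = adjacent }
        where
        module A = Aligned A
        vertex : Fin (suc t) → Fin n
        vertex zero    = w
        vertex (suc x) = A.vertex x
        inside : ∀ x → U (ρ x) (vertex x) ≡ true
        inside zero    = w-in
        inside (suc x) = A.inside x
        distinct : Injective _≡_ _≡_ vertex
        distinct {zero}  {zero}  e = refl
        distinct {zero}  {suc y} e = ⊥-elim (compatible-≢ (w-ok y) e)
        distinct {suc x} {zero}  e = ⊥-elim (compatible-≢ (w-ok x) (sym e))
        distinct {suc x} {suc y} e = cong suc (A.distinct e)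
        join : ∀ x → ρ (suc x) ≢ ρ zero → a (A.vertex x) w ≡ true
        join x ne = compatible-adj (w-ok x) (λ e → ne (trans (sym (U-part _ _ (A.inside x))) (trans e (U-part _ _ w-in))))
        adjacent : ∀ x y → ρ x ≢ ρ y → a (vertex x) (vertex y) ≡ true
        adjacent zero    zero    ne = ⊥-elim (ne refl)
        adjacent zero    (suc y) ne = trans (a-sym _ _) (join y (λ e → ne (sym e)))
        adjacent (suc x) zero    ne = join x ne
        adjacent (suc x) (suc y) ne = A.adjacent x y ne

      greedy : ∀ t → t ≤ k → (ρ : Fin t → Fin m) → Σ (Aligned U ρ) λ A → ∀ x → typical (Aligned.vertex A x) ≡ true
      greedy zero t≤k ρ = record { vertex = λ () ; inside = λ () ; distinct = λ {x} → ⊥-elim (Fin.¬Fin0 x) ; adjacent =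
        λ () } , λ ()
      greedy (suc t) t≤k ρ = extend t ρ A chosen , all-typical
        where
        A : Aligned U (λ x → ρ (suc x))
        A = proj₁ (greedy t (<⇒≤ t≤k) (λ x → ρ (suc x)))
        A-typical : ∀ x → typical (Aligned.vertex A x) ≡ true
        A-typical = proj₂ (greedy t (<⇒≤ t≤k) (λ x → ρ (suc x)))
        chosen : Σ (Fin n) λ w → U (ρ zero) w ≡ true × typical w ≡ true × (∀ x → compatible (Aligned.vertex A x) w ≡ true)
        chosen = next t t≤k (Aligned.vertex A) A-typical (ρ zero)
        all-typical : ∀ x → typical (Aligned.vertex (extend t ρ A chosen) x) ≡ true
        all-typical zero    = proj₁ (proj₂ (proj₂ chosen))
        all-typical (suc x) = A-typical x

    -- The sets `U l` are smaller than the parts, so that the copy can be attached to vertices given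
    -- beforehand: they will be the hosts of some vertices, the neighbourhood of one vertex, or
    -- common neighbourhoods.
    aligned : (ρ : Fin k → Fin m) → Aligned U ρ
    aligned ρ = proj₁ (greedy k ≤-refl ρ)

module _ {n : ℕ} (a : Fin n → Fin n → Bool) (a-sym : ∀ u w → a u w ≡ a w u) (a-irr : ∀ u → a u u ≡ false)
  (m : ℕ) (j : Fin m) (F : Graph) where

  private
    q : ℕ
    q = order F
    part : Fin (m * q) → Fin m
    part u = proj₁ (remQuot {m} q u)
    index : Fin (m * q) → Fin q
    index u = proj₂ (remQuot {m} q u)

  -- `S` places K_m^q and `g` takes over on part `j`, where it may overlap `S`. Between the two,
  -- distinctness follows from adjacency and irreflexivity.
  assemble : (S : Fin (m * q) → Fin n) (g : Fin q → Fin n) →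
    Injective _≡_ _≡_ S → (∀ u w → part u ≢ part w → a (S u) (S w) ≡ true) →
    Injective _≡_ _≡_ g → (∀ s t → adj F s t ≡ true → a (g s) (g t) ≡ true) →
    (∀ t u → part u ≢ j → a (g t) (S u) ≡ true) → Embeds (KmqPlus m j F) a
  assemble S g S-inj S-adj g-inj g-hom joined = (λ u → f u (part u ≟ j)) ,
    (λ {u} {w} → f-inj u w (part u ≟ j) (part w ≟ j)) ,
      (λ u w → f-hom u w (part u ≟ j) (part w ≟ j))
    where
    f : ∀ u → Dec (part u ≡ j) → Fin n
    f u (yes _) = g (index u)
    f u (no _)  = S u
    apart : ∀ {x y} → x ≡ y → a x y ≡ true → ⊥
    apart {x} refl e = absurd-bool e (a-irr x)
    f-inj : ∀ u w d e → f u d ≡ f w e → u ≡ w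
    f-inj u w (yes d) (yes e) eq = trans (sym (Fin.combine-remQuot {m} q u)) (trans
      (cong₂ combine (trans d (sym e)) (g-inj eq)) (Fin.combine-remQuot {m} q w))
    f-inj u w (yes d) (no e)  eq = ⊥-elim (apart eq (joined (index u) w e))
    f-inj u w (no d)  (yes e) eq = ⊥-elim (apart (sym eq) (joined (index w) u d))
    f-inj u w (no d)  (no e)  eq = S-inj eq
    f-hom : ∀ u w d e → adj (KmqPlus m j F) u w ≡ true → a (f u d) (f w e) ≡ true
    f-hom u w d e ad with part u ≟ part w
    f-hom u w (yes d) (yes e) ad | yes s = g-hom _ _ (proj₂ (∧-true {⌊ part u ≟ j ⌋} ad))
    f-hom u w (yes d) (no e)  ad | yes s = ⊥-elim (e (trans (sym s) d))
    f-hom u w (no d)  e       ad | yes s = ⊥-elim (d (true-⌊⌋ (part u ≟ j) (proj₁ (∧-true ad))))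
    f-hom u w (yes d) (yes e) ad | no s = ⊥-elim (s (trans d (sym e)))
    f-hom u w (yes d) (no e)  ad | no s = joined (index u) w e
    f-hom u w (no d)  (yes e) ad | no s = trans (a-sym _ _) (joined (index w) u d)
    f-hom u w (no d)  (no e)  ad | no s = S-adj u w s

-- Embedding forests

two-distinct : ∀ {n} (P : Fin n → Bool) x y → x ≢ y → P x ≡ true → P y ≡ true → 2 ≤ count (V n) P
two-distinct {n} P x y x≢y px py = ≤-trans
  (≤-reflexive (sym (trans (∑-+ (V n) (λ z → b2n ⌊ z ≟ x ⌋) (λ z → b2n ⌊ z ≟ y ⌋)) (cong₂ _+_ (∑-δ-count x) (∑-δ-count y)))))
  (∑-mono (V n) pointwise)
  where
  pointwise : ∀ z → b2n ⌊ z ≟ x ⌋ + b2n ⌊ z ≟ y ⌋ ≤ b2n (P z)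
  pointwise z with z ≟ x | z ≟ y
  ... | yes refl | yes refl = ⊥-elim (x≢y refl)
  ... | yes refl | no _ = ≤-reflexive (sym (cong b2n px))
  ... | no _ | yes refl = ≤-reflexive (sym (cong b2n py))
  ... | no _ | no _ = z≤n

another : ∀ {n} (P : Fin n → Bool) z → 2 ≤ count (V n) P → Σ (Fin n) λ y → P y ≡ true × y ≢ z
another {n} P z two with ∑-exists (V n) {λ y → b2n (P y)} {λ y → b2n ⌊ y ≟ z ⌋}
  (≤-trans (s≤s (≤-reflexive (∑-δ-count z))) two)
... | y , _ , lt with P y in eq | y ≟ z
...   | true  | no ne = y , eq , ne
...   | true  | yes _ = ⊥-elim (1+n≰n lt)
...   | false | yes _ = ⊥-elim (n≮0 lt)
...   | false | no _  = ⊥-elim (n≮0 lt)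

without : ∀ {n} → (Fin n → Bool) → Fin n → Fin n → Bool
without P v x = P x ∧ not ⌊ x ≟ v ⌋

count-without : ∀ {n} (P : Fin n → Bool) v → P v ≡ true → count (V n) P ≡ suc (count (V n) (without P v))
count-without {n} P v pv = trans (∑-cong (V n) pointwise)
  (trans (∑-+ (V n) (λ x → b2n ⌊ x ≟ v ⌋) (λ x → b2n (without P v x))) (cong (_+ count (V n) (without P v)) (∑-δ-count v)))
  where
  pointwise : ∀ x → b2n (P x) ≡ b2n ⌊ x ≟ v ⌋ + b2n (without P v x)
  pointwise x with x ≟ v
  ... | yes refl rewrite pv = refl
  ... | no _ = cong b2n (sym (∧-identityʳ (P x)))

module _ (F : Graph) where

  private
    q : ℕ
    q = order F

  module _ (X : Fin q → Bool) (branching : ∀ x → X x ≡ true → 2 ≤ count (V q) (λ y → X y ∧ adj F x y)) where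

    record Path (L : ℕ) : Set where
      field
        at        : Fin (suc L) → Fin q
        at-inj    : Injective _≡_ _≡_ at
        at-adj    : ∀ s t → toℕ t ≡ suc (toℕ s) → adj F (at s) (at t) ≡ true
        at-inside : ∀ s → X (at s) ≡ true

    continue-path : ∀ {L} (P : Path L) → Σ (Fin q) λ y → X y ≡ true × adj F (Path.at P zero) y ≡ true ×
      (∀ s → toℕ s ≡ 1 → Path.at P s ≢ y)
    continue-path {zero} P with another (λ y → X y ∧ adj F (Path.at P zero) y) (Path.at P zero)
      (branching _ (Path.at-inside P zero))
    ... | y , e , _ = y , proj₁ (∧-true e) , proj₂ (∧-true {X y} e) , λ { zero () }
    continue-path {suc L} P with another (λ y → X y ∧ adj F (Path.at P zero) y) (Path.at P (suc zero))
      (branching _ (Path.at-inside P zero))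
    ... | y , e , ne = y , proj₁ (∧-true e) , proj₂ (∧-true {X y} e) , λ { (suc zero) _ eq → ne (sym eq) }

    -- Paths grow at index 0. A chord from there to index s closes the initial segment to a cycle,
    -- and s ≥ 2 provides its three vertices.
    close-path : ∀ {L} (P : Path L) s → adj F (Path.at P zero) (Path.at P s) ≡ true → toℕ s ≢ 1 → HasCycle F
    close-path P zero ad s≢1 = ⊥-elim (absurd-bool ad (irrefl F _))
    close-path {suc L} P (suc zero) ad s≢1 = ⊥-elim (s≢1 refl)
    close-path {suc L} P (suc (suc s)) ad s≢1 = toℕ s , (λ t → at (emb t)) ,
      (λ e → Fin.inject≤-injective _ _ _ _ (at-inj e)) ,
        (λ i → at-adj _ _ (trans (Fin.toℕ-inject≤ (suc i) bound)
          (cong suc (sym (trans (Fin.toℕ-inject≤ (inject₁ i) bound) (Fin.toℕ-inject₁ i)))))) ,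
        trans (adjSym F _ _) (subst₂ (λ x y → adj F (at x) (at y) ≡ true)
          (Fin.toℕ-injective (sym (Fin.toℕ-inject≤ zero bound)))
          (Fin.toℕ-injective (sym (trans (Fin.toℕ-inject≤ (fromℕ (2 + toℕ s)) bound) (Fin.toℕ-fromℕ (2 + toℕ s))))) ad)
      where
      open Path P
      bound : 3 + toℕ s ≤ suc (suc L)
      bound = s≤s (Fin.toℕ<n (suc s))
      emb : Fin (3 + toℕ s) → Fin (suc (suc L))
      emb t = Data.Fin.inject≤ t bound

    prolong-path : ∀ {L} (P : Path L) y → X y ≡ true → adj F (Path.at P zero) y ≡ true → (∀ s → Path.at P s ≢ y) → Path
      (suc L)
    prolong-path {L} P y Xy ad new = record { at = at ; at-inj = at-inj ; at-adj = at-adj ; at-inside = at-inside }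
      where
      module P = Path P
      at : Fin (suc (suc L)) → Fin q
      at zero    = y
      at (suc s) = P.at s
      at-inj : Injective _≡_ _≡_ at
      at-inj {zero}  {zero}  e = refl
      at-inj {zero}  {suc t} e = ⊥-elim (new t (sym e))
      at-inj {suc s} {zero}  e = ⊥-elim (new s e)
      at-inj {suc s} {suc t} e = cong suc (P.at-inj e)
      at-adj : ∀ s t → toℕ t ≡ suc (toℕ s) → adj F (at s) (at t) ≡ true
      at-adj zero    (suc zero) e = trans (adjSym F _ _) ad
      at-adj (suc s) (suc t)    e = P.at-adj s t (suc-injective e)
      at-inside : ∀ s → X (at s) ≡ true
      at-inside zero    = Xy
      at-inside (suc s) = P.at-inside s

    path-cycle : ∀ fuel L → q ≤ fuel + L → Path L → HasCycle F
    path-cycle zero L q≤ P = ⊥-elim (1+n≰n (≤-trans (Fin.injective⇒≤ (Path.at-inj P)) q≤))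
    path-cycle (suc fuel) L q≤ P with continue-path P
    ... | y , Xy , ad , not-second with Fin.any? (λ s → Path.at P s ≟ y)
    ...   | yes (s , refl) = close-path P s ad (λ e → not-second s e refl)
    ...   | no new = path-cycle fuel (suc L) (≤-trans q≤ (≤-reflexive (sym (+-suc fuel L))))
      (prolong-path P y Xy ad (λ s e → new (s , e)))

    branching-cycle : ∀ x → X x ≡ true → HasCycle F
    branching-cycle x Xx = path-cycle q 0 (≤-reflexive (sym (+-identityʳ q))) (record
      { at = λ _ → x ; at-inj = λ { {zero} {zero} _ → refl } ; at-adj = λ { zero zero () } ; at-inside = λ _ → Xx })

  -- Each vertex has at most one neighbour among those after it. Read from the end, this is an order
  -- in which a forest can be embedded with one adjacency to respect at a time.
  data Elimination : List (Fin q) → Set where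
    []   : Elimination []
    elim : ∀ {v vs} → (∀ x → x ∈ vs → v ≢ x) →
      (∀ x y → x ∈ vs → y ∈ vs → adj F v x ≡ true → adj F v y ≡ true → x ≡ y) → Elimination vs → Elimination (v ∷ vs)

  -- If every vertex of `X` had two neighbours in `X`, a path could be prolonged until it closes to
  -- a cycle. So some vertex has at most one, and it is removed first.
  eliminate : Forest F → ∀ k (X : Fin q → Bool) → count (V q) X ≡ k →
    Σ (List (Fin q)) λ vs → Elimination vs × length vs ≡ k × (∀ x → X x ≡ true → x ∈ vs) × (∀ x → x ∈ vs → X x ≡ true)
  eliminate forest zero X size = [] , [] , refl ,
    (λ x Xx → ⊥-elim (1+n≰n (≤-trans (count-∈ X (∈V x) Xx) (≤-reflexive size)))) , (λ _ ())
  eliminate forest (suc k) X size with Fin.any? (λ v → ⌊leaf⌋? v)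
    where
    ⌊leaf⌋? : ∀ v → Dec (X v ≡ true × count (V q) (λ y → X y ∧ adj F v y) ≤ 1)
    ⌊leaf⌋? v = (X v Bool.≟ true) ×-dec (count (V q) (λ y → X y ∧ adj F v y) ≤? 1)
  ... | no none = ⊥-elim (forest (branching-cycle X (λ x Xx → ≰⇒> (λ le → none (x , Xx , le))) _ (proj₂ (proj₂ start))))
    where
    start : ∃ λ x → x ∈ V q × X x ≡ true
    start = count-exists (V q) X (≤-trans (s≤s z≤n) (≤-reflexive (sym size)))
  ... | yes (v , Xv , leaf) with eliminate forest k (without X v) (suc-injective (trans (sym (count-without X v Xv)) size))
  ...   | vs , el , len , covers , inside = v ∷ vs , elim
    (λ x m e → false-⌊⌋ (x ≟ v) (not-true (proj₂ (∧-true {X x} (inside x m)))) (sym e)) unique el ,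
      cong suc len , cover , λ { _ (here refl) → Xv ; x (there m) → proj₁ (∧-true (inside x m)) }
    where
    unique : ∀ x y → x ∈ vs → y ∈ vs → adj F v x ≡ true → adj F v y ≡ true → x ≡ y
    unique x y mx my ax ay with x ≟ y
    ... | yes e = e
    ... | no ne = ⊥-elim (1+n≰n (≤-trans (two-distinct (λ y → X y ∧ adj F v y) x y ne
      (true-∧ (proj₁ (∧-true (inside x mx))) ax) (true-∧ (proj₁ (∧-true (inside y my))) ay)) leaf))
    cover : ∀ x → X x ≡ true → x ∈ v ∷ vs
    cover x Xx with x ≟ v in eq
    ... | yes refl = here refl
    ... | no _ = there (covers x (true-∧ Xx (cong (not ∘ ⌊_⌋) eq)))

  module _ {n : ℕ} (a : Fin n → Fin n → Bool) (a-sym : ∀ u w → a u w ≡ a w u) (U : Fin n → Bool) (z₀ : Fin n)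
    (Uz₀ : U z₀ ≡ true)
    (min-degree : ∀ z → U z ≡ true → q ≤ count (V n) (λ w → U w ∧ a z w)) where

    record Partial (vs : List (Fin q)) : Set where
      field
        map-to   : Fin q → Fin n
        inside   : ∀ x → x ∈ vs → U (map-to x) ≡ true
        distinct : ∀ x y → x ∈ vs → y ∈ vs → map-to x ≡ map-to y → x ≡ y
        hom      : ∀ x y → x ∈ vs → y ∈ vs → adj F x y ≡ true → a (map-to x) (map-to y) ≡ true

    fresh : ∀ (g : Fin q → Fin n) vs → suc (length vs) ≤ q → ∀ z → U z ≡ true →
      Σ (Fin n) λ y → U y ≡ true × a z y ≡ true × (∀ x → x ∈ vs → y ≢ g x)
    fresh g vs len z Uz with ∑-exists (V n) {λ w → b2n (U w ∧ a z w)} {λ w → ∑ vs (λ x → b2n ⌊ w ≟ g x ⌋)}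
      (≤-trans (≤-trans (s≤s (≤-reflexive used)) len) (min-degree z Uz))
      where
      used : ∑ (V n) (λ w → ∑ vs (λ x → b2n ⌊ w ≟ g x ⌋)) ≡ length vs
      used = trans (∑-swap (V n) vs _) (trans (∑-cong vs (λ x → ∑-δ-count (g x))) (trans (∑-const vs 1) (*-identityʳ _)))
    ... | y , _ , lt with U y ∧ a z y in eq
    ...   | false = ⊥-elim (n≮0 lt)
    ...   | true = y , proj₁ (∧-true eq) , proj₂ (∧-true {U y} eq) ,
      λ x m e → 1+n≰n (≤-trans lt (≤-trans (≤-reflexive (sym (cong b2n (⌊⌋-true (y ≟ g x) e))))
        (∑-∈ (λ x → b2n ⌊ y ≟ g x ⌋) m)))

    extend-at : ∀ {v vs} → (∀ x → x ∈ vs → v ≢ x) → (P : Partial vs) (y : Fin n) → U y ≡ true →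
      (∀ x → x ∈ vs → y ≢ Partial.map-to P x) → (∀ x → x ∈ vs → adj F v x ≡ true → a y (Partial.map-to P x) ≡ true) →
        Partial (v ∷ vs)
    extend-at {v} {vs} v∉ P y Uy new joined = record { map-to = g ; inside = inside ; distinct = distinct ; hom = hom }
      where
      module P = Partial P
      g : Fin q → Fin n
      g x = if ⌊ x ≟ v ⌋ then y else P.map-to x
      g-v : g v ≡ y
      g-v rewrite ⌊⌋-true (v ≟ v) refl = refl
      g-old : ∀ x → x ∈ vs → g x ≡ P.map-to x
      g-old x m rewrite ⌊⌋-false (x ≟ v) (λ e → v∉ x m (sym e)) = refl
      inside : ∀ x → x ∈ v ∷ vs → U (g x) ≡ true
      inside x (here refl) = trans (cong U g-v) Uy
      inside x (there m) = trans (cong U (g-old x m)) (P.inside x m)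
      distinct : ∀ x x′ → x ∈ v ∷ vs → x′ ∈ v ∷ vs → g x ≡ g x′ → x ≡ x′
      distinct x x′ (here refl) (here refl) e = refl
      distinct x x′ (here refl) (there m) e = ⊥-elim (new x′ m (trans (sym g-v) (trans e (g-old x′ m))))
      distinct x x′ (there m) (here refl) e = ⊥-elim (new x m (trans (sym g-v) (trans (sym e) (g-old x m))))
      distinct x x′ (there m) (there m′) e = P.distinct x x′ m m′ (trans (sym (g-old x m)) (trans e (g-old x′ m′)))
      hom : ∀ x x′ → x ∈ v ∷ vs → x′ ∈ v ∷ vs → adj F x x′ ≡ true → a (g x) (g x′) ≡ true
      hom x x′ (here refl) (here refl) ad = ⊥-elim (absurd-bool ad (irrefl F x))
      hom x x′ (here refl) (there m) ad = trans (cong₂ a g-v (g-old x′ m)) (joined x′ m ad)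
      hom x x′ (there m) (here refl) ad = trans (cong₂ a (g-old x m) g-v)
        (trans (a-sym _ _) (joined x m (trans (adjSym F _ _) ad)))
      hom x x′ (there m) (there m′) ad = trans (cong₂ a (g-old x m) (g-old x′ m′)) (P.hom x x′ m m′ ad)

    embed-list : ∀ vs → Elimination vs → length vs ≤ q → Partial vs
    embed-list [] [] len = record { map-to = λ _ → z₀ ; inside = λ _ () ; distinct = λ _ _ () ; hom = λ _ _ () }
    embed-list (v ∷ vs) (elim v∉ unique el) len with embed-list vs el (<⇒≤ len)
    ... | P with Any.any? (λ x → adj F v x Bool.≟ true) vs
    ...   | no none with fresh (Partial.map-to P) vs len z₀ Uz₀
    ...     | y , Uy , _ , new = extend-at v∉ P y Uy new (λ x m ad → ⊥-elim (none (Any.map (λ { refl → ad }) m)))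
    embed-list (v ∷ vs) (elim v∉ unique el) len | P | yes some with Mem.find some
    ... | x , m , ad with fresh (Partial.map-to P) vs len (Partial.map-to P x) (Partial.inside P x m)
    ...   | y , Uy , ay , new = extend-at v∉ P y Uy new (λ x′ m′ ad′ →
      trans (a-sym _ _) (subst (λ t → a (Partial.map-to P t) y ≡ true) (unique x x′ m m′ ad ad′) ay))

    embed-forest : Forest F → Σ (Fin q → Fin n) λ g → Injective _≡_ _≡_ g ×
      (∀ s t → adj F s t ≡ true → a (g s) (g t) ≡ true) × (∀ t → U (g t) ≡ true)
    embed-forest forest with eliminate forest q (λ _ → true) (trans (∑V-const q 1) (*-identityʳ q))
    ... | vs , el , len , covers , _ with embed-list vs el (≤-reflexive len)
    ...   | P = P.map-to , P.distinct _ _ (covers _ refl) (covers _ refl) ,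
      (λ s t → P.hom s t (covers s refl) (covers t refl)) ,
      λ t → P.inside t (covers t refl)
      where module P = Partial P

-- Subsets of large minimum degree

module _ {n : ℕ} (a : Fin n → Fin n → Bool) (a-sym : ∀ u w → a u w ≡ a w u) (a-irr : ∀ u → a u u ≡ false) (q : ℕ) where

  DenseCore : (Fin n → Bool) → Set
  DenseCore W = Σ (Fin n → Bool) λ U → (∀ x → U x ≡ true → W x ≡ true) × (∃ λ z → U z ≡ true) ×
    (∀ z → U z ≡ true → q ≤ count (V n) (λ w → U w ∧ a z w))

  edgesIn-without : ∀ W v → W v ≡ true → edgesIn W a ≡ edgesIn (without W v) a + 2 * count (V n) (λ w → W w ∧ a v w)
  edgesIn-without W v Wv = trans (sym (+-identityʳ _)) (trans (cong (λ z → edgesIn W a + 2 * z) (sym row′))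
    (trans (row-swap f g v (symm W) (symm (without W v)) (diag W) (diag (without W v)) off) (cong (λ z → ∑₂ g + 2 * z) row)))
    where
    f g : Fin n → Fin n → ℕ
    f u w = b2n ((W u ∧ W w) ∧ a u w)
    g u w = b2n ((without W v u ∧ without W v w) ∧ a u w)
    symm : ∀ (X : Fin n → Bool) u w → b2n ((X u ∧ X w) ∧ a u w) ≡ b2n ((X w ∧ X u) ∧ a w u)
    symm X u w = cong b2n (cong₂ _∧_ (∧-comm (X u) (X w)) (a-sym u w))
    diag : ∀ (X : Fin n → Bool) → b2n ((X v ∧ X v) ∧ a v v) ≡ 0
    diag X rewrite a-irr v | ∧-zeroʳ (X v ∧ X v) = refl
    off : ∀ u w → u ≢ v → w ≢ v → f u w ≡ g u w
    off u w nu nw rewrite ⌊⌋-false (u ≟ v) nu | ⌊⌋-false (w ≟ v) nw | ∧-identityʳ (W u) | ∧-identityʳ (W w) = refl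
    row : ∑ (V n) (f v) ≡ count (V n) (λ w → W w ∧ a v w)
    row = ∑-cong (V n) (λ w → cong (λ b → b2n ((b ∧ W w) ∧ a v w)) Wv)
    row′ : ∑ (V n) (g v) ≡ 0
    row′ = ∑-zero (V n) gone
      where
      gone : ∀ w → g v w ≡ 0
      gone w rewrite ⌊⌋-true (v ≟ v) refl | ∧-zeroʳ (W v) = refl

  -- Vertices of degree below q are deleted one by one. Either this stops at a core or it exhausts
  -- `W`, and every deletion removes fewer than 2q ordered pairs.
  dense-core : ∀ k W → count (V n) W ≡ k → DenseCore W ⊎ edgesIn W a ≤ 2 * q * k
  dense-core zero W size = inj₂ (≤-reflexive (trans (∑-zero (V n) (λ u → ∑-zero (V n) (none u))) (sym (*-zeroʳ (2 * q)))))
    where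
    none : ∀ u w → b2n ((W u ∧ W w) ∧ a u w) ≡ 0
    none u w with W u in eq
    ... | false = refl
    ... | true = ⊥-elim (1+n≰n (≤-trans (count-∈ W (∈V u) eq) (≤-reflexive size)))
  dense-core (suc k) W size with Fin.any? (λ v → (W v Bool.≟ true) ×-dec (suc (count (V n) (λ w → W w ∧ a v w)) ≤? q))
  ... | no none = inj₁ (W , (λ _ e → e) , (proj₁ start , proj₂ (proj₂ start)) , λ z Wz → ≮⇒≥ (λ lt → none (z , Wz , lt)))
    where
    start : ∃ λ x → x ∈ V n × W x ≡ true
    start = count-exists (V n) W (≤-trans (s≤s z≤n) (≤-reflexive (sym size)))
  ... | yes (v , Wv , low) with dense-core k (without W v) (suc-injective (trans (sym (count-without W v Wv)) size))
  ...   | inj₁ (U , sub , z , deg) = inj₁ (U , (λ x Ux → proj₁ (∧-true (sub x Ux))) , z , deg)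
  ...   | inj₂ sparse = inj₂ (≤-trans (≤-reflexive (edgesIn-without W v Wv))
    (lin 0 (+-mono-≤ sparse (*-monoʳ-≤ 2 (<⇒≤ low))) (eq (edgesIn (without W v) a) (count (V n) (λ w → W w ∧ a v w)) q k)))
    where
    eq : ∀ e d q k → e + 2 * d + (2 * q * k + 2 * q) + 0 ≡ 2 * q * (1 + k) + (e + 2 * d)
    eq = solve-∀

-- Inner edges of a partition

∑-injective : ∀ {n q} (h : Fin q → Fin n) → Injective _≡_ _≡_ h → ∀ (f : Fin n → ℕ) → ∑ (V q) (λ t → f (h t)) ≤ ∑ (V n) f
∑-injective {n} {q} h h-inj f = begin
  ∑ (V q) (λ t → f (h t)) ≡⟨ ∑-cong (V q) (λ t → sym (∑-δ (h t) f)) ⟩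
  ∑ (V q) (λ t → ∑ (V n) (λ w → b2n ⌊ w ≟ h t ⌋ * f w)) ≡⟨ ∑-swap (V q) (V n) _ ⟩
  ∑ (V n) (λ w → ∑ (V q) (λ t → b2n ⌊ w ≟ h t ⌋ * f w)) ≡⟨ ∑-cong (V n) (λ w → ∑-*ʳ (V q) (f w) _) ⟩
  ∑ (V n) (λ w → ∑ (V q) (λ t → b2n ⌊ w ≟ h t ⌋) * f w) ≤⟨ ∑-mono (V n)
    (λ w → ≤-trans (*-monoˡ-≤ (f w) (hits w)) (≤-reflexive (*-identityˡ (f w)))) ⟩
  ∑ (V n) f ∎
  where
  open ≤-Reasoning
  hits : ∀ w → ∑ (V q) (λ t → b2n ⌊ w ≟ h t ⌋) ≤ 1
  hits w with Fin.any? (λ t → w ≟ h t)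
  ... | yes (t₀ , refl) = ≤-reflexive (trans (∑-cong (V q) (λ t → cong b2n
      (⌊⌋-cong (h t₀ ≟ h t) (t ≟ t₀) (λ e → sym (h-inj e)) (λ e → cong h (sym e))))) (∑-δ-count t₀))
  ... | no none = ≤-trans (≤-reflexive (∑-zero (V q) (λ t → cong b2n (⌊⌋-false (w ≟ h t) (λ e → none (t , e)))))) z≤n

image-count : ∀ {n q} (P : Fin n → Bool) (h : Fin q → Fin n) → Injective _≡_ _≡_ h → (∀ t → P (h t) ≡ true) → q ≤ count
  (V n) P
image-count {n} {q} P h h-inj Ph = ≤-trans
  (≤-reflexive (sym (trans (∑-cong (V q) (λ t → cong b2n (Ph t))) (trans (∑V-const q 1) (*-identityʳ q)))))
  (∑-injective h h-inj (λ w → b2n (P w)))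

-- Order zero is split off because the embedding of a forest needs a vertex to start from.
empty-or-inhabited : ∀ k → (∀ {C : Set} → Fin k → C) ⊎ Fin k
empty-or-inhabited zero    = inj₁ (λ ())
empty-or-inhabited (suc k) = inj₂ zero

module _ {n : ℕ} (a : Fin n → Fin n → Bool) (a-sym : ∀ u w → a u w ≡ a w u) (a-irr : ∀ u → a u u ≡ false)
  (m : ℕ) (j : Fin m) (F : Graph) where

  private
    q : ℕ
    q = order F
    part : Fin (m * q) → Fin m
    part u = proj₁ (remQuot {m} q u)
    index : Fin (m * q) → Fin q
    index u = proj₂ (remQuot {m} q u)

  empty-embeds : (∀ {C : Set} → Fin q → C) → Embeds (KmqPlus m j F) a
  empty-embeds none = (λ u → none (index u)) , (λ {u} → none (index u)) , (λ u → none (index u))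

  -- Parts `zero` and `suc j` merge into part `j`. They span a K_{q,q}, whose minimum degree q
  -- suffices for a forest on q vertices.
  multipartite-embeds : ∀ {W} → Forest F → Multipartite a W (suc m) q → Embeds (KmqPlus m j F) a
  multipartite-embeds forest M = by-order (empty-or-inhabited q)
    where
    module M = Multipartite M
    hits : Fin (suc m) → Fin n → Bool
    hits i w = ⌊ Fin.any? (λ t → w ≟ M.vertex i t) ⌋
    hit : ∀ i t → hits i (M.vertex i t) ≡ true
    hit i t = ⌊⌋-true (Fin.any? (λ s → M.vertex i t ≟ M.vertex i s)) (t , refl)
    U : Fin n → Bool
    U w = hits zero w ∨ hits (suc j) w
    U-cases : ∀ {w} → U w ≡ true → (∃ λ t → w ≡ M.vertex zero t) ⊎ (∃ λ t → w ≡ M.vertex (suc j) t)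
    U-cases {w} e with Fin.any? (λ t → w ≟ M.vertex zero t) | Fin.any? (λ t → w ≟ M.vertex (suc j) t)
    ... | yes h | _ = inj₁ h
    ... | no _ | yes h = inj₂ h
    left : ∀ t → U (M.vertex zero t) ≡ true
    left t rewrite hit zero t = refl
    right : ∀ t → U (M.vertex (suc j) t) ≡ true
    right t rewrite hit (suc j) t = ∨-zeroʳ (hits zero (M.vertex (suc j) t))
    min-degree : ∀ z → U z ≡ true → q ≤ count (V n) (λ w → U w ∧ a z w)
    min-degree z Uz with U-cases Uz
    ... | inj₁ (t , refl) = image-count (λ w → U w ∧ a (M.vertex zero t) w) (M.vertex (suc j)) (M.distinct (suc j))
      (λ s → true-∧ (right s) (M.adjacent (λ ()) t s))
    ... | inj₂ (t , refl) = image-count (λ w → U w ∧ a (M.vertex (suc j) t) w) (M.vertex zero) (M.distinct zero)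
      (λ s → true-∧ (left s) (M.adjacent (λ ()) t s))
    S : Fin (m * q) → Fin n
    S u = M.vertex (suc (part u)) (index u)
    S-adj : ∀ u w → part u ≢ part w → a (S u) (S w) ≡ true
    S-adj u w ne = M.adjacent (λ e → ne (Fin.suc-injective e)) (index u) (index w)
    S-inj : Injective _≡_ _≡_ S
    S-inj {u} {w} e with part u ≟ part w
    ... | no ne = ⊥-elim (absurd-bool (S-adj u w ne) (trans (cong (a (S u)) (sym e)) (a-irr (S u))))
    ... | yes s = trans (sym (Fin.combine-remQuot {m} q u)) (trans
      (cong₂ combine s (M.distinct (suc (part w)) (trans (cong (λ i → M.vertex (suc i) (index u)) (sym s)) e)))
        (Fin.combine-remQuot {m} q w))
    by-order : (∀ {C : Set} → Fin q → C) ⊎ Fin q → Embeds (KmqPlus m j F) a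
    by-order (inj₁ none) = empty-embeds none
    by-order (inj₂ t₀) with embed-forest F a a-sym U (M.vertex zero t₀) (left t₀) min-degree forest
    ... | g , g-inj , g-hom , g-in = assemble a a-sym a-irr m j F S g S-inj S-adj g-inj g-hom joined
      where
      joined : ∀ t u → part u ≢ j → a (g t) (S u) ≡ true
      joined t u ne with U-cases (g-in t)
      ... | inj₁ (s , e) rewrite e = M.adjacent (λ ()) s (index u)
      ... | inj₂ (s , e) rewrite e = M.adjacent (λ e′ → ne (sym (Fin.suc-injective e′))) s (index u)

module _ {n m : ℕ} (a : Fin n → Fin n → Bool) (a-sym : ∀ u w → a u w ≡ a w u) (p : Fin n → Fin m) (h : ℕ) where

  -- The 4 in `deficient`: an inner edge may be charged from both of its ends, so that this rate
  -- yields 2·inner ≤ missing plus an error, the ratio that `edit-bound` requires. A good vertex has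
  -- inner degree below n/h and therefore missing degree below 4n/h.
  over deficient good : Fin n → Bool
  over v = ⌊ n ≤? h * innerDegree a p v ⌋
  deficient v = ⌊ 4 * innerDegree a p v ≤? missingDegree a p v ⌋
  good v = not (over v) ∧ not (deficient v)

  goodIn : Fin m → Fin n → Bool
  goodIn l v = good v ∧ ⌊ p v ≟ l ⌋

  good-missing : ∀ {v} → good v ≡ true → h * missingDegree a p v ≤ 4 * n
  good-missing {v} g = begin
    h * missingDegree a p v ≤⟨ *-monoʳ-≤ h
      (<⇒≤ (≰⇒> (false-⌊⌋ (4 * innerDegree a p v ≤? _) (not-true (proj₂ (∧-true {not (over v)} g)))))) ⟩
    h * (4 * innerDegree a p v) ≡⟨ eq h (innerDegree a p v) ⟩
    4 * (h * innerDegree a p v) ≤⟨ *-monoʳ-≤ 4 (<⇒≤ (≰⇒> (false-⌊⌋ (n ≤? _) (not-true (proj₁ (∧-true g)))))) ⟩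
    4 * n ∎
    where
    open ≤-Reasoning
    eq : ∀ h i → h * (4 * i) ≡ 4 * (h * i)
    eq = solve-∀

  -- Inner edges at vertices that are over are few because these vertices are few; those at deficient vertices are charged to
  -- the missing edges there.
  inner-bound : ∀ T e → count (V n) over ≤ T → (∀ l → edgesIn (goodIn l) a ≤ 2 * e * count (V n) (goodIn l)) →
    2 * inner a p ≤ missing a p + 4 * (T + e) * n
  inner-bound T e few-over sparse = *-cancelˡ-≤ 2 (lin 0
      (+-mono-≤ (*-monoʳ-≤ 4 split) (+-mono-≤ (*-monoʳ-≤ 2 bad≤)
        (+-mono-≤ (*-monoʳ-≤ 4 good≤) (*-monoʳ-≤ 8 (*-monoˡ-≤ n few-over)))))
      (eq (inner a p) (missing a p) B (innerIn good a p) (count (V n) over) T e n))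
    where
    B : ℕ
    B = ∑ (V n) (λ u → b2n (not (good u)) * innerDegree a p u)
    eq : ∀ i μ B g O T e n → 2 * (2 * i) +
      (4 * (B + B + g) + (2 * (4 * (O * n) + μ) + (4 * (2 * e * n) + 8 * (T * n)))) + 0 ≡
      2 * (μ + 4 * (T + e) * n) + (4 * i + (2 * (4 * B) + (4 * g + 8 * (O * n))))
    eq = solve-∀
    side : Fin n → Fin n → ℕ
    side u w = b2n (not (good u)) * b2n (a u w ∧ ⌊ p u ≟ p w ⌋)
    ∑side : ∑₂ side ≡ B
    ∑side = ∑-cong (V n) (λ u → ∑-* (V n) (b2n (not (good u))) _)
    split : inner a p ≤ B + B + innerIn good a p
    split = ≤-trans (∑₂-mono pointwise)
      (≤-reflexive (trans (∑₂-+ (λ u w → side u w + side w u) (λ u w → b2n (((good u ∧ good w) ∧ a u w) ∧ ⌊ p u ≟ p w ⌋)))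
      (cong (_+ innerIn good a p) (trans (∑₂-+ side (λ u w → side w u))
        (cong₂ _+_ ∑side (trans (∑-swap (V n) (V n) (λ u w → side w u)) ∑side))))))
      where
      bool : ∀ g g′ e s → b2n (e ∧ s) ≤ b2n (not g) * b2n (e ∧ s) + b2n (not g′) * b2n (e ∧ s) + b2n (((g ∧ g′) ∧ e) ∧ s)
      bool false g′ e s = ≤-trans (≤-trans (≤-reflexive (sym (*-identityˡ _))) (m≤m+n _ _)) (m≤m+n _ _)
      bool true false e s = ≤-trans (≤-reflexive (sym (*-identityˡ _))) (m≤m+n _ _)
      bool true true e s = ≤-refl
      pointwise : ∀ u w → b2n (a u w ∧ ⌊ p u ≟ p w ⌋) ≤ side u w + side w u + b2n
        (((good u ∧ good w) ∧ a u w) ∧ ⌊ p u ≟ p w ⌋)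
      pointwise u w rewrite a-sym w u | ⌊⌋-cong (p w ≟ p u) (p u ≟ p w) sym sym = bool (good u) (good w)
        (a u w) ⌊ p u ≟ p w ⌋
    bad≤ : 4 * B ≤ 4 * (count (V n) over * n) + missing a p
    bad≤ = begin
      4 * B ≡⟨ sym (∑-* (V n) 4 _) ⟩
      ∑ (V n) (λ u → 4 * (b2n (not (good u)) * innerDegree a p u)) ≤⟨ ∑-mono (V n) pointwise ⟩
      ∑ (V n) (λ u → 4 * (b2n (over u) * n) + missingDegree a p u) ≡⟨ ∑-+ (V n) _ _ ⟩
      ∑ (V n) (λ u → 4 * (b2n (over u) * n)) + missing a p ≡⟨ cong (_+ missing a p)
        (trans (∑-* (V n) 4 _) (cong (4 *_) (∑-*ʳ (V n) n _))) ⟩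
      4 * (count (V n) over * n) + missing a p ∎
      where
      open ≤-Reasoning
      pointwise : ∀ u → 4 * (b2n (not (good u)) * innerDegree a p u) ≤ 4 * (b2n (over u) * n) + missingDegree a p u
      pointwise u with n ≤? h * innerDegree a p u | 4 * innerDegree a p u ≤? missingDegree a p u
      ... | yes _ | _ = ≤-trans (*-monoʳ-≤ 4 (*-monoʳ-≤ 1 (count≤n (λ w → a u w ∧ ⌊ p u ≟ p w ⌋)))) (m≤m+n _ _)
      ... | no _ | yes le = ≤-trans (*-monoʳ-≤ 4 (≤-reflexive (*-identityˡ (innerDegree a p u)))) le
      ... | no _ | no _ = z≤n
    good≤ : innerIn good a p ≤ 2 * e * n
    good≤ = begin
      innerIn good a p ≡⟨ ∑₂-cong by-part ⟩
      ∑₂ (λ u w → ∑ (V m) (λ l → b2n ((goodIn l u ∧ goodIn l w) ∧ a u w))) ≡⟨ ∑-cong (V n) (λ u → ∑-swap (V n) (V m) _) ⟩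
      ∑ (V n) (λ u → ∑ (V m) (λ l → ∑ (V n) (λ w → b2n ((goodIn l u ∧ goodIn l w) ∧ a u w)))) ≡⟨ ∑-swap (V n) (V m) _ ⟩
      ∑ (V m) (λ l → edgesIn (goodIn l) a) ≤⟨ ∑-mono (V m)
        (λ l → ≤-trans (sparse l) (*-monoʳ-≤ (2 * e) (∑-mono (V n) (λ v → bool (good v) ⌊ p v ≟ l ⌋)))) ⟩
      ∑ (V m) (λ l → 2 * e * part-size p l) ≡⟨ trans (∑-* (V m) (2 * e) _) (cong (2 * e *_) (∑-part-size p)) ⟩
      2 * e * n ∎
      where
      open ≤-Reasoning
      bool : ∀ x y → b2n (x ∧ y) ≤ b2n y
      bool true  y = ≤-refl
      bool false y = z≤n
      bool′ : ∀ g g′ e s t → b2n (((g ∧ s) ∧ (g′ ∧ t)) ∧ e) ≡ b2n s * b2n t * b2n ((g ∧ g′) ∧ e)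
      bool′ false g′ e s t = sym (*-zeroʳ (b2n s * b2n t))
      bool′ true false e s t rewrite ∧-zeroʳ s = sym (*-zeroʳ (b2n s * b2n t))
      bool′ true true e false t = refl
      bool′ true true e true false = refl
      bool′ true true e true true = sym (*-identityˡ _)
      by-part : ∀ u w → b2n (((good u ∧ good w) ∧ a u w) ∧ ⌊ p u ≟ p w ⌋) ≡ ∑ (V m)
        (λ l → b2n ((goodIn l u ∧ goodIn l w) ∧ a u w))
      by-part u w = trans (b2n-∧ ((good u ∧ good w) ∧ a u w) ⌊ p u ≟ p w ⌋)
        (trans (*-comm _ (b2n ⌊ p u ≟ p w ⌋)) (trans (cong (_* b2n ((good u ∧ good w) ∧ a u w)) (b2n-same p u w))
        (trans (sym (∑-*ʳ (V m) _ _)) (∑-cong (V m) (λ l → sym (bool′ (good u) (good w) (a u w) ⌊ p u ≟ l ⌋ ⌊ p w ≟ l ⌋))))))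

  over-degree : LocalMaxCut a p → ∀ {v} → over v ≡ true → ∀ l → n ≤ h * neighboursIn a p v l
  over-degree local {v} o l = ≤-trans (true-⌊⌋ (n ≤? h * innerDegree a p v) o) (*-monoʳ-≤ h (local v l))

-- Common neighbourhoods in all parts

chain-size : ℕ → ℕ → ℕ → ℕ
chain-size zero    h q = q
chain-size (suc k) h q = dense-size h (chain-size k h q)

chain-factor : ℕ → ℕ → ℕ → ℕ
chain-factor zero    h q = 0
chain-factor (suc k) h q = dense-factor h (chain-size k h q) + chain-factor k h q

-- `common-dense` is applied to one part after the other, each time shrinking the set of vertices; a
-- smaller set has larger common neighbourhoods, so earlier parts are not spoilt. `chain-size` is
-- computed backwards so that q vertices are left at the end, and `chain-factor` adds the factors of
-- all rounds in order to bound each of them.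
common-neighbours : ∀ {n m} (a : Fin n → Fin n → Bool) (p : Fin n → Fin m) h q → 1 ≤ n → (ls : List (Fin m))
  (os : List (Fin n)) → Unique os →
  chain-size (length ls) h q ≤ length os → (∀ x → x ∈ os → ∀ l → l ∈ ls → n ≤ h * neighboursIn a p x l) →
  Σ (List (Fin n)) λ s → Unique s × length s ≡ q ×
    (∀ l → l ∈ ls → n ≤ chain-factor (length ls) h q * count (V n) (λ w → all (λ x → a x w ∧ ⌊ p w ≟ l ⌋) s)) ×
      (∀ x → x ∈ s → x ∈ os)
common-neighbours a p h q n≥1 [] os uos size rich = take q os , Unique.take⁺ q uos ,
  trans (Data.List.Properties.length-take q os) (m≤n⇒m⊓n≡m size) , (λ _ ()) , λ x m → take-⊆ q os m
common-neighbours {n} {m} a p h q n≥1 (l ∷ ls) os uos size rich = combined step₁ (λ (s₁ , us₁ , len₁ , sub₁ , _) →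
    common-neighbours a p h q n≥1 ls s₁ us₁ (≤-reflexive (sym len₁)) (λ x k l′ k′ → rich x (sub₁ x k) l′ (there k′)))
  where
  D E : ℕ
  D = dense-factor h (chain-size (length ls) h q)
  E = chain-factor (length ls) h q
  joint : List (Fin n) → Fin m → ℕ
  joint s l = count (V n) (λ w → all (λ x → a x w ∧ ⌊ p w ≟ l ⌋) s)
  Step₁ : Set
  Step₁ = Σ (List (Fin n)) λ s₁ → Unique s₁ × length s₁ ≡ chain-size (length ls) h q × (∀ x → x ∈ s₁ → x ∈ os) ×
    length (V n) ≤ D * joint s₁ l
  step₁ : Step₁
  step₁ = common-dense h (chain-size (length ls) h q) os (V n) (λ x w → a x w ∧ ⌊ p w ≟ l ⌋) uos size
    (≤-trans n≥1 (≤-reflexive (sym (length-V n)))) (λ x k → ≤-trans (≤-reflexive (length-V n)) (rich x k l (here refl)))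
  mono : ∀ s s₁ → (∀ x → x ∈ s → x ∈ s₁) → ∀ w → b2n (all (λ x → a x w ∧ ⌊ p w ≟ l ⌋) s₁) ≤ b2n
    (all (λ x → a x w ∧ ⌊ p w ≟ l ⌋) s)
  mono s s₁ sub w with all (λ x → a x w ∧ ⌊ p w ≟ l ⌋) s₁ in eq
  ... | false = z≤n
  ... | true = ≤-reflexive (sym (cong b2n (∈-all _ s (λ x m → all-∈ _ eq (sub x m)))))
  combined : (r : Step₁) → ((r : Step₁) → Σ (List (Fin n)) λ s → Unique s × length s ≡ q ×
      (∀ l → l ∈ ls → n ≤ E * joint s l) × (∀ x → x ∈ s → x ∈ proj₁ r)) →
    Σ (List (Fin n)) λ s → Unique s × length s ≡ q × (∀ l′ → l′ ∈ l ∷ ls → n ≤ (D + E) * joint s l′) × (∀ x → x ∈ s → x ∈ os)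
  combined r@(s₁ , us₁ , len₁ , sub₁ , dense) rest = s , us , len , both , λ x k → sub₁ x (sub x k)
    where
    s : List (Fin n)
    s = proj₁ (rest r)
    us : Unique s
    us = proj₁ (proj₂ (rest r))
    len : length s ≡ q
    len = proj₁ (proj₂ (proj₂ (rest r)))
    sub : ∀ x → x ∈ s → x ∈ s₁
    sub = proj₂ (proj₂ (proj₂ (proj₂ (rest r))))
    both : ∀ l′ → l′ ∈ l ∷ ls → n ≤ (D + E) * joint s l′
    both _ (here refl) = ≤-trans (≤-reflexive (sym (length-V n)))
      (≤-trans dense (*-mono-≤ (m≤m+n D E) (∑-mono (V n) (mono s s₁ sub))))
    both l′ (there k) = ≤-trans (proj₁ (proj₂ (proj₂ (proj₂ (rest r)))) l′ k) (*-monoˡ-≤ _ (m≤n+m E D))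

-- Write H for `host-density m k`. Of a part of more than n/(2m) vertices, k vertices of missing
-- degree at most 4n/H exclude at most k + 4kn/H ≤ (4k + 1)n/H. As H exceeds 2m(4k + 1) by one,
-- n/(2mH) vertices remain.
host-density host-factor : ℕ → ℕ → ℕ
host-density m k = suc (2 * m * (4 * k + 1))
host-factor m k = 2 * (m * host-density m k)

module _ {n m : ℕ} (a : Fin n → Fin n → Bool) (p : Fin n → Fin m) where

  hosts : ∀ k → (Fin k → Fin n) → Fin m → Fin n → Bool
  hosts k u l w = ⌊ p w ≟ l ⌋ ∧ all (λ t → compatible a p (u t) w) (V k)

  hosts-large : ∀ k (u : Fin k → Fin n) → (∀ t → host-density m k * missingDegree a p (u t) ≤ 4 * n) →
    host-density m k * k ≤ n →
    (∀ l → n < 2 * (m * part-size p l)) → ∀ l → n ≤ host-factor m k * count (V n) (hosts k u l)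
  hosts-large k u typical n-large large l = lin 0
    (+-mono-≤ (*-monoʳ-≤ H (<⇒≤ (large l))) (+-mono-≤ (*-monoʳ-≤ (2 * m * H) (avoid a p (λ w → ⌊ p w ≟ l ⌋) k u))
      (+-mono-≤ (*-monoʳ-≤ (2 * m) n-large) (*-monoʳ-≤ (2 * m) M≤))))
    (eq m k n (part-size p l) (count (V n) (hosts k u l)) M)
    where
    H M : ℕ
    H = host-density m k
    M = ∑ (V k) (λ t → missingDegree a p (u t))
    M≤ : H * M ≤ k * (4 * n)
    M≤ = ≤-trans (≤-reflexive (sym (∑-* (V k) H _))) (≤-trans (∑-mono (V k) typical) (≤-reflexive (∑V-const k (4 * n))))
    eq : ∀ m k n P G M → let H = 1 + 2 * m * (4 * k + 1) in
      n + (H * (2 * (m * P)) + (2 * m * H * (G + (k + M)) + (2 * m * n + 2 * m * (k * (4 * n))))) + 0 ≡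
      2 * (m * H) * G + (H * n + (2 * m * H * P + (2 * m * (H * k) + 2 * m * (H * M))))
    eq = solve-∀

record SingleEdge (F : Graph) : Set where
  field
    s₀ t₀  : Fin (order F)
    edge   : adj F s₀ t₀ ≡ true
    only   : ∀ s t → adj F s t ≡ true → (s ≡ s₀ × t ≡ t₀) ⊎ (s ≡ t₀ × t ≡ s₀)

  s₀≢t₀ : s₀ ≢ t₀
  s₀≢t₀ e = absurd-bool (trans (cong (adj F s₀) e) edge) (irrefl F s₀)

pair-δ : ∀ {n} (x y : Fin n) → ∑₂ (λ u w → b2n ⌊ (u ≟ x) ×-dec (w ≟ y) ⌋) ≡ 1
pair-δ {n} x y = trans (∑₂-cong (λ u w → split (u ≟ x) (w ≟ y)))
  (trans (∑-cong (V n) (λ u → trans (∑-* (V n) (b2n ⌊ u ≟ x ⌋) _)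
    (trans (cong (b2n ⌊ u ≟ x ⌋ *_) (∑-δ-count y)) (*-identityʳ _)))) (∑-δ-count x))
  where
  split : ∀ {P Q : Set} (d : Dec P) (e : Dec Q) → b2n ⌊ d ×-dec e ⌋ ≡ b2n ⌊ d ⌋ * b2n ⌊ e ⌋
  split (yes _) (yes _) = refl
  split (yes _) (no _)  = refl
  split (no _)  _       = refl

only-edge : ∀ F → pairs (adj F) ≡ 2 → ∀ s₀ t₀ → adj F s₀ t₀ ≡ true → ∀ s t → adj F s t ≡ true →
  (s ≡ s₀ × t ≡ t₀) ⊎ (s ≡ t₀ × t ≡ s₀)
only-edge F two s₀ t₀ edge s t ad with (s ≟ s₀) ×-dec (t ≟ t₀) | (s ≟ t₀) ×-dec (t ≟ s₀)
... | yes e | _ = inj₁ e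
... | no _ | yes e = inj₂ e
... | no ne | no ne′ = ⊥-elim (1+n≰n (≤-trans (≤-reflexive (sym three)) (≤-trans (∑₂-mono pointwise) (≤-reflexive two))))
  where
  s₀≢t₀ : s₀ ≢ t₀
  s₀≢t₀ e = absurd-bool (trans (cong (adj F s₀) e) edge) (irrefl F s₀)
  δ : Fin (order F) → Fin (order F) → Fin (order F) → Fin (order F) → ℕ
  δ x y u w = b2n ⌊ (u ≟ x) ×-dec (w ≟ y) ⌋
  three : ∑₂ (λ u w → δ s₀ t₀ u w + (δ t₀ s₀ u w + δ s t u w)) ≡ 3
  three = trans (∑₂-+ (δ s₀ t₀) (λ u w → δ t₀ s₀ u w + δ s t u w)) (cong₂ _+_ (pair-δ s₀ t₀)
    (trans (∑₂-+ (δ t₀ s₀) (δ s t)) (cong₂ _+_ (pair-δ t₀ s₀) (pair-δ s t))))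
  pointwise : ∀ u w → δ s₀ t₀ u w + (δ t₀ s₀ u w + δ s t u w) ≤ b2n (adj F u w)
  pointwise u w with (u ≟ s₀) ×-dec (w ≟ t₀) | (u ≟ t₀) ×-dec (w ≟ s₀) | (u ≟ s) ×-dec (w ≟ t)
  ... | yes (refl , _) | yes (e , _) | _ = ⊥-elim (s₀≢t₀ e)
  ... | yes (refl , refl) | no _ | yes (refl , refl) = ⊥-elim (ne (refl , refl))
  ... | yes (refl , refl) | no _ | no _ = ≤-reflexive (sym (cong b2n edge))
  ... | no _ | yes (refl , refl) | yes (refl , refl) = ⊥-elim (ne′ (refl , refl))
  ... | no _ | yes (refl , refl) | no _ = ≤-reflexive (sym (cong b2n (trans (adjSym F _ _) edge)))
  ... | no _ | no _ | yes (refl , refl) = ≤-reflexive (sym (cong b2n ad))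
  ... | no _ | no _ | no _ = z≤n

single-edge : ∀ F → edges F ≡ 1 → SingleEdge F
single-edge F one = record { s₀ = proj₁ row ; t₀ = proj₁ entry ; edge = proj₂ (proj₂ entry) ;
    only = only-edge F two (proj₁ row) (proj₁ entry) (proj₂ (proj₂ entry)) }
  where
  q : ℕ
  q = order F
  two : pairs (adj F) ≡ 2
  two = trans (handshake q (adj F) (adjSym F) (irrefl F)) (cong (2 *_) one)
  row : ∃ λ s → s ∈ V q × 0 < ∑ (V q) (λ t → b2n (adj F s t))
  row = ∑-exists (V q) {λ s → ∑ (V q) (λ t → b2n (adj F s t))} {λ _ → 0}
    (≤-trans (s≤s (≤-reflexive (∑-zero (V q) (λ _ → refl)))) (≤-trans (s≤s z≤n) (≤-reflexive (sym two))))
  entry : ∃ λ t → t ∈ V q × adj F (proj₁ row) t ≡ true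
  entry = count-exists (V q) (adj F (proj₁ row)) (proj₂ (proj₂ row))

single-edge-forest : ∀ {F} → SingleEdge F → Forest F
single-edge-forest {F} E (r , c , c-inj , path , _) = cases (only _ _ (path zero)) (only _ _ (path (suc zero)))
  where
  open SingleEdge E
  c₀ c₁ c₂ : Fin (order F)
  c₀ = c zero
  c₁ = c (suc zero)
  c₂ = c (suc (suc zero))
  different : ∀ {i j} → i ≢ j → c i ≡ c j → ⊥
  different ne e = ne (c-inj e)
  cases : (c₀ ≡ s₀ × c₁ ≡ t₀) ⊎ (c₀ ≡ t₀ × c₁ ≡ s₀) → (c₁ ≡ s₀ × c₂ ≡ t₀) ⊎ (c₁ ≡ t₀ × c₂ ≡ s₀) → ⊥
  cases (inj₁ (e , _)) (inj₁ (f , _)) = different {zero} {suc zero} (λ ()) (trans e (sym f))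
  cases (inj₁ (e , _)) (inj₂ (_ , f)) = different {zero} {suc (suc zero)} (λ ()) (trans e (sym f))
  cases (inj₂ (e , _)) (inj₁ (_ , f)) = different {zero} {suc (suc zero)} (λ ()) (trans e (sym f))
  cases (inj₂ (e , _)) (inj₂ (f , _)) = different {zero} {suc zero} (λ ()) (trans e (sym f))

-- Forbidden configurations at inner edges

module _ {n : ℕ} (a : Fin n → Fin n → Bool) (a-sym : ∀ u w → a u w ≡ a w u) (a-irr : ∀ u → a u u ≡ false)
  (m : ℕ) (j : Fin m) (F : Graph) (p : Fin n → Fin m) where

  private
    q : ℕ
    q = order F
    part : Fin (m * q) → Fin m
    part u = proj₁ (remQuot {m} q u)
    part-combine : ∀ l t → part (combine l t) ≡ l
    part-combine l t = cong proj₁ (Fin.remQuot-combine {m} l t)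
    -- The inner edges are found in an arbitrary part `l`, while the model has them in part `j`;
    -- exchanging the two labels reconciles them.
    swap : Fin m → Fin (m * q) → Fin m
    swap l u = transpose j l (part u)
    transpose-injective : ∀ l {x y} → transpose j l x ≡ transpose j l y → x ≡ y
    transpose-injective l {x} {y} e = trans (sym (transpose-inverse l j))
      (trans (cong (transpose l j) e) (transpose-inverse l j))
    transpose-at : ∀ l → transpose j l j ≡ l
    transpose-at l with j ≟ j
    ... | yes _ = refl
    ... | no ne = ⊥-elim (ne refl)
    U-part : ∀ {k} (u : Fin k → Fin n) l w → hosts a p k u l w ≡ true → p w ≡ l
    U-part u l w e = true-⌊⌋ (p w ≟ l) (proj₁ (∧-true e))
    host-apart : ∀ {k} (u : Fin k → Fin n) l {w} → hosts a p k u l w ≡ true → ∀ t → w ≢ u t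
    host-apart {k} u l {w} e t = compatible-≢ a p
      (all-∈ (λ t → compatible a p (u t) w) (proj₂ (∧-true {⌊ p w ≟ l ⌋} e)) (∈V t))
    host-adj : ∀ {k} (u : Fin k → Fin n) l l′ {w} → hosts a p k u l w ≡ true → ∀ t → p (u t) ≡ l′ → l ≢ l′ → a (u t) w ≡ true
    host-adj {k} u l l′ {w} e t pt ne = compatible-adj a p
      (all-∈ (λ t → compatible a p (u t) w) (proj₂ (∧-true {⌊ p w ≟ l ⌋} e)) (∈V t))
      (λ e′ → ne (trans (sym (U-part u l w e)) (trans (sym e′) pt)))

  -- The forest is embedded first, in the core. Its q vertices miss few edges, so every part retains
  -- many hosts, and the remaining parts are chosen among these.
  forest-in-part : Forest F → ∀ l (W : Fin n → Bool) → (∀ v → W v ≡ true → p v ≡ l) →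
    (∀ v → W v ≡ true → host-density m q * missingDegree a p v ≤ 4 * n) → host-density m q * q ≤ n →
      (∀ l → n < 2 * (m * part-size p l)) →
    aligned-factor (host-factor m q) (m * q) * missing a p ≤ n * n → aligned-size (host-factor m q) (m * q) ≤ n →
    DenseCore a a-sym a-irr q W → Embeds (KmqPlus m j F) a
  forest-in-part forest l W W-part W-typical n-large large few n-large′ (U , U⊆W , (z , Uz) , deg) =
    assemble a a-sym a-irr m j F A.vertex g A.distinct S-adj g-inj g-hom joined
    where
    embedded : Σ (Fin q → Fin n) λ g → Injective _≡_ _≡_ g × (∀ s t → adj F s t ≡ true → a (g s) (g t) ≡ true) ×
      (∀ t → U (g t) ≡ true)
    embedded = embed-forest F a a-sym U z Uz deg forest
    g : Fin q → Fin n
    g = proj₁ embedded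
    g-inj : Injective _≡_ _≡_ g
    g-inj = proj₁ (proj₂ embedded)
    g-hom : ∀ s t → adj F s t ≡ true → a (g s) (g t) ≡ true
    g-hom = proj₁ (proj₂ (proj₂ embedded))
    g-in : ∀ t → W (g t) ≡ true
    g-in t = U⊆W (g t) (proj₂ (proj₂ (proj₂ embedded)) t)
    module A = Aligned (aligned a p a-sym (host-factor m q) (m * q) (hosts a p q g) (U-part g)
      (hosts-large a p q g (λ t → W-typical (g t) (g-in t)) n-large large) few n-large′ (swap l))
    S-adj : ∀ u w → part u ≢ part w → a (A.vertex u) (A.vertex w) ≡ true
    S-adj u w ne = A.adjacent u w (λ e → ne (transpose-injective l e))
    joined : ∀ t u → part u ≢ j → a (g t) (A.vertex u) ≡ true
    joined t u ne = host-adj g (swap l u) l (A.inside u) t (W-part (g t) (g-in t))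
      (λ e → ne (transpose-injective l (trans e (sym (transpose-at l)))))

  module _ (E : SingleEdge F) where
    open SingleEdge E

    -- Only the two ends of the edge are prescribed. The isolated vertices of `F` come from the
    -- aligned copy in part `l`, whose vertices differ from the ends because hosts are compatible
    -- with them.
    edge-in-part : ∀ l (W : Fin n → Bool) → (∀ v → W v ≡ true → p v ≡ l) →
      (∀ v → W v ≡ true → host-density m 2 * missingDegree a p v ≤ 4 * n) → host-density m 2 * 2 ≤ n →
        (∀ l → n < 2 * (m * part-size p l)) →
      aligned-factor (host-factor m 2) (m * q) * missing a p ≤ n * n → aligned-size (host-factor m 2) (m * q) ≤ n →
      ∀ x y → W x ≡ true → W y ≡ true → a x y ≡ true → Embeds (KmqPlus m j F) a
    edge-in-part l W W-part W-typical n-large large few n-large′ x y Wx Wy xy =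
      assemble a a-sym a-irr m j F A.vertex g A.distinct S-adj g-inj g-hom joined
      where
      x≢y : x ≢ y
      x≢y e = absurd-bool (trans (cong (a x) e) xy) (a-irr x)
      ends : Fin 2 → Fin n
      ends zero       = x
      ends (suc zero) = y
      ends-in : ∀ t → W (ends t) ≡ true
      ends-in zero       = Wx
      ends-in (suc zero) = Wy
      module A = Aligned (aligned a p a-sym (host-factor m 2) (m * q) (hosts a p 2 ends) (U-part ends)
        (hosts-large a p 2 ends (λ t → W-typical (ends t) (ends-in t)) n-large large) few n-large′ (swap l))
      S-adj : ∀ u w → part u ≢ part w → a (A.vertex u) (A.vertex w) ≡ true
      S-adj u w ne = A.adjacent u w (λ e → ne (transpose-injective l e))
      joined-end : ∀ i u → part u ≢ j → a (ends i) (A.vertex u) ≡ true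
      joined-end i u ne = host-adj ends (swap l u) l (A.inside u) i (W-part (ends i) (ends-in i))
        (λ e → ne (transpose-injective l (trans e (sym (transpose-at l)))))
      apart : ∀ i u → A.vertex u ≢ ends i
      apart i u = host-apart ends (swap l u) (A.inside u) i
      place : ∀ t → Dec (t ≡ s₀) → Dec (t ≡ t₀) → Fin n
      place t (yes _) _       = x
      place t (no _)  (yes _) = y
      place t (no _)  (no _)  = A.vertex (combine j t)
      g : Fin q → Fin n
      g t = place t (t ≟ s₀) (t ≟ t₀)
      g-s₀ : g s₀ ≡ x
      g-s₀ with s₀ ≟ s₀
      ... | yes _ = refl
      ... | no ne = ⊥-elim (ne refl)
      g-t₀ : g t₀ ≡ y
      g-t₀ with t₀ ≟ s₀ | t₀ ≟ t₀
      ... | yes e | _ = ⊥-elim (s₀≢t₀ (sym e))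
      ... | no _ | yes _ = refl
      ... | no _ | no ne = ⊥-elim (ne refl)
      place-inj : ∀ s t d e d′ e′ → place s d e ≡ place t d′ e′ → s ≡ t
      place-inj s t (yes d) e (yes d′) e′ eq = trans d (sym d′)
      place-inj s t (yes d) e (no d′) (yes e′) eq = ⊥-elim (x≢y eq)
      place-inj s t (yes d) e (no d′) (no e′) eq = ⊥-elim (apart zero _ (sym eq))
      place-inj s t (no d) (yes e) (yes d′) e′ eq = ⊥-elim (x≢y (sym eq))
      place-inj s t (no d) (yes e) (no d′) (yes e′) eq = trans e (sym e′)
      place-inj s t (no d) (yes e) (no d′) (no e′) eq = ⊥-elim (apart (suc zero) _ (sym eq))
      place-inj s t (no d) (no e) (yes d′) e′ eq = ⊥-elim (apart zero _ eq)
      place-inj s t (no d) (no e) (no d′) (yes e′) eq = ⊥-elim (apart (suc zero) _ eq)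
      place-inj s t (no d) (no e) (no d′) (no e′) eq = Fin.combine-injectiveʳ j s j t (A.distinct eq)
      g-inj : Injective _≡_ _≡_ g
      g-inj {s} {t} = place-inj s t (s ≟ s₀) (s ≟ t₀) (t ≟ s₀) (t ≟ t₀)
      g-hom : ∀ s t → adj F s t ≡ true → a (g s) (g t) ≡ true
      g-hom s t ad with only s t ad
      ... | inj₁ (refl , refl) = trans (cong₂ a g-s₀ g-t₀) xy
      ... | inj₂ (refl , refl) = trans (cong₂ a g-t₀ g-s₀) (trans (a-sym y x) xy)
      place-joined : ∀ t d e u → part u ≢ j → a (place t d e) (A.vertex u) ≡ true
      place-joined t (yes d) e u ne = joined-end zero u ne
      place-joined t (no d) (yes e) u ne = joined-end (suc zero) u ne
      place-joined t (no d) (no e) u ne = S-adj (combine j t) u (λ e → ne (trans (sym e) (part-combine j t)))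
      joined : ∀ t u → part u ≢ j → a (g t) (A.vertex u) ≡ true
      joined t = place-joined t (t ≟ s₀) (t ≟ t₀)

    -- A copy of K_m^q is found inside the neighbourhood of `v`. Putting `v` in the place of `s₀`
    -- creates the extra edge, since `v` is adjacent to the image of `t₀` as well.
    spread-vertex : ∀ h v → (∀ l → n ≤ h * neighboursIn a p v l) → aligned-factor h (m * q) * missing a p ≤ n * n →
      aligned-size h (m * q) ≤ n → Embeds (KmqPlus m j F) a
    spread-vertex h v rich few n-large = assemble a a-sym a-irr m j F A.vertex g A.distinct A.adjacent g-inj g-hom joined
      where
      module A = Aligned (aligned a p a-sym h (m * q) (λ l w → a v w ∧ ⌊ p w ≟ l ⌋)
        (λ l w e → true-⌊⌋ (p w ≟ l) (proj₂ (∧-true {a v w} e))) rich few n-large part)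
      v-adj : ∀ u → a v (A.vertex u) ≡ true
      v-adj u = proj₁ (∧-true (A.inside u))
      v-apart : ∀ u → v ≢ A.vertex u
      v-apart u e = absurd-bool (v-adj u) (trans (cong (a v) (sym e)) (a-irr v))
      place : ∀ t → Dec (t ≡ s₀) → Fin n
      place t (yes _) = v
      place t (no _)  = A.vertex (combine j t)
      g : Fin q → Fin n
      g t = place t (t ≟ s₀)
      place-inj : ∀ s t d e → place s d ≡ place t e → s ≡ t
      place-inj s t (yes d) (yes e) eq = trans d (sym e)
      place-inj s t (yes d) (no e)  eq = ⊥-elim (v-apart _ eq)
      place-inj s t (no d)  (yes e) eq = ⊥-elim (v-apart _ (sym eq))
      place-inj s t (no d)  (no e)  eq = Fin.combine-injectiveʳ j s j t (A.distinct eq)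
      g-inj : Injective _≡_ _≡_ g
      g-inj {s} {t} = place-inj s t (s ≟ s₀) (t ≟ s₀)
      edge-image : a (g s₀) (g t₀) ≡ true
      edge-image with s₀ ≟ s₀ | t₀ ≟ s₀
      ... | no ne | _ = ⊥-elim (ne refl)
      ... | yes _ | yes e = ⊥-elim (s₀≢t₀ (sym e))
      ... | yes _ | no _ = v-adj _
      g-hom : ∀ s t → adj F s t ≡ true → a (g s) (g t) ≡ true
      g-hom s t ad with only s t ad
      ... | inj₁ (refl , refl) = edge-image
      ... | inj₂ (refl , refl) = trans (a-sym _ _) edge-image
      place-joined : ∀ t d u → part u ≢ j → a (place t d) (A.vertex u) ≡ true
      place-joined t (yes d) u ne = v-adj u
      place-joined t (no d)  u ne = A.adjacent (combine j t) u (λ e → ne (trans (sym e) (part-combine j t)))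
      joined : ∀ t u → part u ≢ j → a (g t) (A.vertex u) ≡ true
      joined t = place-joined t (t ≟ s₀)

  -- The q vertices of `s` form an additional part to the copy of K_m^q in their common
  -- neighbourhoods, which gives a K_{m+1}^q.
  spread-vertices : Forest F → ∀ h (s : List (Fin n)) → Unique s → length s ≡ q →
    (∀ l → n ≤ h * count (V n) (λ w → all (λ x → a x w ∧ ⌊ p w ≟ l ⌋) s)) →
    aligned-factor h (m * q) * missing a p ≤ n * n → aligned-size h (m * q) ≤ n → Embeds (KmqPlus m j F) a
  spread-vertices forest h s us len rich few n-large = by-order (empty-or-inhabited q)
    where
    f : Fin q → Fin n
    f = proj₁ (enumerate s us len)
    f-inj : Injective _≡_ _≡_ f
    f-inj = proj₁ (proj₂ (enumerate s us len))
    f∈ : ∀ t → f t ∈ s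
    f∈ = proj₂ (proj₂ (enumerate s us len))
    U : Fin m → Fin n → Bool
    U l w = all (λ x → a x w ∧ ⌊ p w ≟ l ⌋) s
    at : ∀ l w → U l w ≡ true → ∀ t → (a (f t) w ∧ ⌊ p w ≟ l ⌋) ≡ true
    at l w e t = all-∈ (λ x → a x w ∧ ⌊ p w ≟ l ⌋) e (f∈ t)
    by-order : (∀ {C : Set} → Fin q → C) ⊎ Fin q → Embeds (KmqPlus m j F) a
    by-order (inj₁ none) = empty-embeds a a-sym a-irr m j F none
    by-order (inj₂ t₁) = multipartite-embeds a a-sym a-irr m j F {λ _ → true} forest (record
        { vertex = vertex ; inside = λ _ _ → refl ; distinct = distinct ; adjacent = adjacent })
      where
      module A = Aligned (aligned a p a-sym h (m * q) U
        (λ l w e → true-⌊⌋ (p w ≟ l) (proj₂ (∧-true {a (f t₁) w} (at l w e t₁)))) rich few n-large part)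
      vertex : Fin (suc m) → Fin q → Fin n
      vertex zero    = f
      vertex (suc l) t = A.vertex (combine l t)
      distinct : ∀ i → Injective _≡_ _≡_ (vertex i)
      distinct zero = f-inj
      distinct (suc l) e = Fin.combine-injectiveʳ l _ l _ (A.distinct e)
      joined : ∀ l t t′ → a (f t) (vertex (suc l) t′) ≡ true
      joined l t t′ = proj₁ (∧-true (at _ _ (A.inside (combine l t′)) t))
      adjacent : ∀ {i i′} → i ≢ i′ → ∀ t t′ → a (vertex i t) (vertex i′ t′) ≡ true
      adjacent {zero}  {zero}   ne t t′ = ⊥-elim (ne refl)
      adjacent {zero}  {suc l′} ne t t′ = joined l′ t t′
      adjacent {suc l} {zero}   ne t t′ = trans (a-sym _ _) (joined l t′ t)
      adjacent {suc l} {suc l′} ne t t′ = A.adjacent _ _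
        (λ e → ne (cong suc (trans (sym (part-combine l t)) (trans e (part-combine l′ t′)))))

-- The stability estimate

dense-cliques : ∀ q r h {n} (a : Fin n → Fin n → Bool) → (∀ u w → a u w ≡ a w u) →
  kst-size q r h ≤ n → n ^ r ≤ h * cliques a r (λ _ → true) → Multipartite a (λ _ → true) r q
dense-cliques zero    r h a a-sym size dense = empty-parts r
dense-cliques (suc q) r h a a-sym size dense = many-cliques q r h a a-sym (λ _ → true) size dense

inner+missing≤ : ∀ {n m} (a : Fin n → Fin n → Bool) (p : Fin n → Fin m) → inner a p + missing a p ≤ n * n
inner+missing≤ a p = ≤-trans (≤-reflexive (sym (edit-split p a))) (pairs≤ (λ u w → a u w xor blowAdj p u w))

sum-bounds : ∀ n₁ n₂ n₃ n₄ n₅ {n} → n₁ + (n₂ + (n₃ + (n₄ + n₅))) ≤ n → (n₁ ≤ n × n₂ ≤ n) × (n₃ ≤ n × n₄ ≤ n × n₅ ≤ n)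
sum-bounds n₁ n₂ n₃ n₄ n₅ le = (m+n≤o⇒m≤o n₁ le , m+n≤o⇒m≤o n₂ r₂) , (m+n≤o⇒m≤o n₃ r₃ , m+n≤o⇒m≤o n₄ r₄ , m+n≤o⇒n≤o n₄ r₄)
  where
  r₂ = m+n≤o⇒n≤o n₁ le
  r₃ = m+n≤o⇒n≤o n₂ r₂
  r₄ = m+n≤o⇒n≤o n₃ r₃

weaken : ∀ {n} c c′ {μ} → (c + c′) * μ ≤ n → c * μ ≤ n
weaken c c′ {μ} le = ≤-trans (*-monoˡ-≤ μ (m≤m+n c c′)) le

weaken′ : ∀ {n} c c′ {μ} → (c + c′) * μ ≤ n → c′ * μ ≤ n
weaken′ c c′ {μ} le = ≤-trans (*-monoˡ-≤ μ (m≤n+m c′ c)) le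

module _ (m′ : ℕ) (j : Fin (suc m′)) (F : Graph) (forest : Forest F) where

  private
    m q : ℕ
    m = suc m′
    q = order F

  clique-factor clique-size : ℕ → ℕ
  clique-factor c = stab-factor m′ (setup-factor m′ c)
  clique-size c = kst-size q (2 + m′) (clique-factor c)

  module _ {n : ℕ} (a : Fin n → Fin n → Bool) (a-sym : ∀ u w → a u w ≡ a w u) (a-irr : ∀ u → a u u ≡ false)
    (avoids : ¬ Embeds (KmqPlus m j F) a) (x : ℕ) (cross≤ : ∀ (p : Fin n → Fin m) → cross p ≤ x) where

    few-large-cliques : ∀ c → clique-size c ≤ n → clique-factor c * cliques a (2 + m′) (λ _ → true) ≤ n ^ (2 + m′)
    few-large-cliques c size = ≰⇒≥
      (λ dense → avoids (multipartite-embeds a a-sym a-irr m j F forest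
      (dense-cliques q (2 + m′) (clique-factor c) a a-sym size dense)))

    Controlled : ∀ c (h T e : ℕ) → Approximation a m c (x ∸ pairs a) → Set
    Controlled c h T e A = count (V n) (over a a-sym p h) ≤ T ×
        (∀ l → edgesIn (goodIn a a-sym p h l) a ≤ 2 * e * count (V n) (goodIn a a-sym p h l))
      where open Approximation A using (p)

    module _ (c h T e : ℕ) (local-structure : (A : Approximation a m c (x ∸ pairs a)) → Controlled c h T e A) where

      -- Common to both cases: `T` bounds the number of vertices of large inner degree and `e` the
      -- density of inner edges among good vertices. For a single edge both are 0 and the linear
      -- term disappears.
      stability : clique-size c ≤ n → 16 * (m * m) < n →
        Σ (Fin n → Fin m) λ p → inner a p + missing a p ≤ (setup-factor m′ c + 3) * (x ∸ pairs a) + 2 * (4 * (T + e) * n)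
      stability size n-large = conclude (approximate m′ c a a-sym a-irr x (few-large-cliques c size) cross≤ n-large)
        where
        s : ℕ
        s = x ∸ pairs a
        conclude : n * n ≤ setup-factor m′ c * s ⊎ Approximation a m c s →
          Σ (Fin n → Fin m) λ p → inner a p + missing a p ≤ (setup-factor m′ c + 3) * s + 2 * (4 * (T + e) * n)
        conclude (inj₁ far) = (λ _ → j) , ≤-trans (inner+missing≤ a (λ _ → j))
          (≤-trans far (≤-trans (*-monoˡ-≤ s (m≤m+n (setup-factor m′ c) 3)) (m≤m+n _ _)))
        conclude (inj₂ A) = A.p , ≤-trans
          (edit-bound (4 * (T + e) * n) A.missing≤
          (inner-bound a a-sym A.p h T e (proj₁ (local-structure A)) (proj₂ (local-structure A))))
            (+-monoˡ-≤ (2 * (4 * (T + e) * n)) (*-monoˡ-≤ s (m≤n+m 3 (setup-factor m′ c))))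
          where module A = Approximation A

    good-in-part : ∀ (p : Fin n → Fin m) h l v → goodIn a a-sym p h l v ≡ true → p v ≡ l
    good-in-part p h l v e = true-⌊⌋ (p v ≟ l) (proj₂ (∧-true {good a a-sym p h v} e))

    good-in-missing : ∀ (p : Fin n → Fin m) h l v → goodIn a a-sym p h l v ≡ true → h * missingDegree a p v ≤ 4 * n
    good-in-missing p h l v e = good-missing a a-sym p h (proj₁ (∧-true e))

  -- The two summands of `c` serve the two uses of `aligned`, in `forest-in-part` and in
  -- `spread-vertices`. `T` is the number of vertices from which `common-neighbours` extracts q.
  module ForestConstants where
    h T h′ c c₁ c₂ : ℕ
    h = host-density m q
    T = chain-size (length (V m)) h q
    h′ = chain-factor (length (V m)) h q
    c₁ = aligned-factor (host-factor m q) (m * q)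
    c₂ = aligned-factor h′ (m * q)
    c = c₁ + c₂
    n₁ n₂ n₃ n₄ n₅ n₀ : ℕ
    n₁ = clique-size c
    n₂ = suc (16 * (m * m))
    n₃ = host-density m q * q
    n₄ = aligned-size (host-factor m q) (m * q)
    n₅ = aligned-size h′ (m * q)
    n₀ = n₁ + (n₂ + (n₃ + (n₄ + n₅)))

  module _ {n : ℕ} (a : Fin n → Fin n → Bool) (a-sym : ∀ u w → a u w ≡ a w u) (a-irr : ∀ u → a u u ≡ false)
    (avoids : ¬ Embeds (KmqPlus m j F) a) (x : ℕ) (cross≤ : ∀ (p : Fin n → Fin m) → cross p ≤ x) where

    open ForestConstants

    forest-stability : n₀ ≤ n → Σ (Fin n → Fin m) λ p → inner a p + missing a p ≤ (setup-factor m′ c + 3) *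
      (x ∸ pairs a) + 2 * (4 * (T + q) * n)
    forest-stability n-large = stability a a-sym a-irr avoids x cross≤ c h T q local-structure n₁≤ n₂≤
      where
      bounds : (n₁ ≤ n × n₂ ≤ n) × (n₃ ≤ n × n₄ ≤ n × n₅ ≤ n)
      bounds = sum-bounds n₁ n₂ n₃ n₄ n₅ n-large
      n₁≤ : n₁ ≤ n
      n₁≤ = proj₁ (proj₁ bounds)
      n₂≤ : n₂ ≤ n
      n₂≤ = proj₂ (proj₁ bounds)
      n₃≤ : n₃ ≤ n
      n₃≤ = proj₁ (proj₂ bounds)
      n₄≤ : n₄ ≤ n
      n₄≤ = proj₁ (proj₂ (proj₂ bounds))
      n₅≤ : n₅ ≤ n
      n₅≤ = proj₂ (proj₂ (proj₂ bounds))
      module _ (A : Approximation a m c (x ∸ pairs a)) where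
        open Approximation A
        missing₁ : c₁ * missing a p ≤ n * n
        missing₁ = weaken c₁ c₂ missing-small
        missing₂ : c₂ * missing a p ≤ n * n
        missing₂ = weaken′ c₁ c₂ missing-small
        os : List (Fin n)
        os = select (over a a-sym p h) (V n)
        os-rich : ∀ v → v ∈ os → ∀ l → l ∈ V m → n ≤ h * neighboursIn a p v l
        os-rich v k l _ = over-degree a a-sym p h local (select-true (over a a-sym p h) (V n) k) l
        few-over : count (V n) (over a a-sym p h) ≤ T
        few-over = ≮⇒≥ λ many → too-many (common-neighbours a p h q (≤-trans (s≤s z≤n) n₂≤) (V m) os
            (Unique.filter⁺ (λ v → over a a-sym p h v Bool.≟ true) (Unique.allFin⁺ n))
            (≤-trans (<⇒≤ many) (≤-reflexive (sym (length-select (over a a-sym p h) (V n))))) os-rich)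
          where
          too-many : (Σ (List (Fin n)) λ s → Unique s × length s ≡ q ×
            (∀ l → l ∈ V m → n ≤ h′ * count (V n) (λ w → all (λ x → a x w ∧ ⌊ p w ≟ l ⌋) s)) × (∀ x → x ∈ s → x ∈ os)) → ⊥
          too-many (s , us , len , rich , _) = avoids
            (spread-vertices a a-sym a-irr m j F p forest h′ s us len (λ l → rich l (∈V l)) missing₂ n₅≤)
        sparse : ∀ l → edgesIn (goodIn a a-sym p h l) a ≤ 2 * q * count (V n) (goodIn a a-sym p h l)
        sparse l = by-core (dense-core a a-sym a-irr q _ (goodIn a a-sym p h l) refl)
          where
          by-core : DenseCore a a-sym a-irr q (goodIn a a-sym p h l) ⊎ edgesIn (goodIn a a-sym p h l) a ≤ 2 * q * count
            (V n) (goodIn a a-sym p h l) →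
            edgesIn (goodIn a a-sym p h l) a ≤ 2 * q * count (V n) (goodIn a a-sym p h l)
          by-core (inj₂ le) = le
          by-core (inj₁ core) = ⊥-elim (avoids (forest-in-part a a-sym a-irr m j F p forest l (goodIn a a-sym p h l)
            (good-in-part a a-sym a-irr avoids x cross≤ p h l)
              (good-in-missing a a-sym a-irr avoids x cross≤ p h l) n₃≤ large missing₁ n₄≤ core))
        local-structure : count (V n) (over a a-sym p h) ≤ T ×
          (∀ l → edgesIn (goodIn a a-sym p h l) a ≤ 2 * q * count (V n) (goodIn a a-sym p h l))
        local-structure = few-over , sparse

module _ (m′ : ℕ) (j : Fin (suc m′)) (F : Graph) (E : SingleEdge F) where

  private
    m q : ℕ
    m = suc m′
    q = order F
    forest : Forest F
    forest = single-edge-forest E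

  module EdgeConstants where
    h c c₁ c₂ : ℕ
    h = host-density m 2
    c₁ = aligned-factor (host-factor m 2) (m * q)
    c₂ = aligned-factor h (m * q)
    c = c₁ + c₂
    n₁ n₂ n₃ n₄ n₅ n₀ : ℕ
    n₁ = clique-size m′ j F forest c
    n₂ = suc (16 * (m * m))
    n₃ = host-density m 2 * 2
    n₄ = aligned-size (host-factor m 2) (m * q)
    n₅ = aligned-size h (m * q)
    n₀ = n₁ + (n₂ + (n₃ + (n₄ + n₅)))

  module _ {n : ℕ} (a : Fin n → Fin n → Bool) (a-sym : ∀ u w → a u w ≡ a w u) (a-irr : ∀ u → a u u ≡ false)
    (avoids : ¬ Embeds (KmqPlus m j F) a) (x : ℕ) (cross≤ : ∀ (p : Fin n → Fin m) → cross p ≤ x) where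

    open EdgeConstants

    edge-stability : n₀ ≤ n → Σ (Fin n → Fin m) λ p → inner a p + missing a p ≤ (setup-factor m′ c + 3) * (x ∸ pairs a)
    edge-stability n-large = proj₁ stable , ≤-trans (proj₂ stable) (≤-reflexive (+-identityʳ _))
      where
      bounds : (n₁ ≤ n × n₂ ≤ n) × (n₃ ≤ n × n₄ ≤ n × n₅ ≤ n)
      bounds = sum-bounds n₁ n₂ n₃ n₄ n₅ n-large
      n₁≤ : n₁ ≤ n
      n₁≤ = proj₁ (proj₁ bounds)
      n₂≤ : n₂ ≤ n
      n₂≤ = proj₂ (proj₁ bounds)
      n₃≤ : n₃ ≤ n
      n₃≤ = proj₁ (proj₂ bounds)
      n₄≤ : n₄ ≤ n
      n₄≤ = proj₁ (proj₂ (proj₂ bounds))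
      n₅≤ : n₅ ≤ n
      n₅≤ = proj₂ (proj₂ (proj₂ bounds))
      module _ (A : Approximation a m c (x ∸ pairs a)) where
        open Approximation A
        none-over : ∀ v → over a a-sym p h v ≡ true → ⊥
        none-over v o = avoids (spread-vertex a a-sym a-irr m j F p E h v (over-degree a a-sym p h local o)
          (weaken′ c₁ c₂ missing-small) n₅≤)
        few-over : count (V n) (over a a-sym p h) ≤ 0
        few-over = ≮⇒≥ λ some → let (v , _ , o) = count-exists (V n) (over a a-sym p h) some in none-over v o
        independent : ∀ l u w → (goodIn a a-sym p h l u ∧ goodIn a a-sym p h l w) ∧ a u w ≡ true → ⊥
        independent l u w e = avoids (edge-in-part a a-sym a-irr m j F p E l (goodIn a a-sym p h l)
          (good-in-part m′ j F forest a a-sym a-irr avoids x cross≤ p h l)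
            (good-in-missing m′ j F forest a a-sym a-irr avoids x cross≤ p h l)
          n₃≤ large (weaken c₁ c₂ missing-small) n₄≤ u w
          (proj₁ (∧-true (proj₁ (∧-true e)))) (proj₂ (∧-true {goodIn a a-sym p h l u} (proj₁ (∧-true e))))
            (proj₂ (∧-true {goodIn a a-sym p h l u ∧ goodIn a a-sym p h l w} e)))
        false-count : ∀ b → (b ≡ true → ⊥) → b2n b ≡ 0
        false-count false _ = refl
        false-count true  f = ⊥-elim (f refl)
        sparse : ∀ l → edgesIn (goodIn a a-sym p h l) a ≤ 2 * 0 * count (V n) (goodIn a a-sym p h l)
        sparse l = ≤-reflexive (∑-zero (V n) (λ u → ∑-zero (V n) (λ w → false-count _ (independent l u w))))
        local-structure : count (V n) (over a a-sym p h) ≤ 0 ×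
          (∀ l → edgesIn (goodIn a a-sym p h l) a ≤ 2 * 0 * count (V n) (goodIn a a-sym p h l))
        local-structure = few-over , sparse
      stable : Σ (Fin n → Fin m) λ p → inner a p + missing a p ≤ (setup-factor m′ c + 3) * (x ∸ pairs a) + 2 *
        (4 * (0 + 0) * n)
      stable = stability m′ j F forest a a-sym a-irr avoids x cross≤ c h 0 0 local-structure n₁≤ n₂≤

-- Sufficiency of the criteria

pullback : (G : Graph) {k : ℕ} → (Fin k → Fin (order G)) → Graph
pullback G {k} f = record { order = k ; adj = λ u w → adj G (f u) (f w) ; adjSym = λ u w → adjSym G (f u)
  (f w) ; irrefl = λ u → irrefl G (f u) }

complete-multipartite : ∀ {n m} → (Fin n → Fin m) → Graph
complete-multipartite {n} p = record { order = n ; adj = blowAdj p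
  ; adjSym = λ u w → cong not (⌊⌋-cong (p u ≟ p w) (p w ≟ p u) sym sym)
  ; irrefl = λ u → cong not (⌊⌋-true (p u ≟ p u) refl) }

module _ {I : Set} (𝓗 : I → Graph) where

  free-embeds : ∀ {A G : Graph} → Embeds A (adj G) → Free 𝓗 G → Free 𝓗 A
  free-embeds {A} {G} (f , f-inj , f-hom) free (i , H′ , (refl , super) , (φ , φ-inj , φ-iso)) =
    -- The supergraph found in `A` is replaced by the graph that `G` induces on its image, which
    -- again contains all edges of the member.
    free (i , pullback G (λ u → f (φ u)) , (refl , λ u w ad → f-hom _ _ (trans (sym (φ-iso u w)) (super u w ad))) ,
      ((λ u → f (φ u)) , (λ e → φ-inj (f-inj e)) , λ u w → refl))

  multipartite-free : ∀ {n m} → (∀ i → ¬ Colorable (𝓗 i) m) → (p : Fin n → Fin m) → Free 𝓗 (complete-multipartite p)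
  multipartite-free uncolorable p (i , H′ , (refl , super) , (φ , _ , φ-iso)) =
    uncolorable i ((λ u → p (φ u)) , λ u w ad same → absurd-bool (trans (sym (φ-iso u w)) (super u w ad))
      (cong not (⌊⌋-true (p (φ u) ≟ p (φ w)) same)))

pairs-edges : ∀ G → pairs (adj G) ≡ 2 * edges G
pairs-edges G = handshake (order G) (adj G) (adjSym G) (irrefl G)

cross-edges : ∀ {n m} (p : Fin n → Fin m) → cross p ≡ 2 * edges (complete-multipartite p)
cross-edges p = pairs-edges (complete-multipartite p)

edit-pairs : ∀ G {m} (p : Fin (order G) → Fin m) → inner (adj G) p + missing (adj G) p ≡ 2 * editDist G p
edit-pairs G p = trans (sym (edit-split p (adj G))) (handshake (order G) _
  (λ u w → cong₂ _xor_ (adjSym G u w) (adjSym (complete-multipartite p) u w))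
  (λ u → cong₂ _xor_ (irrefl G u) (irrefl (complete-multipartite p) u)))

2*C2 : ∀ n → 2 * (n C 2) + n ≡ n * n
2*C2 zero = refl
2*C2 (suc n) = begin
  2 * (suc n C 2) + suc n ≡⟨ cong (λ z → 2 * z + suc n) (sym (nCk+nC[k+1]≡[n+1]C[k+1] n 1)) ⟩
  2 * (n C 1 + n C 2) + suc n ≡⟨ cong (λ z → 2 * (z + n C 2) + suc n) (nC1≡n n) ⟩
  2 * (n + n C 2) + suc n ≡⟨ eq n (n C 2) ⟩
  2 * n + 1 + (2 * (n C 2) + n) ≡⟨ cong (2 * n + 1 +_) (2*C2 n) ⟩
  2 * n + 1 + n * n ≡⟨ eq′ n ⟩
  suc n * suc n ∎
  where
  open ≡-Reasoning
  eq : ∀ n c → 2 * (n + c) + (1 + n) ≡ 2 * n + 1 + (2 * c + n)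
  eq = solve-∀
  eq′ : ∀ n → 2 * n + 1 + n * n ≡ (1 + n) * (1 + n)
  eq′ = solve-∀

square≤C2 : ∀ n → 2 ≤ n → n * n ≤ 4 * (n C 2)
square≤C2 n n≥2 = lin 0 (+-mono-≤ (≤-reflexive (sym (2*C2 n)))
  (+-mono-≤ (≤-reflexive (sym (2*C2 n))) (*-monoˡ-≤ n n≥2))) (eq n (n C 2))
  where
  eq : ∀ n c → n * n + (2 * c + n + (2 * c + n + n * n)) + 0 ≡ 4 * c + (n * n + (n * n + 2 * n))
  eq = solve-∀

module _ {I : Set} (𝓗 : I → Graph) (m′ : ℕ) (uncolorable : ∀ i → ¬ Colorable (𝓗 i) (suc m′)) (j : Fin (suc m′)) (F : Graph)
  (forced : ¬ Free 𝓗 (KmqPlus (suc m′) j F)) where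

  private
    m : ℕ
    m = suc m′

  module _ (G : Graph) (free : Free 𝓗 G) (ex : ℕ) (is-ex : IsEx 𝓗 (order G) ex) where

    avoids-forced : ¬ Embeds (KmqPlus m j F) (adj G)
    avoids-forced emb = forced (free-embeds 𝓗 {KmqPlus m j F} {G} emb free)

    cross≤ex : ∀ (p : Fin (order G) → Fin m) → cross p ≤ 2 * ex
    cross≤ex p = ≤-trans (≤-reflexive (cross-edges p))
      (*-monoʳ-≤ 2 (proj₂ is-ex (complete-multipartite p) (multipartite-free 𝓗 uncolorable p) refl))

    deficit : 2 * ex ∸ pairs (adj G) ≡ 2 * (ex ∸ edges G)
    deficit = trans (cong (2 * ex ∸_) (pairs-edges G)) (sym (*-distribˡ-∸ 2 ex (edges G)))

  critical-edge⇒perfectly-stable : SingleEdge F → PerfectlyStable 𝓗 m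
  critical-edge⇒perfectly-stable E = K , stable
    where
    open EdgeConstants m′ j F E
    L K : ℕ
    L = setup-factor m′ c + 3
    K = n₀ + L
    stable : ∀ G → Free 𝓗 G → K ≤ order G → ∀ ex → IsEx 𝓗 (order G) ex →
      Σ (Fin (order G) → Fin m) λ p → editDist G p ≤ K * (ex ∸ edges G)
    stable G free large ex is-ex = proj₁ found , ≤-trans (*-cancelˡ-≤ 2 doubled) (*-monoˡ-≤ (ex ∸ edges G) (m≤n+m L n₀))
      where
      found : Σ (Fin (order G) → Fin m) λ p → inner (adj G) p + missing (adj G) p ≤ L * (2 * ex ∸ pairs (adj G))
      found = edge-stability m′ j F E (adj G) (adjSym G) (irrefl G) (avoids-forced G free ex is-ex) (2 * ex)
        (cross≤ex G free ex is-ex) (≤-trans (m≤m+n n₀ L) large)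
      doubled : 2 * editDist G (proj₁ found) ≤ 2 * (L * (ex ∸ edges G))
      doubled = begin
        2 * editDist G (proj₁ found) ≡⟨ sym (edit-pairs G (proj₁ found)) ⟩
        inner (adj G) (proj₁ found) + missing (adj G) (proj₁ found) ≤⟨ proj₂ found ⟩
        L * (2 * ex ∸ pairs (adj G)) ≡⟨ cong (L *_) (deficit G free ex is-ex) ⟩
        L * (2 * (ex ∸ edges G)) ≡⟨ eq L (ex ∸ edges G) ⟩
        2 * (L * (ex ∸ edges G)) ∎
        where
        open ≤-Reasoning
        eq : ∀ L s → L * (2 * s) ≡ 2 * (L * s)
        eq = solve-∀

  -- The estimate d ≤ L·s + M·n becomes one of the two alternatives according to which of s and n is
  -- larger; the 4 in `K` comes from n² ≤ 4·binom(n, 2).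
  critical-forest⇒robustly-stable : Forest F → RobustlyStable 𝓗 m
  critical-forest⇒robustly-stable forest = K , stable
    where
    open ForestConstants m′ j F forest
    L M K : ℕ
    L = setup-factor m′ c + 3
    M = 4 * (T + order F)
    K = n₀ + (4 * (L + M) + 2)
    stable : ∀ G → Free 𝓗 G → K ≤ order G → ∀ ex → IsEx 𝓗 (order G) ex →
      Σ (Fin (order G) → Fin m) λ p → (editDist G p * order G ≤ K * (order G C 2)) ⊎ (editDist G p ≤ K * (ex ∸ edges G))
    stable G free large ex is-ex = proj₁ found , conclude (≤-total (order G) s)
      where
      n s d : ℕ
      n = order G
      s = ex ∸ edges G
      found : Σ (Fin n → Fin m) λ p → inner (adj G) p + missing (adj G) p ≤ L * (2 * ex ∸ pairs (adj G)) + 2 * (M * n)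
      found = forest-stability m′ j F forest (adj G) (adjSym G) (irrefl G) (avoids-forced G free ex is-ex) (2 * ex)
        (cross≤ex G free ex is-ex) (≤-trans (m≤m+n n₀ _) large)
      d = editDist G (proj₁ found)
      bound : d ≤ L * s + M * n
      bound = *-cancelˡ-≤ 2 (begin
        2 * d ≡⟨ sym (edit-pairs G (proj₁ found)) ⟩
        inner (adj G) (proj₁ found) + missing (adj G) (proj₁ found) ≤⟨ proj₂ found ⟩
        L * (2 * ex ∸ pairs (adj G)) + 2 * (M * n) ≡⟨ cong (λ z → L * z + 2 * (M * n)) (deficit G free ex is-ex) ⟩
        L * (2 * s) + 2 * (M * n) ≡⟨ eq L s (M * n) ⟩
        2 * (L * s + M * n) ∎)
        where
        open ≤-Reasoning
        eq : ∀ L s y → L * (2 * s) + 2 * y ≡ 2 * (L * s + y)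
        eq = solve-∀
      factor≤ : 4 * (L + M) ≤ K
      factor≤ = ≤-trans (m≤m+n (4 * (L + M)) 2) (m≤n+m _ n₀)
      n≥2 : 2 ≤ n
      n≥2 = ≤-trans (≤-trans (m≤n+m 2 (4 * (L + M))) (m≤n+m _ n₀)) large
      conclude : n ≤ s ⊎ s ≤ n → (d * n ≤ K * (n C 2)) ⊎ (d ≤ K * s)
      conclude (inj₁ n≤s) = inj₂ (≤-trans bound
        (≤-trans (+-monoʳ-≤ (L * s) (*-monoʳ-≤ M n≤s)) (≤-trans (≤-reflexive (sym (*-distribʳ-+ s L M)))
        (*-monoˡ-≤ s (≤-trans (m≤m+n (L + M) _) factor≤)))))
      conclude (inj₂ s≤n) = inj₁ (begin
        d * n ≤⟨ *-monoˡ-≤ n (≤-trans bound (+-monoˡ-≤ (M * n) (*-monoʳ-≤ L s≤n))) ⟩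
        (L * n + M * n) * n ≡⟨ eq L M n ⟩
        (L + M) * (n * n) ≤⟨ *-monoʳ-≤ (L + M) (square≤C2 n n≥2) ⟩
        (L + M) * (4 * (n C 2)) ≡⟨ eq′ (L + M) (n C 2) ⟩
        4 * (L + M) * (n C 2) ≤⟨ *-monoˡ-≤ (n C 2) factor≤ ⟩
        K * (n C 2) ∎)
        where
        open ≤-Reasoning
        eq : ∀ L M n → (L * n + M * n) * n ≡ (L + M) * (n * n)
        eq = solve-∀
        eq′ : ∀ L c → L * (4 * c) ≡ 4 * L * c
        eq′ = solve-∀

-- Extremal graphs and perfect stability

-- Supplies the defect for `cauchy` when only its non-negativity matters, that is, for the plain
-- inequality between Σ aₗ² and n²/m.
square-defect : ∀ x n → Σ ℕ λ D → x * x + n * n ≡ 2 * (x * n) + D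
square-defect x n with ≤-total x n
... | inj₁ le = (n ∸ x) * (n ∸ x) , subst (λ z → x * x + z * z ≡ 2 * (x * z) + (n ∸ x) * (n ∸ x)) (m+[n∸m]≡n le)
  (eq x (n ∸ x))
  where
  eq : ∀ x y → x * x + (x + y) * (x + y) ≡ 2 * (x * (x + y)) + y * y
  eq = solve-∀
... | inj₂ ge = (x ∸ n) * (x ∸ n) , subst (λ z → z * z + n * n ≡ 2 * (z * n) + (x ∸ n) * (x ∸ n)) (m+[n∸m]≡n ge)
  (eq n (x ∸ n))
  where
  eq : ∀ x y → (x + y) * (x + y) + x * x ≡ 2 * ((x + y) * x) + y * y
  eq = solve-∀

module _ (m′ q : ℕ) where

  private
    m n : ℕ
    m = suc m′
    n = m * q
    part : Fin n → Fin m
    part u = proj₁ (remQuot {m} q u)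
    squares : ∀ {n} → (Fin n → Fin m) → ℕ
    squares p = ∑ (V m) (λ l → part-size p l * part-size p l)

  part-size-large : ∀ l → q ≤ part-size part l
  part-size-large l = image-count (λ u → ⌊ part u ≟ l ⌋) (combine l) (λ {s} {t} → Fin.combine-injectiveʳ l s l t)
    (λ t → ⌊⌋-true (part (combine l t) ≟ l) (cong proj₁ (Fin.remQuot-combine {m} l t)))

  part-size-small : ∀ l → part-size part l ≤ q
  part-size-small l = m∸n≡0⇒m≤n (n≤0⇒n≡0
    (+-cancelˡ-≤ n excess 0 (≤-trans (≤-reflexive (sym total)) (≤-trans (∑-mono (V m) pointwise)
      (≤-reflexive (trans (∑-part-size part) (sym (+-identityʳ n))))))))
    where
    excess : ℕ
    excess = part-size part l ∸ q
    total : ∑ (V m) (λ k → q + b2n ⌊ k ≟ l ⌋ * excess) ≡ n + excess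
    total = trans (∑-+ (V m) (λ _ → q) _) (cong₂ _+_ (∑V-const m q) (∑-δ l (λ _ → excess)))
    pointwise : ∀ k → q + b2n ⌊ k ≟ l ⌋ * excess ≤ part-size part k
    pointwise k with k ≟ l
    ... | yes refl = ≤-reflexive (trans (cong (q +_) (+-identityʳ excess)) (m+[n∸m]≡n (part-size-large l)))
    ... | no _ = ≤-trans (≤-reflexive (+-identityʳ q)) (part-size-large k)

  balanced-optimal : ∀ (p : Fin n → Fin m) → cross p ≤ cross part
  balanced-optimal p = lin 0 (+-mono-≤ (≤-reflexive (trans (cross+squares p) (sym (cross+squares part))))
    (≤-trans part-squares squares-large))
      (eq (cross p) (cross part) (squares part) (squares p))
    where
    eq : ∀ c d s t → c + (d + s + t) + 0 ≡ d + (c + t + s)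
    eq = solve-∀
    part-squares : squares part ≤ m * (q * q)
    part-squares = ≤-trans (∑-mono (V m) (λ l → *-mono-≤ (part-size-small l) (part-size-small l)))
      (≤-reflexive (∑V-const m (q * q)))
    defect : Σ ℕ λ D → m * part-size p zero * (m * part-size p zero) + n * n ≡ 2 * (m * part-size p zero * n) + D
    defect = square-defect (m * part-size p zero) n
    squares-large : m * (q * q) ≤ squares p
    squares-large = *-cancelˡ-≤ (m * m)
      (lin (proj₁ defect) (cauchy m (part-size p) zero n (proj₁ defect) (∑-part-size p) (proj₂ defect))
      (eq′ m q (squares p) (proj₁ defect)))
      where
      eq′ : ∀ m q S D → m * m * (m * (q * q)) + m * m * S + D ≡ m * m * S + (m * (m * q * (m * q)) + D)
      eq′ = solve-∀

  kmq-pairs : ∀ (j : Fin m) (F : Graph) → order F ≡ q → cross part + pairs (adj F) ≤ pairs (adj (KmqPlus m j F))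
  kmq-pairs j F refl = ≤-trans (+-monoʳ-≤ (cross part) inside) (≤-reflexive (trans (sym (∑₂-+ {n} _ _)) (∑₂-cong split)))
    where
    index : Fin n → Fin q
    index u = proj₂ (remQuot {m} q u)
    inPart : Fin n → Fin n → Bool
    inPart u w = ⌊ part u ≟ part w ⌋ ∧ (⌊ part u ≟ j ⌋ ∧ adj F (index u) (index w))
    split : ∀ u w → b2n (blowAdj part u w) + b2n (inPart u w) ≡ b2n (adj (KmqPlus m j F) u w)
    split u w with part u ≟ part w
    ... | yes _ = refl
    ... | no _ = refl
    at : ∀ s t → inPart (combine j s) (combine j t) ≡ adj F s t
    at s t = trans (cong₂ (λ x y → ⌊ proj₁ x ≟ proj₁ y ⌋ ∧ (⌊ proj₁ x ≟ j ⌋ ∧ adj F (proj₂ x) (proj₂ y)))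
      (Fin.remQuot-combine {m} j s) (Fin.remQuot-combine {m} j t))
      (cong (λ b → b ∧ (b ∧ adj F s t)) (⌊⌋-true (j ≟ j) refl))
    column : Injective _≡_ _≡_ (combine {m} {q} j)
    column {s} {t} = Fin.combine-injectiveʳ j s j t
    inside : pairs (adj F) ≤ pairs inPart
    inside = ≤-trans (≤-reflexive (sym (∑₂-cong (λ s t → cong b2n (at s t)))))
      (≤-trans (∑-mono (V q) (λ s → ∑-injective (combine j) column (λ w → b2n (inPart (combine j s) w))))
        (∑-injective (combine j) column (λ u → ∑ (V n) (λ w → b2n (inPart u w)))))

-- In ordered pairs, `G` has at least cross part + 2e(F) ≥ cross p + 2e(F) of them, and exactly
-- cross p + inner - missing. Hence inner alone is at least 2e(F).
extremal-edit : ∀ m′ (j : Fin (suc m′)) F G → order G ≡ suc m′ * order F → edges (KmqPlus (suc m′) j F) ≤ edges G →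
  ∀ (p : Fin (order G) → Fin (suc m′)) → edges F ≤ editDist G p
extremal-edit m′ j F G size more p = *-cancelˡ-≤ 2
  (lin (2 * missing (adj G) p) (+-mono-≤ (kmq-pairs m′ (order F) j F refl) (+-mono-≤ optimal
    (+-mono-≤ (*-monoʳ-≤ 2 more) (≤-reflexive (edges+missing p (adj G))))))
  (trans (cong₂ (λ a b → 2 * edges F + (b + (cross part + (2 * edges G + (cross p + inner (adj G) p)))) + a) refl
    (pairs-edges (KmqPlus m j F)))
   (trans (eq (edges F) (edges (KmqPlus m j F)) (cross part) (edges G) (cross p) (inner (adj G) p) (missing (adj G) p))
   (cong₂ _+_ (edit-pairs G p) (cong₂
     (λ x y → cross part + x + (cross p + (2 * edges (KmqPlus m j F) + (y + missing (adj G) p)))) (sym (pairs-edges F))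
     (sym (pairs-edges G)))))))
  where
  m : ℕ
  m = suc m′
  part : Fin (m * order F) → Fin m
  part u = proj₁ (remQuot {m} (order F) u)
  optimal : cross p ≤ cross part
  optimal = on-size (order G) size p
    where
    on-size : ∀ n → n ≡ m * order F → (p : Fin n → Fin m) → cross p ≤ cross part
    on-size _ refl p = balanced-optimal m′ (order F) p
  eq : ∀ f k c g d i μ → 2 * f + (2 * k + (c + (2 * g + (d + i)))) + 2 * μ ≡ i + μ +
    (c + 2 * f + (d + (2 * k + (2 * g + μ))))
  eq = solve-∀

-- `P` need not be decidable, so the climb to larger values is carried out inside a refutation; it
-- stops at the bound `B`.
¬¬-maximum : ∀ (P : ℕ → Set) B → (∀ e → P e → e ≤ B) → ∀ e → P e → ¬ ¬ (Σ ℕ λ x → P x × (∀ e → P e → e ≤ x))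
¬¬-maximum P B bounded e Pe none = climb B e (m≤n+m B e) Pe
  where
  climb : ∀ d e → B ≤ e + d → P e → ⊥
  climb zero e reach Pe = none (e , Pe , λ e′ Pe′ → ≤-trans (bounded e′ Pe′) (≤-trans reach (≤-reflexive (+-identityʳ e))))
  climb (suc d) e reach Pe = none
    (e , Pe , λ e′ Pe′ → ≮⇒≥ λ lt → climb d e′ (≤-trans reach (≤-trans (≤-reflexive (+-suc e d)) (+-monoˡ-≤ d lt))) Pe′)

module _ {I : Set} (𝓗 : I → Graph) where

  ¬¬-extremal : ∀ G → Free 𝓗 G → ¬ ¬ (Σ ℕ (IsEx 𝓗 (order G)))
  ¬¬-extremal G free none = ¬¬-maximum Attained (order G * order G) bounded (edges G) (G , free , refl , refl)
    λ (x , attained , max) → none (x , attained , λ G′ free′ size → max (edges G′) (G′ , free′ , size , refl))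
    where
    Attained : ℕ → Set
    Attained e = Σ Graph λ G′ → Free 𝓗 G′ × order G′ ≡ order G × edges G′ ≡ e
    bounded : ∀ e → Attained e → e ≤ order G * order G
    bounded e (G′ , _ , size , refl) = ≤-trans (m≤m+n (edges G′) (edges G′ + 0))
      (≤-trans (≤-reflexive (sym (pairs-edges G′)))
      (≤-trans (pairs≤ (adj G′)) (≤-reflexive (cong₂ _*_ size size))))

  extremal-graph : ∀ m′ (j : Fin (suc m′)) F → Free 𝓗 (KmqPlus (suc m′) j F) →
    ¬ ¬ (Σ Graph λ G → Free 𝓗 G × order G ≡ suc m′ * order F × IsEx 𝓗 (order G) (edges G) ×
      (∀ (p : Fin (order G) → Fin (suc m′)) → edges F ≤ editDist G p))
  extremal-graph m′ j F free none = ¬¬-extremal (KmqPlus (suc m′) j F) free λ { (_ , (G , free-G , size , refl) , max) →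
    none (G , free-G , size , ((G , free-G , refl , refl) , λ G′ free′ size′ → max G′ free′ (trans size′ size)) ,
      extremal-edit m′ j F G size (max (KmqPlus (suc m′) j F) free refl)) }

module _ {n : ℕ} where

  link : Fin n → Fin n → Fin n → Fin n → Bool
  link x y u w = ⌊ (u ≟ x) ×-dec (w ≟ y) ⌋ ∨ ⌊ (u ≟ y) ×-dec (w ≟ x) ⌋

  link-cases : ∀ x y u w → link x y u w ≡ true → (u ≡ x × w ≡ y) ⊎ (u ≡ y × w ≡ x)
  link-cases x y u w e with (u ≟ x) ×-dec (w ≟ y) | (u ≟ y) ×-dec (w ≟ x)
  ... | yes d | _ = inj₁ d
  ... | no _ | yes d = inj₂ d

  link-sym : ∀ x y u w → link x y u w ≡ link x y w u
  link-sym x y u w = trans (∨-comm ⌊ (u ≟ x) ×-dec (w ≟ y) ⌋ ⌊ (u ≟ y) ×-dec (w ≟ x) ⌋) (cong₂ _∨_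
    (⌊⌋-cong ((u ≟ y) ×-dec (w ≟ x)) ((w ≟ x) ×-dec (u ≟ y)) (λ (e , f) → f , e) (λ (e , f) → f , e))
    (⌊⌋-cong ((u ≟ x) ×-dec (w ≟ y)) ((w ≟ y) ×-dec (u ≟ x)) (λ (e , f) → f , e) (λ (e , f) → f , e)))

  link-irr : ∀ {x y} → x ≢ y → ∀ u → link x y u u ≡ false
  link-irr {x} {y} x≢y u with link x y u u in eq
  ... | false = refl
  ... | true with link-cases x y u u eq
  ...   | inj₁ (e , f) = ⊥-elim (x≢y (trans (sym e) f))
  ...   | inj₂ (e , f) = ⊥-elim (x≢y (trans (sym f) e))

  pairs-link : ∀ x y → x ≢ y → pairs (link x y) ≡ 2
  pairs-link x y x≢y = trans (∑₂-cong pointwise) (trans (∑₂-+ {n} _ _) (cong₂ _+_ (pair-δ x y) (pair-δ y x)))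
    where
    pointwise : ∀ u w → b2n (link x y u w) ≡ b2n ⌊ (u ≟ x) ×-dec (w ≟ y) ⌋ + b2n ⌊ (u ≟ y) ×-dec (w ≟ x) ⌋
    pointwise u w with (u ≟ x) ×-dec (w ≟ y) | (u ≟ y) ×-dec (w ≟ x)
    ... | yes (e , _) | yes (f , _) = ⊥-elim (x≢y (trans (sym e) f))
    ... | yes _ | no _ = refl
    ... | no _ | yes _ = refl
    ... | no _ | no _ = refl

edge-graph : ℕ → Graph
edge-graph k = record { order = 2 + k ; adj = link zero (suc zero) ; adjSym = link-sym zero (suc zero) ; irrefl =
  link-irr (λ ()) }

edge-graph-edges : ∀ k → edges (edge-graph k) ≡ 1
edge-graph-edges k = *-cancelˡ-≡ _ _ 2 (trans (sym (pairs-edges (edge-graph k))) (pairs-link {2 + k} zero (suc zero) (λ ())))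

-- The K isolated vertices beside the edge lift the order above the threshold K. An extremal graph
-- has deficit 0, so stability places it at distance 0 from a complete m-partite graph, whereas
-- `extremal-graph` keeps it at distance at least 1.
perfectly-stable⇒critical-edge : ∀ {I : Set} (𝓗 : I → Graph) m′ → PerfectlyStable 𝓗 (suc m′) →
  Σ Graph λ F → Σ (Fin (suc m′)) λ j → edges F ≡ 1 × ¬ Free 𝓗 (KmqPlus (suc m′) j F)
perfectly-stable⇒critical-edge 𝓗 m′ (K , stable) = edge-graph K , zero , edge-graph-edges K , λ free →
  extremal-graph 𝓗 m′ zero (edge-graph K) free contradiction
  where
  contradiction : ¬ (Σ Graph λ G → Free 𝓗 G × order G ≡ suc m′ * (2 + K) × IsEx 𝓗 (order G) (edges G) ×
      (∀ (p : Fin (order G) → Fin (suc m′)) → edges (edge-graph K) ≤ editDist G p))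
  contradiction (G , free , size , is-ex , far) = 1+n≰n
    (≤-trans (≤-reflexive (sym (edge-graph-edges K))) (≤-trans (far (proj₁ near))
      (≤-trans (proj₂ near) (≤-reflexive (trans (cong (K *_) (n∸n≡0 (edges G))) (*-zeroʳ K))))))
    where
    near : Σ (Fin (order G) → Fin (suc m′)) λ p → editDist G p ≤ K * (edges G ∸ edges G)
    near = stable G free (≤-trans (≤-trans (m≤n+m K 2) (m≤m+n (2 + K) _)) (≤-reflexive (sym size))) (edges G) is-ex

-- Graphs of high girth

-- The index bounds the length from above: `stay` is available at every k, so that walks can be
-- weakened.
data Walk {n} (a : Fin n → Fin n → Bool) : ℕ → Fin n → Fin n → Set where
  stay : ∀ {k u} → Walk a k u u
  step : ∀ {k u v w} → a u v ≡ true → Walk a k v w → Walk a (suc k) u w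

walk-≤ : ∀ {n} {a : Fin n → Fin n → Bool} {k l u w} → k ≤ l → Walk a k u w → Walk a l u w
walk-≤ k≤l stay = stay
walk-≤ (s≤s k≤l) (step e W) = step e (walk-≤ k≤l W)

walk-map : ∀ {n} {a b : Fin n → Fin n → Bool} → (∀ u w → a u w ≡ true → b u w ≡ true) → ∀ {k u w} → Walk a k u w →
  Walk b k u w
walk-map f stay = stay
walk-map f (step e W) = step (f _ _ e) (walk-map f W)

walk-++ : ∀ {n} {a : Fin n → Fin n → Bool} {k l u v w} → Walk a k u v → Walk a l v w → Walk a (k + l) u w
walk-++ {k = k} stay W′ = walk-≤ (m≤n+m _ k) W′
walk-++ (step e W) W′ = step e (walk-++ W W′)

walk-reverse : ∀ {n} {a : Fin n → Fin n → Bool} → (∀ u w → a u w ≡ a w u) → ∀ {k u w} → Walk a k u w → Walk a k w u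
walk-reverse a-sym stay = stay
walk-reverse a-sym {suc k} (step e W) = walk-≤ (≤-reflexive (+-comm k 1))
  (walk-++ (walk-reverse a-sym W) (step {k = 0} (trans (a-sym _ _) e) stay))

module _ {n : ℕ} where

  link-count : ∀ x y v → x ≢ y → count (V n) (link x y v) ≤ b2n ⌊ v ≟ x ⌋ + b2n ⌊ v ≟ y ⌋
  link-count x y v x≢y with v ≟ x | v ≟ y
  ... | yes refl | yes e = ⊥-elim (x≢y e)
  ... | yes refl | no _ = ≤-reflexive (trans (∑-cong (V n) at) (∑-δ-count y))
    where
    at : ∀ w → b2n (⌊ yes refl ×-dec (w ≟ y) ⌋ ∨ false) ≡ b2n ⌊ w ≟ y ⌋
    at w with w ≟ y
    ... | yes _ = refl
    ... | no _ = refl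
  ... | no _ | yes refl = ≤-reflexive (trans (∑-cong (V n) at) (∑-δ-count x))
    where
    at : ∀ w → b2n ⌊ yes refl ×-dec (w ≟ x) ⌋ ≡ b2n ⌊ w ≟ x ⌋
    at w with w ≟ x
    ... | yes _ = refl
    ... | no _ = refl
  ... | no _ | no _ = ≤-reflexive (∑-zero (V n) (λ _ → refl))

  with-edge without-edge : Fin n → Fin n → (Fin n → Fin n → Bool) → Fin n → Fin n → Bool
  with-edge x y a u w = a u w ∨ link x y u w
  without-edge s t a u w = a u w ∧ not (link s t u w)

  module _ (a : Fin n → Fin n → Bool) (x y s t : Fin n) where

    private
      b : Fin n → Fin n → Bool
      b = without-edge s t a

    -- A walk using the new edge xy is cut at its first and after its last passage through that edge.
    Crossing : ℕ → Fin n → Set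
    Crossing k v = Σ ℕ λ i → Σ ℕ λ l → i + suc l ≤ k × ((Walk b i v x × Walk b l y t) ⊎ (Walk b i v y × Walk b l x t))

    cut : ∀ {k v} → Walk (without-edge s t (with-edge x y a)) k v t → Walk b k v t ⊎ Crossing k v
    cut stay = inj₁ stay
    cut {suc k} {v} (step {v = z} e W) = by-edge (old-or-new (a v z) refl) (cut W)
      where
      avoids : not (link s t v z) ≡ true
      avoids = proj₂ (∧-true {with-edge x y a v z} e)
      old-or-new : ∀ c → a v z ≡ c → b v z ≡ true ⊎ ((v ≡ x × z ≡ y) ⊎ (v ≡ y × z ≡ x))
      old-or-new true av = inj₁ (true-∧ av avoids)
      old-or-new false av = inj₂ (link-cases x y v z (subst (λ c → c ∨ link x y v z ≡ true) av (proj₁ (∧-true e))))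
      by-edge : b v z ≡ true ⊎ ((v ≡ x × z ≡ y) ⊎ (v ≡ y × z ≡ x)) → Walk b k z t ⊎ Crossing k z → Walk b
        (suc k) v t ⊎ Crossing (suc k) v
      by-edge (inj₁ old) (inj₁ W′) = inj₁ (step old W′)
      by-edge (inj₁ old) (inj₂ (i , l , le , inj₁ (W₁ , W₂))) = inj₂ (suc i , l , s≤s le , inj₁ (step old W₁ , W₂))
      by-edge (inj₁ old) (inj₂ (i , l , le , inj₂ (W₁ , W₂))) = inj₂ (suc i , l , s≤s le , inj₂ (step old W₁ , W₂))
      by-edge (inj₂ (inj₁ (refl , refl))) (inj₁ W′) = inj₂ (0 , k , ≤-refl , inj₁ (stay , W′))
      by-edge (inj₂ (inj₂ (refl , refl))) (inj₁ W′) = inj₂ (0 , k , ≤-refl , inj₂ (stay , W′))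
      by-edge (inj₂ (inj₁ (refl , refl))) (inj₂ (i , l , le , inj₁ (_ , W₂))) = inj₂
        (0 , l , ≤-trans (m≤n+m _ i) (≤-trans le (n≤1+n k)) , inj₁ (stay , W₂))
      -- The walk comes back to its starting point `x`, so the detour through the new edge is
      -- dropped.
      by-edge (inj₂ (inj₁ (refl , refl))) (inj₂ (i , l , le , inj₂ (_ , W₂))) = inj₁
        (walk-≤ (≤-trans (n≤1+n l) (≤-trans (m≤n+m _ i) (≤-trans le (n≤1+n k)))) W₂)
      by-edge (inj₂ (inj₂ (refl , refl))) (inj₂ (i , l , le , inj₁ (_ , W₂))) = inj₁
        (walk-≤ (≤-trans (n≤1+n l) (≤-trans (m≤n+m _ i) (≤-trans le (n≤1+n k)))) W₂)
      by-edge (inj₂ (inj₂ (refl , refl))) (inj₂ (i , l , le , inj₂ (_ , W₂))) = inj₂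
        (0 , l , ≤-trans (m≤n+m _ i) (≤-trans le (n≤1+n k)) , inj₂ (stay , W₂))

-- The ends of an edge stay at distance more than g when it is deleted, so no cycle has length at
-- most g + 1. Walks make this easy to preserve when edges are added; the degree bound keeps balls
-- small.
record HighGirth (n g D : ℕ) : Set where
  field
    a       : Fin n → Fin n → Bool
    a-sym   : ∀ u w → a u w ≡ a w u
    a-irr   : ∀ u → a u u ≡ false
    degree≤ : ∀ v → count (V n) (a v) ≤ D
    girth   : ∀ s t → a s t ≡ true → ¬ Walk (without-edge s t a) g s t

module _ {n g D : ℕ} (H : HighGirth n g D) where
  open HighGirth H

  -- A short walk around an old edge st that uses xy consists of pieces from s to one end of xy and
  -- from the other end to t. Joined through st they form a short walk between x and y, which are
  -- far apart.
  add-edge : ∀ x y → x ≢ y → a x y ≡ false → count (V n) (a x) < D → count (V n) (a y) < D → ¬ Walk a g x y →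
    Σ (HighGirth n g D) λ H′ → pairs a < pairs (HighGirth.a H′)
  add-edge x y x≢y xy-new x-low y-low far =
    record { a = a′ ; a-sym = a′-sym ; a-irr = a′-irr ; degree≤ = degree′≤ ; girth = girth′ } , more
    where
    a′ : Fin n → Fin n → Bool
    a′ = with-edge x y a
    a′-sym : ∀ u w → a′ u w ≡ a′ w u
    a′-sym u w = cong₂ _∨_ (a-sym u w) (link-sym x y u w)
    a′-irr : ∀ u → a′ u u ≡ false
    a′-irr u = cong₂ _∨_ (a-irr u) (link-irr x≢y u)
    degree′≤ : ∀ v → count (V n) (a′ v) ≤ D
    degree′≤ v = ≤-trans (∑-mono (V n) (λ w → bool (a v w) (link x y v w))) (≤-trans (≤-reflexive (∑-+ (V n) _ _))
        (≤-trans (+-monoʳ-≤ (count (V n) (a v)) (link-count x y v x≢y)) room))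
      where
      bool : ∀ b c → b2n (b ∨ c) ≤ b2n b + b2n c
      bool true c = m≤m+n 1 _
      bool false c = ≤-refl
      room : count (V n) (a v) + (b2n ⌊ v ≟ x ⌋ + b2n ⌊ v ≟ y ⌋) ≤ D
      room with v ≟ x | v ≟ y
      ... | yes refl | yes e = ⊥-elim (x≢y e)
      ... | yes refl | no _ = ≤-trans (≤-reflexive (+-comm _ 1)) x-low
      ... | no _ | yes refl = ≤-trans (≤-reflexive (+-comm _ 1)) y-low
      ... | no _ | no _ = ≤-trans (≤-reflexive (+-identityʳ _)) (degree≤ v)
    more : pairs a < pairs a′
    more = ≤-trans (≤-reflexive (trans (+-comm 1 (pairs a))
      (trans (cong (pairs a +_) (sym (pair-δ x y))) (sym (∑₂-+ {n} _ _))))) (∑₂-mono pointwise)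
      where
      pointwise : ∀ u w → b2n (a u w) + b2n ⌊ (u ≟ x) ×-dec (w ≟ y) ⌋ ≤ b2n (a′ u w)
      pointwise u w with (u ≟ x) ×-dec (w ≟ y)
      ... | yes (refl , refl) rewrite xy-new = ≤-refl
      ... | no _ = ≤-trans (≤-reflexive (+-identityʳ _)) (bool (a u w) _)
        where
        bool : ∀ b c → b2n b ≤ b2n (b ∨ c)
        bool true c = ≤-refl
        bool false c = z≤n
    far′ : ¬ Walk a g y x
    far′ W = far (walk-reverse a-sym W)
    forget : ∀ {s t} u w → without-edge s t a u w ≡ true → a u w ≡ true
    forget u w e = proj₁ (∧-true e)
    around : ∀ {s t z z′ i l} → i + suc l ≤ g → a s t ≡ true → Walk (without-edge s t a) i s z → Walk
      (without-edge s t a) l z′ t → Walk a g z z′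
    around {l = l} le st W₁ W₂ = walk-≤ le
      (walk-++ (walk-reverse a-sym (walk-map forget W₁)) (step st (walk-reverse a-sym (walk-map forget W₂))))
    girth′ : ∀ s t → a′ s t ≡ true → ¬ Walk (without-edge s t a′) g s t
    girth′ s t e W = by-case (a s t) refl
      where
      -- If st is the new edge itself, deleting it leaves old edges only, and the walk contradicts
      -- the distance of x and y directly.
      old-step : link x y s t ≡ true → ∀ u w → without-edge s t a′ u w ≡ true → a u w ≡ true
      old-step l u w f with a u w | link x y u w in luw | link s t u w in lstuw
      ... | true | _ | _ = refl
      old-step l u w () | false | false | _
      old-step l u w () | false | true | true
      ... | false | true | false = absurd-bool (same-link (link-cases x y s t l) (link-cases x y u w luw)) lstuw
        where
        same-link : (s ≡ x × t ≡ y) ⊎ (s ≡ y × t ≡ x) → (u ≡ x × w ≡ y) ⊎ (u ≡ y × w ≡ x) → link s t u w ≡ true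
        same-link (inj₁ (refl , refl)) _ = luw
        same-link (inj₂ (refl , refl)) _ = trans (∨-comm ⌊ (u ≟ y) ×-dec (w ≟ x) ⌋ _) luw
      by-case : ∀ c → a s t ≡ c → ⊥
      by-case true st with cut a x y s t W
      ... | inj₁ W′ = girth s t st W′
      ... | inj₂ (i , l , le , inj₁ (W₁ , W₂)) = far (around le st W₁ W₂)
      ... | inj₂ (i , l , le , inj₂ (W₁ , W₂)) = far′ (around le st W₁ W₂)
      by-case false st = endpoints (link-cases x y s t is-link)
        where
        is-link : link x y s t ≡ true
        is-link = subst (λ c → c ∨ link x y s t ≡ true) st e
        endpoints : (s ≡ x × t ≡ y) ⊎ (s ≡ y × t ≡ x) → ⊥
        endpoints (inj₁ (sx , ty)) = far (subst₂ (Walk a g) sx ty (walk-map (old-step is-link) W))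
        endpoints (inj₂ (sy , tx)) = far′ (subst₂ (Walk a g) sy tx (walk-map (old-step is-link) W))

  ball : ℕ → Fin n → Fin n → Bool
  ball zero    u v = ⌊ v ≟ u ⌋
  ball (suc k) u v = ⌊ v ≟ u ⌋ ∨ ⌊ Fin.any? (λ z → (a u z ∧ ball k z v) Bool.≟ true) ⌋

  walk-ball : ∀ {k u v} → Walk a k u v → ball k u v ≡ true
  walk-ball {zero}  {u} stay = ⌊⌋-true (u ≟ u) refl
  walk-ball {suc k} {u} stay rewrite ⌊⌋-true (u ≟ u) refl = refl
  walk-ball {suc k} {u} {v} (step {v = z} e W) = trans (cong (⌊ v ≟ u ⌋ ∨_)
    (⌊⌋-true (Fin.any? (λ z → (a u z ∧ ball k z v) Bool.≟ true)) (z , true-∧ e (walk-ball W)))) (∨-zeroʳ _)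

ball-size : ℕ → ℕ → ℕ
ball-size D zero    = 1
ball-size D (suc k) = 1 + D * ball-size D k

ball-count : ∀ {n g D} (H : HighGirth n g D) k u → count (V n) (ball H k u) ≤ ball-size D k
ball-count H zero u = ≤-reflexive (∑-δ-count u)
ball-count {n} {g} {D} H (suc k) u = begin
  count (V n) (ball H (suc k) u) ≤⟨ ∑-mono (V n) pointwise ⟩
  ∑ (V n) (λ v → b2n ⌊ v ≟ u ⌋ + ∑ (V n) (λ z → b2n (a u z) * b2n (ball H k z v))) ≡⟨ trans (∑-+ (V n) _ _)
    (cong₂ _+_ (∑-δ-count u) (∑-swap (V n) (V n) _)) ⟩
  1 + ∑ (V n) (λ z → ∑ (V n) (λ v → b2n (a u z) * b2n (ball H k z v))) ≡⟨ cong suc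
    (∑-cong (V n) (λ z → ∑-* (V n) (b2n (a u z)) _)) ⟩
  1 + ∑ (V n) (λ z → b2n (a u z) * count (V n) (ball H k z)) ≤⟨ +-monoʳ-≤ 1
    (∑-mono (V n) (λ z → *-monoʳ-≤ (b2n (a u z)) (ball-count H k z))) ⟩
  1 + ∑ (V n) (λ z → b2n (a u z) * ball-size D k) ≡⟨ cong suc (∑-*ʳ (V n) (ball-size D k) _) ⟩
  1 + count (V n) (a u) * ball-size D k ≤⟨ +-monoʳ-≤ 1 (*-monoˡ-≤ (ball-size D k) (degree≤ u)) ⟩
  1 + D * ball-size D k ∎
  where
  open ≤-Reasoning
  open HighGirth H
  pointwise : ∀ v → b2n (ball H (suc k) u v) ≤ b2n ⌊ v ≟ u ⌋ + ∑ (V n) (λ z → b2n (a u z) * b2n (ball H k z v))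
  pointwise v with v ≟ u | Fin.any? (λ z → (a u z ∧ ball H k z v) Bool.≟ true)
  ... | yes _ | _ = m≤m+n 1 _
  ... | no _ | no _ = z≤n
  ... | no _ | yes (z , e) = ≤-trans (≤-reflexive (trans (sym (cong b2n e)) (b2n-∧ (a u z) (ball H k z v))))
    (∑-∈ (λ z → b2n (a u z) * b2n (ball H k z v)) (∈V z))

empty-high-girth : ∀ n g D → HighGirth n g D
empty-high-girth n g D = record { a = λ _ _ → false ; a-sym = λ _ _ → refl ; a-irr = λ _ → refl
  ; degree≤ = λ v → ≤-trans (≤-reflexive (∑-zero (V n) (λ _ → refl))) z≤n ; girth = λ _ _ () }

-- Edges are added between unsaturated vertices at distance more than g until all unsaturated vertices lie in a single ball.
saturate : ∀ n g D → Σ (HighGirth n (suc g) D) λ H → D * n ≤ pairs (HighGirth.a H) + D * ball-size D (suc g)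
saturate n g D = grow (n * n) (empty-high-girth n (suc g) D) (m≤n+m (n * n) _)
  where
  grow : ∀ fuel (H : HighGirth n (suc g) D) → n * n ≤ pairs (HighGirth.a H) + fuel →
    Σ (HighGirth n (suc g) D) λ H → D * n ≤ pairs (HighGirth.a H) + D * ball-size D (suc g)
  grow fuel H enough = by-count (count (V n) low ≤? ball-size D (suc g))
    where
    open HighGirth H
    low : Fin n → Bool
    low v = ⌊ suc (count (V n) (a v)) ≤? D ⌋
    continue : ∀ fuel → n * n ≤ pairs a + fuel → (Σ (HighGirth n (suc g) D) λ H′ → pairs a < pairs (HighGirth.a H′)) →
      Σ (HighGirth n (suc g) D) λ H → D * n ≤ pairs (HighGirth.a H) + D * ball-size D (suc g)
    continue zero enough (H′ , more) = ⊥-elim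
      (1+n≰n (≤-trans more (≤-trans (pairs≤ (HighGirth.a H′)) (≤-trans enough (≤-reflexive (+-identityʳ _))))))
    continue (suc fuel) enough (H′ , more) = grow fuel H′
      (≤-trans enough (≤-trans (≤-reflexive (+-suc (pairs a) fuel)) (+-monoˡ-≤ fuel more)))
    by-count : Dec (count (V n) low ≤ ball-size D (suc g)) → Σ (HighGirth n (suc g) D) λ H → D * n ≤ pairs
      (HighGirth.a H) + D * ball-size D (suc g)
    by-count (yes few) = H , (begin
      D * n ≡⟨ trans (*-comm D n) (sym (∑V-const n D)) ⟩
      ∑ (V n) (λ v → D) ≤⟨ ∑-mono (V n) pointwise ⟩
      ∑ (V n) (λ v → count (V n) (a v) + D * b2n (low v)) ≡⟨ trans (∑-+ (V n) _ _) (cong (pairs a +_) (∑-* (V n) D _)) ⟩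
      pairs a + D * count (V n) low ≤⟨ +-monoʳ-≤ (pairs a) (*-monoʳ-≤ D few) ⟩
      pairs a + D * ball-size D (suc g) ∎)
      where
      open ≤-Reasoning
      pointwise : ∀ v → D ≤ count (V n) (a v) + D * b2n (low v)
      pointwise v with suc (count (V n) (a v)) ≤? D
      ... | yes _ = ≤-trans (≤-reflexive (sym (*-identityʳ D))) (m≤n+m _ _)
      ... | no ¬p = ≤-trans (≮⇒≥ ¬p) (m≤m+n _ _)
    by-count (no many) = continue fuel enough
      (add-edge H x y x≢y (not-adjacent (a x y) refl) (unsaturated x-low) (unsaturated y-low) far)
      where
      unsaturated : ∀ {v} → low v ≡ true → count (V n) (a v) < D
      unsaturated {v} = true-⌊⌋ (suc (count (V n) (a v)) ≤? D)
      first : ∃ λ v → v ∈ V n × low v ≡ true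
      first = count-exists (V n) low (≤-trans (s≤s z≤n) (≰⇒> many))
      x y : Fin n
      x = proj₁ first
      x-low : low x ≡ true
      x-low = proj₂ (proj₂ first)
      -- There are more unsaturated vertices than the ball around `x` can hold, so one of them lies
      -- outside it.
      second : ∃ λ v → v ∈ V n × b2n (ball H (suc g) x v) < b2n (low v)
      second = ∑-exists (V n) {λ v → b2n (low v)} {λ v → b2n (ball H (suc g) x v)}
        (≤-trans (s≤s (ball-count H (suc g) x)) (≰⇒> many))
      y = proj₁ second
      strict : ∀ b c → b2n b < b2n c → b ≡ false × c ≡ true
      strict false true lt = refl , refl
      strict true true lt = ⊥-elim (1+n≰n lt)
      strict true false lt = ⊥-elim (n≮0 lt)
      strict false false lt = ⊥-elim (n≮0 lt)
      y-split : ball H (suc g) x y ≡ false × low y ≡ true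
      y-split = strict (ball H (suc g) x y) (low y) (proj₂ (proj₂ second))
      y-low : low y ≡ true
      y-low = proj₂ y-split
      far : ¬ Walk a (suc g) x y
      far W = absurd-bool (walk-ball H W) (proj₁ y-split)
      x≢y : x ≢ y
      x≢y e = far (subst (Walk a (suc g) x) e stay)
      -- An edge is a walk of length one, which is at most `suc g`; hence the successor in the girth
      -- parameter.
      not-adjacent : ∀ c → a x y ≡ c → c ≡ false
      not-adjacent false e = refl
      not-adjacent true e = ⊥-elim (far (step e stay))

-- Robust stability and the theorem

-- The search meets functions only up to pointwise equality, which `resp` makes sufficient.
function-search : ∀ k n (P : (Fin k → Fin n) → Set) → (∀ f → Dec (P f)) → (∀ {f g} → (∀ x → f x ≡ g x) → P f → P g) →
  Dec (Σ (Fin k → Fin n) P)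
function-search zero n P P? resp = map′ (λ Pf → empty , Pf) (λ (f , Pf) → resp {f} {empty} (λ ()) Pf) (P? empty)
  where
  empty : Fin 0 → Fin n
  empty ()
function-search (suc k) n P P? resp = map′ (λ (y , f , Pf) → cons y f , Pf)
    (λ (f , Pf) → f zero , (λ x → f (suc x)) , resp (λ { zero → refl ; (suc x) → refl }) Pf)
    (Fin.any? (λ y → function-search k n (λ f → P (cons y f)) (λ f → P? (cons y f))
      (λ e → resp (λ { zero → refl ; (suc x) → e x }))))
  where
  cons : Fin n → (Fin k → Fin n) → Fin (suc k) → Fin n
  cons y f zero    = y
  cons y f (suc x) = f x

-- Decidability turns the mere absurdity of freeness into a member of the family and an embedding of
-- it, from which the forest is read off.
embeds? : ∀ H {n} (a : Fin n → Fin n → Bool) → Dec (Embeds H a)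
embeds? H {n} a = function-search (order H) n _
  (λ f → map′ (λ inj {x} {y} → inj x y) (λ inj x y → inj) (Fin.all? (λ x → Fin.all? (λ y → (f x ≟ f y) →-dec (x ≟ y))))
    ×-dec Fin.all? (λ u → Fin.all? (λ w → (adj H u w Bool.≟ true) →-dec (a (f u) (f w) Bool.≟ true))))
  (λ f≗g (inj , hom) → (λ {x} {y} e → inj (trans (f≗g x) (trans e (sym (f≗g y))))) , λ u w ad → trans
    (sym (cong₂ a (f≗g u) (f≗g w))) (hom u w ad))

module _ {I : Set} (𝓗 : I → Graph) where

  embeds⇒¬free : ∀ i (A : Graph) → Embeds (𝓗 i) (adj A) → ¬ Free 𝓗 A
  embeds⇒¬free i A (f , f-inj , f-hom) free = free (i , pullback A f , (refl , f-hom) , (f , f-inj , λ u w → refl))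

  ¬embeds⇒free : ∀ (A : Graph) → (∀ i → ¬ Embeds (𝓗 i) (adj A)) → Free 𝓗 A
  ¬embeds⇒free A none (i , H′ , (refl , super) , (φ , φ-inj , φ-iso)) =
    none i (φ , φ-inj , λ u w ad → trans (sym (φ-iso u w)) (super u w ad))

walk-along : ∀ {n} {b : Fin n → Fin n → Bool} L (c : Fin (suc L) → Fin n) → (∀ i → b (c (inject₁ i)) (c (suc i)) ≡ true) →
  Walk b L (c zero) (c (fromℕ L))
walk-along zero    c path = stay
walk-along (suc L) c path = step (path zero) (walk-along L (λ i → c (suc i)) (λ i → path (suc i)))

-- The vertices outside `S` are kept as isolated ones, so that K_m^q plus this graph has the vertex
-- set of K_m^q plus `Γ` and an embedding carries over unchanged.
induced-on : (Γ : Graph) → (Fin (order Γ) → Bool) → Graph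
induced-on Γ S = record { order = order Γ ; adj = λ u w → adj Γ u w ∧ (S u ∧ S w)
  ; adjSym = λ u w → cong₂ _∧_ (adjSym Γ u w) (∧-comm (S u) (S w)) ; irrefl = λ u → cong (_∧ (S u ∧ S u)) (irrefl Γ u) }

-- `S` has at most k elements, so a cycle on it has at most k ≤ g vertices. Going along it from the
-- first vertex to the last avoids the closing edge, contrary to the girth.
high-girth-forest : ∀ {n g D} (H : HighGirth n g D) → let Γ = record { order = n ; adj = HighGirth.a H ; adjSym = HighGirth.a-sym H ; irrefl = HighGirth.a-irr H } in
  ∀ (S : Fin n → Bool) k (f : Fin k → Fin n) → (∀ t → S t ≡ true → ∃ λ x → f x ≡ t) → k ≤ g → Forest (induced-on Γ S)
high-girth-forest {n} {g} H S k f covered k≤g (r , c , c-inj , path , closing) =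
  girth (c zero) (c (fromℕ (2 + r))) (trans (a-sym _ _) (proj₁ (∧-true closing)))
    (walk-≤ short (walk-along (2 + r) c along))
  where
  open HighGirth H
  on-S : ∀ i → S (c i) ≡ true
  on-S zero    = proj₁ (∧-true (proj₂ (∧-true {a (c zero) (c (suc zero))} (path zero))))
  on-S (suc i) = proj₂ (∧-true {S (c (inject₁ i))} (proj₂ (∧-true {a (c (inject₁ i)) (c (suc i))} (path i))))
  origin : Fin (3 + r) → Fin k
  origin i = proj₁ (covered (c i) (on-S i))
  origin-inj : Injective _≡_ _≡_ origin
  origin-inj {i} {i′} e = c-inj (trans (sym (proj₂ (covered (c i) (on-S i))))
    (trans (cong f e) (proj₂ (covered (c i′) (on-S i′)))))
  short : 2 + r ≤ g
  short = ≤-trans (n≤1+n (2 + r)) (≤-trans (Fin.injective⇒≤ origin-inj) k≤g)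
  along : ∀ i → without-edge (c zero) (c (fromℕ (2 + r))) a (c (inject₁ i)) (c (suc i)) ≡ true
  along i = true-∧ (proj₁ (∧-true (path i)))
    (not-closing (link (c zero) (c (fromℕ (2 + r))) (c (inject₁ i)) (c (suc i))) refl)
    where
    not-closing : ∀ b → link (c zero) (c (fromℕ (2 + r))) (c (inject₁ i)) (c (suc i)) ≡ b → not b ≡ true
    not-closing false _ = refl
    not-closing true e with link-cases (c zero) (c (fromℕ (2 + r))) (c (inject₁ i)) (c (suc i)) e
    ... | inj₂ (last , _) = ⊥-elim (Fin.fromℕ≢inject₁ (sym (c-inj last)))
    ... | inj₁ (first , last) = ⊥-elim (ends i (c-inj first) (c-inj last))
      -- Coincidence with the closing edge would force i = 0 and make its successor the last index,
      -- but a cycle has at least three vertices.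
      where
      ends : ∀ (i : Fin (2 + r)) → inject₁ i ≡ zero → suc i ≡ fromℕ (2 + r) → ⊥
      ends zero _ ()

module _ {I : Set} (𝓗 : I → Graph) (m′ : ℕ) (k : ℕ) (I↔k : I ↔ Fin k) (K : ℕ)
  (stable : ∀ G → Free 𝓗 G → K ≤ order G → ∀ ex → IsEx 𝓗 (order G) ex →
    Σ (Fin (order G) → Fin (suc m′)) λ p → (editDist G p * order G ≤ K * (order G C 2)) ⊎ (editDist G p ≤ K * (ex ∸ edges G))) where

  private
    -- Robust stability at deficit 0 allows 2d ≤ K·N with N = m·n, so `Γ` must have more than K·m·n
    -- ordered adjacent pairs. Saturation provides D(n - B) of them; n > 2B makes this at least (K·m
    -- + 1)·n, and n > K meets the threshold. The sum `h` bounds the order of each member.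
    m h D B n : ℕ
    m = suc m′
    member : Fin k → Graph
    member i = 𝓗 (Inverse.from I↔k i)
    h = ∑ (V k) (λ i → order (member i))
    D = 2 * (K * m + 1)
    B = ball-size D (suc h)
    n = suc (2 * B + K)

  dense-forces : ∀ Γ → order Γ ≡ n → D * n ≤ pairs (adj Γ) + D * B → ¬ Free 𝓗 (KmqPlus m zero Γ)
  dense-forces Γ size dense free = extremal-graph 𝓗 m′ zero Γ free contradiction
    where
    dense′ : (K * m + 1) * n ≤ pairs (adj Γ)
    dense′ = *-cancelˡ-≤ 2 (lin (2 * (K * m + 1) * (1 + K)) (*-monoʳ-≤ 2 dense) (eq (K * m + 1) B K (pairs (adj Γ))))
      where
      eq : ∀ d B K P → let n = 1 + (2 * B + K) in 2 * (d * n) + 2 * (P + 2 * d * B) + 2 * d * (1 + K) ≡ 2 * P + 2 * (2 * d * n)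
      eq = solve-∀
    strict : suc (K * (m * n)) ≤ pairs (adj Γ)
    strict = ≤-trans (lin (2 * B + K) (≤-refl {0}) (eq K m n′)) dense′
      where
      n′ : ℕ
      n′ = 2 * B + K
      eq : ∀ K m n → 1 + K * (m * (1 + n)) + 0 + n ≡ (K * m + 1) * (1 + n) + 0
      eq = solve-∀
    contradiction : ¬ (Σ Graph λ G → Free 𝓗 G × order G ≡ m * order Γ × IsEx 𝓗 (order G) (edges G) ×
      (∀ (p : Fin (order G) → Fin m) → edges Γ ≤ editDist G p))
    contradiction (G , free-G , size-G , is-ex , far) = by-case (proj₂ near)
      where
      N d : ℕ
      N = order G
      N≡ : N ≡ m * n
      N≡ = trans size-G (cong (m *_) size)
      N≥ : suc (2 * B + K) ≤ N
      N≥ = ≤-trans (m≤m+n n (m′ * n)) (≤-reflexive (sym N≡))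
      near : Σ (Fin N → Fin m) λ p → (editDist G p * N ≤ K * (N C 2)) ⊎ (editDist G p ≤ K * (edges G ∸ edges G))
      near = stable G free-G (≤-trans (≤-trans (m≤n+m K (2 * B)) (n≤1+n _)) N≥) (edges G) is-ex
      d = editDist G (proj₁ near)
      pairs≤2d : pairs (adj Γ) ≤ 2 * d
      pairs≤2d = ≤-trans (≤-reflexive (pairs-edges Γ)) (*-monoʳ-≤ 2 (far (proj₁ near)))
      by-case : (d * N ≤ K * (N C 2)) ⊎ (d ≤ K * (edges G ∸ edges G)) → ⊥
      by-case (inj₁ le) = 1+n≰n (≤-trans strict (≤-trans pairs≤2d (≤-trans few (≤-reflexive (cong (K *_) N≡)))))
        where
        few : 2 * d ≤ K * N
        few = *-cancelʳ-≤ (2 * d) (K * N) N ⦃ >-nonZero (≤-trans (s≤s z≤n) N≥) ⦄ (begin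
          2 * d * N ≡⟨ *-assoc 2 d N ⟩
          2 * (d * N) ≤⟨ *-monoʳ-≤ 2 le ⟩
          2 * (K * (N C 2)) ≡⟨ eq K (N C 2) ⟩
          K * (2 * (N C 2)) ≤⟨ *-monoʳ-≤ K (≤-trans (m≤m+n (2 * (N C 2)) N) (≤-reflexive (2*C2 N))) ⟩
          K * (N * N) ≡⟨ sym (*-assoc K N N) ⟩
          K * N * N ∎)
          where
          open ≤-Reasoning
          eq : ∀ K c → 2 * (K * c) ≡ K * (2 * c)
          eq = solve-∀
      by-case (inj₂ le) = 1+n≰n (≤-trans (≤-trans (s≤s z≤n) strict) (≤-trans pairs≤2d (≤-trans (*-monoʳ-≤ 2 le)
        (≤-reflexive (cong (2 *_) (trans (cong (K *_) (n∸n≡0 (edges G))) (*-zeroʳ K)))))))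

  -- Some member embeds in K_m^n plus `Γ`, for otherwise `dense-forces` is contradicted. Only the
  -- edges of `Γ` between indices it hits are used. Collecting the indices from all parts still
  -- gives no more of them than the member has vertices.
  robustly-stable⇒critical-forest : Σ Graph λ F → Σ (Fin m) λ j → Forest F × ¬ Free 𝓗 (KmqPlus m j F)
  robustly-stable⇒critical-forest = extract (Fin.any? (λ i → embeds? (member i) (adj A)))
    where
    saturated : Σ (HighGirth n (suc h) D) λ H → D * n ≤ pairs (HighGirth.a H) + D * B
    saturated = saturate n h D
    H : HighGirth n (suc h) D
    H = proj₁ saturated
    Γ A : Graph
    Γ = record { order = n ; adj = HighGirth.a H ; adjSym = HighGirth.a-sym H ; irrefl = HighGirth.a-irr H }
    A = KmqPlus m zero Γ
    index : Fin (m * n) → Fin n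
    index u = proj₂ (remQuot {m} n u)
    extract : Dec (∃ λ i → Embeds (member i) (adj A)) → Σ Graph λ F → Σ (Fin m) λ j → Forest F × ¬ Free 𝓗 (KmqPlus m j F)
    extract (no none) = ⊥-elim (dense-forces Γ refl (proj₂ saturated) (¬embeds⇒free 𝓗 A
      (λ i emb → none (Inverse.to I↔k i , subst (λ x → Embeds (𝓗 x) (adj A)) (sym (Inverse.strictlyInverseʳ I↔k i)) emb))))
    extract (yes (i , f , f-inj , f-hom)) = F , zero ,
        high-girth-forest H S (order (member i)) (λ v → index (f v)) (λ t e → true-⌊⌋ (Fin.any? (λ v → index (f v) ≟ t)) e)
          (≤-trans (∑-∈ (λ i → order (member i)) (∈V i)) (n≤1+n h)) ,
        embeds⇒¬free 𝓗 (Inverse.from I↔k i) (KmqPlus m zero F) (f , f-inj , λ u w ad → keep u w (f-hom u w ad))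
      where
      S : Fin n → Bool
      S t = ⌊ Fin.any? (λ v → index (f v) ≟ t) ⌋
      F : Graph
      F = induced-on Γ S
      hit : ∀ v → S (index (f v)) ≡ true
      hit v = ⌊⌋-true (Fin.any? (λ x → index (f x) ≟ index (f v))) (v , refl)
      keep : ∀ u w → adj A (f u) (f w) ≡ true → adj (KmqPlus m zero F) (f u) (f w) ≡ true
      keep u w = keep-dec (proj₁ (remQuot {m} n (f u)) ≟ proj₁ (remQuot {m} n (f w)))
        where
        keep-dec : ∀ (d : Dec (proj₁ (remQuot {m} n (f u)) ≡ proj₁ (remQuot {m} n (f w)))) {b} →
          kadjD d (b ∧ adj Γ (index (f u)) (index (f w))) ≡ true → kadjD d (b ∧ adj F (index (f u)) (index (f w))) ≡ true
        keep-dec (no _)  e = refl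
        keep-dec (yes _) {b} e = true-∧ {b} (proj₁ (∧-true {b} e)) (true-∧ (proj₂ (∧-true {b} e)) (true-∧ (hit u) (hit w)))

theorem1p11 : (I : Set) (𝓗 : I → Graph) (m : ℕ) → 2 ≤ m → MinChromatic 𝓗 (suc m) →
    (PerfectlyStable 𝓗 m ⇔
    (Σ Graph λ F → Σ (Fin m) λ j → edges F ≡ 1 × ¬ Free 𝓗 (KmqPlus m j F)))
    ×
    (FiniteIndex I → (RobustlyStable 𝓗 m ⇔
    (Σ Graph λ F → Σ (Fin m) λ j → Forest F × ¬ Free 𝓗 (KmqPlus m j F))))
theorem1p11 I 𝓗 (suc m′) _ (uncolorable , _) =
  mk⇔ (perfectly-stable⇒critical-edge 𝓗 m′)
    (λ (F , j , one , forced) → critical-edge⇒perfectly-stable 𝓗 m′ uncolorable j F forced (single-edge F one)) ,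
  λ (k , I↔k) → mk⇔ (λ (K , stable) → robustly-stable⇒critical-forest 𝓗 m′ k I↔k K stable)
    (λ (F , j , forest , forced) → critical-forest⇒robustly-stable 𝓗 m′ uncolorable j F forced forest)
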